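{- There exist constants $C>0$ and $x_0$ such that for all real $x\ge x_0$, $$\sum_{p<x} f_1(p)\le C\,x\,(\log x)^5(\log\log x)^2,$$ where the sum runs over prime numbers $p<x$, and for a prime $p$, $f_1(p)$ denotes the number of triples $(n_1,n_2,n_3)$ of positive integers satisfying $$\frac{4}{p}=\frac{1}{n_1}+\frac{1}{n_2}+\frac{1}{n_3}$$ such that exactly one of the denominators $n_1,n_2,n_3$ is divisible by $p$.
   Context: Triples $(n_1,n_2,n_3)$ are ordered triples of positive integers. $\log$ is the natural logarithm. -}

module Defs where

open import Algebra.Bundles using (CommutativeRing; Semiring)
import Algebra.Definitions.RawSemiring as RawSemiringDefinitions
open import Data.Empty using (⊥-elim)
open import Data.Integer using (+_)
import Data.Integer.Properties as ℤ
open import Data.List using (List; []; _∷_; _∷ʳ_; cartesianProduct; filter; length; map; sum; upTo)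
open import Data.List.Membership.Propositional using (_∈_)
open import Data.List.Membership.Propositional.Properties
  using (∈-cartesianProduct⁺; ∈-filter⁺; ∈-filter⁻; ∈-upTo⁺)
open import Data.List.Relation.Unary.Linked using (Linked; [-]; _∷_)
open import Data.List.Relation.Unary.Unique.Propositional using (Unique)
import Data.List.Relation.Unary.Unique.Propositional.Properties as Unique
import Data.Nat
open import Data.Nat as ℕ using (ℕ; zero; suc; NonZero; s≤s; z≤n)
open import Data.Nat.Divisibility using (_∣_; _∣?_)
open import Data.Nat.Primality using (Prime; prime?)
import Data.Nat.Properties as ℕ
open import Data.Nat.Solver using (module +-*-Solver)
open import Data.Product using (∃; _×_; _,_; proj₁; proj₂)
open import Data.Rational as ℚ using (_/_)
import Data.Rational.Properties as ℚ
open import Data.Rational.Unnormalised as ℚᵘ using (mkℚᵘ; *≡*)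
import Data.Rational.Unnormalised.Properties as ℚᵘ
open import Data.Sum using (_⊎_; inj₁; inj₂)
open import Function.Bundles using (_⇔_; mk⇔)
open import Level using (0ℓ)
open import Relation.Binary.Core using (Rel)
import Relation.Binary.Construct.StrictToNonStrict as StrictToNonStrict
open import Relation.Binary.Definitions using (tri<; tri≈; tri>)
open import Relation.Binary.PropositionalEquality
  using (_≡_; refl; sym; trans; subst)
open import Relation.Binary.Structures using (IsStrictTotalOrder)
open import Relation.Nullary using (¬_; Dec; yes; no)
open import Relation.Nullary.Decidable using (¬?; _×-dec_; _⊎-dec_)

ExactlyOne : Set → Set → Set → Set
ExactlyOne A B C =
  (A × ¬ B × ¬ C) ⊎ (¬ A × B × ¬ C) ⊎ (¬ A × ¬ B × C)

exactlyOne? : ∀ {A B C} → Dec A → Dec B → Dec C → Dec (ExactlyOne A B C)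
exactlyOne? a b c =
  (a ×-dec ¬? b ×-dec ¬? c) ⊎-dec
  (¬? a ×-dec b ×-dec ¬? c) ⊎-dec
  (¬? a ×-dec ¬? b ×-dec c)

record IsSolution₁ (p n₁ n₂ n₃ : ℕ) : Set where
  field
    {{p≢0}}  : NonZero p
    {{n₁≢0}} : NonZero n₁
    {{n₂≢0}} : NonZero n₂
    {{n₃≢0}} : NonZero n₃
    equation : (+ 4) / p ≡ ((+ 1) / n₁ ℚ.+ (+ 1) / n₂) ℚ.+ (+ 1) / n₃
    oneMultiple : ExactlyOne (p ∣ n₁) (p ∣ n₂) (p ∣ n₃)

Triple : Set
Triple = ℕ × ℕ × ℕ

Solves₁ : ℕ → Triple → Set
Solves₁ p (n₁ , n₂ , n₃) = IsSolution₁ p n₁ n₂ n₃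

solves₁? : ∀ p t → Dec (Solves₁ p t)
solves₁? zero (n₁ , n₂ , n₃) = no λ s → ℕ.≢-nonZero⁻¹ 0 {{IsSolution₁.p≢0 s}} refl
solves₁? (suc _) (zero , n₂ , n₃) = no λ s → ℕ.≢-nonZero⁻¹ 0 {{IsSolution₁.n₁≢0 s}} refl
solves₁? (suc _) (suc _ , zero , n₃) = no λ s → ℕ.≢-nonZero⁻¹ 0 {{IsSolution₁.n₂≢0 s}} refl
solves₁? (suc _) (suc _ , suc _ , zero) = no λ s → ℕ.≢-nonZero⁻¹ 0 {{IsSolution₁.n₃≢0 s}} refl
solves₁? p@(suc _) (n₁@(suc _) , n₂@(suc _) , n₃@(suc _))
  with (+ 4) / p ℚ.≟ ((+ 1) / n₁ ℚ.+ (+ 1) / n₂) ℚ.+ (+ 1) / n₃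
     | exactlyOne? (p ∣? n₁) (p ∣? n₂) (p ∣? n₃)
... | yes e | yes d = yes (record { equation = e ; oneMultiple = d })
... | no ¬e | _     = no λ s → ¬e (IsSolution₁.equation s)
... | yes _ | no ¬d = no λ s → ¬d (IsSolution₁.oneMultiple s)

-- Every solution satisfies nᵢ ≤ 2p⁴ (see solution-bound), so the search box
-- below loses none of them.
solutions₁ : ℕ → List Triple
solutions₁ p = filter (solves₁? p)
  (cartesianProduct range (cartesianProduct range range))
  where range = upTo (suc (2 ℕ.* p ℕ.^ 4))

f₁ : ℕ → ℕ
f₁ p = length (solutions₁ p)

module Bound where
  open Data.Nat using (_≤_; _<_; _+_; _*_; _^_)
  open ℕ.≤-Reasoning
  open +-*-Solver

  Cleared : ℕ → ℕ → ℕ → ℕ → Set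
  Cleared p a b c = 4 * (a * b * c) ≡ p * (b * c + a * c + a * b)

  gap : ∀ x y n r → x * n ≡ y * n + r → 0 < r → n ≤ r
  gap x y n r e 0<r = ℕ.+-cancelʳ-≤ (y * n) n r (begin
    n + y * n  ≤⟨ ℕ.*-monoˡ-≤ n y<x ⟩
    x * n      ≡⟨ e ⟩
    y * n + r  ≡⟨ ℕ.+-comm (y * n) r ⟩
    r + y * n  ∎)
    where
    y<x : y < x
    y<x = ℕ.*-cancelʳ-< n y x
      (subst (y * n <_) (sym e) (ℕ.m<m+n (y * n) 0<r))

  sorted-bound : ∀ p a b c .{{_ : NonZero p}} .{{_ : NonZero a}}
                 .{{_ : NonZero b}} .{{_ : NonZero c}} →
                 Cleared p a b c → a ≤ b → b ≤ c → c ≤ 2 * p ^ 4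
  sorted-bound p@(suc _) a@(suc _) b@(suc _) c@(suc _) e a≤b b≤c = begin
    c                    ≤⟨ c≤pab ⟩
    p * (a * b)          ≤⟨ ℕ.*-monoʳ-≤ p (ℕ.*-mono-≤ a≤p b≤2pp) ⟩
    p * (p * (2 * p * p))
      ≡⟨ solve 1 (λ p → p :* (p :* (con 2 :* p :* p)) := con 2 :* (p :^ 4)) refl p ⟩
    2 * p ^ 4            ∎
    where
    a≤c : a ≤ c
    a≤c = ℕ.≤-trans a≤b b≤c

    4a≤3p : 4 * a ≤ 3 * p
    4a≤3p = ℕ.*-cancelʳ-≤ (4 * a) (3 * p) (b * c) (begin
      4 * a * (b * c)
        ≡⟨ solve 3 (λ a b c → con 4 :* a :* (b :* c) := con 4 :* (a :* b :* c)) refl a b c ⟩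
      4 * (a * b * c)
        ≡⟨ e ⟩
      p * (b * c + a * c + a * b)
        ≤⟨ ℕ.*-monoʳ-≤ p (ℕ.+-mono-≤ (ℕ.+-monoʳ-≤ (b * c) (ℕ.*-monoˡ-≤ c a≤b))
             (ℕ.≤-trans (ℕ.*-monoˡ-≤ b a≤c) (ℕ.≤-reflexive (ℕ.*-comm c b)))) ⟩
      p * (b * c + b * c + b * c)
        ≡⟨ solve 2 (λ p x → p :* (x :+ x :+ x) := con 3 :* p :* x) refl p (b * c) ⟩
      3 * p * (b * c)  ∎)

    a≤p : a ≤ p
    a≤p = ℕ.*-cancelˡ-≤ 3 (ℕ.≤-trans (ℕ.*-monoˡ-≤ a (ℕ.n≤1+n 3)) 4a≤3p)

    b≤2pp : b ≤ 2 * p * p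
    b≤2pp = ℕ.≤-trans (ℕ.*-cancelʳ-≤ b (2 * p * a) c (begin
      b * c                ≤⟨ gap (4 * a) p (b * c) (p * (a * c + a * b)) e′ (s≤s z≤n) ⟩
      p * (a * c + a * b)  ≤⟨ ℕ.*-monoʳ-≤ p (ℕ.+-monoʳ-≤ (a * c) (ℕ.*-monoʳ-≤ a b≤c)) ⟩
      p * (a * c + a * c)
        ≡⟨ solve 3 (λ p a c → p :* (a :* c :+ a :* c) := con 2 :* p :* a :* c) refl p a c ⟩
      2 * p * a * c        ∎)) (ℕ.*-monoʳ-≤ (2 * p) a≤p)
      where
      e′ : 4 * a * (b * c) ≡ p * (b * c) + p * (a * c + a * b)
      e′ = trans
        (solve 3 (λ a b c → con 4 :* a :* (b :* c) := con 4 :* (a :* b :* c)) refl a b c)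
        (trans e (solve 4 (λ p x y z → p :* (x :+ y :+ z) := p :* x :+ p :* (y :+ z))
                   refl p (b * c) (a * c) (a * b)))

    c≤pab : c ≤ p * (a * b)
    c≤pab = gap (4 * (a * b)) (p * (a + b)) c (p * (a * b)) e′ (s≤s z≤n)
      where
      e′ : 4 * (a * b) * c ≡ p * (a + b) * c + p * (a * b)
      e′ = trans (ℕ.*-assoc 4 (a * b) c)
        (trans e (solve 4 (λ p a b c → p :* (b :* c :+ a :* c :+ a :* b) :=
                                       p :* (a :+ b) :* c :+ p :* (a :* b)) refl p a b c))

  swap₁₂ : ∀ p a b c → Cleared p a b c → Cleared p b a c
  swap₁₂ p a b c e = trans
    (solve 3 (λ a b c → con 4 :* (b :* a :* c) := con 4 :* (a :* b :* c)) refl a b c)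
    (trans e (solve 4 (λ p a b c → p :* (b :* c :+ a :* c :+ a :* b) :=
                                   p :* (a :* c :+ b :* c :+ b :* a)) refl p a b c))

  swap₂₃ : ∀ p a b c → Cleared p a b c → Cleared p a c b
  swap₂₃ p a b c e = trans
    (solve 3 (λ a b c → con 4 :* (a :* c :* b) := con 4 :* (a :* b :* c)) refl a b c)
    (trans e (solve 4 (λ p a b c → p :* (b :* c :+ a :* c :+ a :* b) :=
                                   p :* (c :* b :+ a :* b :+ a :* c)) refl p a b c))

  third-bound : ∀ p a b c .{{_ : NonZero p}} .{{_ : NonZero a}}
                .{{_ : NonZero b}} .{{_ : NonZero c}} →
                Cleared p a b c → c ≤ 2 * p ^ 4
  third-bound p a b c e with ℕ.≤-total a b | ℕ.≤-total a c | ℕ.≤-total b c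
  ... | inj₁ a≤b | _        | inj₁ b≤c = sorted-bound p a b c e a≤b b≤c
  ... | inj₂ b≤a | inj₁ a≤c | _        = sorted-bound p b a c (swap₁₂ p a b c e) b≤a a≤c
  ... | inj₁ a≤b | inj₁ a≤c | inj₂ c≤b =
    ℕ.≤-trans c≤b (sorted-bound p a c b (swap₂₃ p a b c e) a≤c c≤b)
  ... | inj₁ a≤b | inj₂ c≤a | inj₂ c≤b = ℕ.≤-trans (ℕ.≤-trans c≤a a≤b)
    (sorted-bound p c a b (swap₁₂ p a c b (swap₂₃ p a b c e)) c≤a a≤b)
  ... | inj₂ b≤a | inj₂ c≤a | inj₁ b≤c = ℕ.≤-trans c≤a
    (sorted-bound p b c a (swap₂₃ p b a c (swap₁₂ p a b c e)) b≤c c≤a)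
  ... | inj₂ b≤a | inj₂ c≤a | inj₂ c≤b = ℕ.≤-trans c≤a
    (sorted-bound p c b a
      (swap₁₂ p b c a (swap₂₃ p b a c (swap₁₂ p a b c e))) c≤b b≤a)

  clear : ∀ p a b c .{{_ : NonZero p}} .{{_ : NonZero a}}
          .{{_ : NonZero b}} .{{_ : NonZero c}} →
          (+ 4) / p ≡ ((+ 1) / a ℚ.+ (+ 1) / b) ℚ.+ (+ 1) / c → Cleared p a b c
  clear (suc p′) (suc a′) (suc b′) (suc c′) e with unnormalised
    where
    u : ℕ → ℚᵘ.ℚᵘ
    u n = mkℚᵘ (+ 1) n

    unnormalised : mkℚᵘ (+ 4) p′ ℚᵘ.≃ (u a′ ℚᵘ.+ u b′) ℚᵘ.+ u c′
    unnormalised =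
      ℚᵘ.≃-trans (ℚᵘ.≃-sym (ℚ.toℚᵘ-fromℚᵘ (mkℚᵘ (+ 4) p′)))
      (ℚᵘ.≃-trans (ℚ.toℚᵘ-cong e)
      (ℚᵘ.≃-trans (ℚ.toℚᵘ-homo-+ ((+ 1) / suc a′ ℚ.+ (+ 1) / suc b′) ((+ 1) / suc c′))
      (ℚᵘ.+-cong
        (ℚᵘ.≃-trans (ℚ.toℚᵘ-homo-+ ((+ 1) / suc a′) ((+ 1) / suc b′))
          (ℚᵘ.+-cong (ℚ.toℚᵘ-fromℚᵘ (u a′)) (ℚ.toℚᵘ-fromℚᵘ (u b′))))
        (ℚ.toℚᵘ-fromℚᵘ (u c′)))))
  ... | *≡* eq = trans (ℤ.+-injective eq)
    (solve 4 (λ p a b c →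
        ((con 1 :* b :+ con 1 :* a) :* c :+ con 1 :* (a :* b)) :* p :=
        p :* (b :* c :+ a :* c :+ a :* b))
      refl (suc p′) (suc a′) (suc b′) (suc c′))

solution-bound : ∀ {p n₁ n₂ n₃} → IsSolution₁ p n₁ n₂ n₃ →
                 n₁ ℕ.≤ 2 ℕ.* p ℕ.^ 4 × n₂ ℕ.≤ 2 ℕ.* p ℕ.^ 4 × n₃ ℕ.≤ 2 ℕ.* p ℕ.^ 4
solution-bound {p} {a} {b} {c} s =
    third-bound p b c a (swap₂₃ p b a c (swap₁₂ p a b c e))
  , third-bound p a c b (swap₂₃ p a b c e)
  , third-bound p a b c e
  where
  open IsSolution₁ s
  open Bound
  e : Cleared p a b c
  e = clear p a b c equation

∈-solutions₁ : ∀ p t → t ∈ solutions₁ p ⇔ Solves₁ p t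
∈-solutions₁ p t = mk⇔ (λ t∈ → proj₂ (∈-filter⁻ (solves₁? p) t∈)) λ s →
  let b₁ , b₂ , b₃ = solution-bound s in
  ∈-filter⁺ (solves₁? p)
    (∈-cartesianProduct⁺ (∈-upTo⁺ (s≤s b₁))
      (∈-cartesianProduct⁺ (∈-upTo⁺ (s≤s b₂)) (∈-upTo⁺ (s≤s b₃)))) s

solutions₁-unique : ∀ p → Unique (solutions₁ p)
solutions₁-unique p = Unique.filter⁺ (solves₁? p)
  (Unique.cartesianProduct⁺ range! (Unique.cartesianProduct⁺ range! range!))
  where range! = Unique.upTo⁺ (suc (2 ℕ.* p ℕ.^ 4))

-- The real field is taken to be any complete ordered field; these are
-- classically all isomorphic.  The Archimedean property is classically a consequence of
-- completeness; it is listed separately to have the witness as data.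
record CompleteOrderedField : Set₁ where
  infix 4 _<_
  infix 9 _⁻¹
  field
    commutativeRing : CommutativeRing 0ℓ 0ℓ
  open CommutativeRing commutativeRing public
    using (Carrier; _≈_; _≉_; _+_; _*_; -_; _-_; 0#; 1#; ring; semiring)
  open RawSemiringDefinitions (Semiring.rawSemiring semiring) public
    using (_^_) renaming (_×_ to _·_)

  fromℕ : ℕ → Carrier
  fromℕ n = n · 1#

  field
    _⁻¹ : Carrier → Carrier      -- unconstrained at 0#
    _<_ : Rel Carrier 0ℓ
    isStrictTotalOrder : IsStrictTotalOrder _≈_ _<_
  open IsStrictTotalOrder isStrictTotalOrder public
    using (compare; _<?_)
  open StrictToNonStrict _≈_ _<_ public using (_≤_)

  UpperBound : (Carrier → Set) → Carrier → Set
  UpperBound P u = ∀ {x} → P x → x ≤ u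

  IsSupremum : (Carrier → Set) → Carrier → Set
  IsSupremum P s = UpperBound P s × (∀ u → UpperBound P u → s ≤ u)

  field
    0<1          : 0# < 1#
    ⁻¹-inverse   : ∀ {x} → x ≉ 0# → x ⁻¹ * x ≈ 1#
    +-monoˡ-<    : ∀ {x y} z → x < y → x + z < y + z
    *-positive   : ∀ {x y} → 0# < x → 0# < y → 0# < x * y
    archimedean  : ∀ x → ∃ λ n → x < fromℕ n
    completeness : (P : Carrier → Set) → ∃ P → ∃ (UpperBound P) → ∃ (IsSupremum P)

module RealFunctions (ℝ : CompleteOrderedField) where

  open CompleteOrderedField ℝ public

  module Properties where
    module R = CommutativeRing commutativeRing
    module O = IsStrictTotalOrder isStrictTotalOrder
    module SN = StrictToNonStrict _≈_ _<_

    <-respˡ : ∀ {x y z} → x ≈ y → x < z → y < z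
    <-respˡ = O.<-respˡ-≈
    <-respʳ : ∀ {x y z} → x ≈ y → z < x → z < y
    <-respʳ = O.<-respʳ-≈

    ≤-trans : ∀ {x y z} → x ≤ y → y ≤ z → x ≤ z
    ≤-trans = SN.trans R.isEquivalence O.<-resp-≈ O.trans

    <-≤-trans : ∀ {x y z} → x < y → y ≤ z → x < z
    <-≤-trans = SN.<-≤-trans O.trans (proj₁ O.<-resp-≈)

    ≤-respˡ : ∀ {x y z} → x ≈ y → x ≤ z → y ≤ z
    ≤-respˡ e (inj₁ l) = inj₁ (<-respˡ e l)
    ≤-respˡ e (inj₂ f) = inj₂ (R.trans (R.sym e) f)

    ≤-respʳ : ∀ {x y z} → x ≈ y → z ≤ x → z ≤ y
    ≤-respʳ e (inj₁ l) = inj₁ (<-respʳ e l)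
    ≤-respʳ e (inj₂ f) = inj₂ (R.trans f e)

    +-monoˡ-≤ : ∀ {x y} z → x ≤ y → x + z ≤ y + z
    +-monoˡ-≤ z (inj₁ l) = inj₁ (+-monoˡ-< z l)
    +-monoˡ-≤ z (inj₂ e) = inj₂ (R.+-congʳ e)

    +-monoʳ-≤ : ∀ {x y} z → x ≤ y → z + x ≤ z + y
    +-monoʳ-≤ z l = ≤-respˡ (R.+-comm _ z) (≤-respʳ (R.+-comm _ z) (+-monoˡ-≤ z l))

    -‿cancel : ∀ x y → (x - y) + y ≈ x
    -‿cancel x y = R.trans (R.+-assoc x (- y) y)
      (R.trans (R.+-congˡ (R.-‿inverseˡ y)) (R.+-identityʳ x))

    telescope : ∀ x y z → (y - x) + (z - y) ≈ z - x
    telescope x y z = R.trans (R.+-comm _ _)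
      (R.trans (R.sym (R.+-assoc (z - y) y (- x))) (R.+-congʳ (-‿cancel z y)))

    <⇒0<- : ∀ {x y} → x < y → 0# < y - x
    <⇒0<- {x} l = <-respˡ (R.-‿inverseʳ x) (+-monoˡ-< (- x) l)

    ≤⇒0≤- : ∀ {x y} → x ≤ y → 0# ≤ y - x
    ≤⇒0≤- {x} l = ≤-respˡ (R.-‿inverseʳ x) (+-monoˡ-≤ (- x) l)

    *-monoˡ-< : ∀ {x y} z → 0# < z → x < y → x * z < y * z
    *-monoˡ-< {x} {y} z 0<z x<y =
      <-respˡ (R.+-identityˡ (x * z))
      (<-respʳ (R.trans (R.sym (R.distribʳ z (y - x) x)) (R.*-congʳ (-‿cancel y x)))
      (+-monoˡ-< (x * z) (*-positive (<⇒0<- x<y) 0<z)))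

    *-monoʳ-≤ : ∀ {x y} z → 0# ≤ z → x ≤ y → z * x ≤ z * y
    *-monoʳ-≤ z _          (inj₂ e) = inj₂ (R.*-congˡ e)
    *-monoʳ-≤ z (inj₂ 0≈z) (inj₁ _) = inj₂ (R.trans (zero-l _) (R.sym (zero-l _)))
      where
      zero-l : ∀ w → z * w ≈ 0#
      zero-l w = R.trans (R.*-congʳ (R.sym 0≈z)) (R.zeroˡ w)
    *-monoʳ-≤ z (inj₁ 0<z) (inj₁ l) =
      inj₁ (<-respˡ (R.*-comm _ z) (<-respʳ (R.*-comm _ z) (*-monoˡ-< z 0<z l)))

    >0⇒≉0 : ∀ {x} → 0# < x → x ≉ 0#
    >0⇒≉0 0<x x≈0 = O.irrefl (R.sym x≈0) 0<x

    ⁻¹-positive : ∀ {x} → 0# < x → 0# < x ⁻¹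
    ⁻¹-positive {x} 0<x with compare 0# (x ⁻¹)
    ... | tri< 0<x⁻¹ _ _ = 0<x⁻¹
    ... | tri≈ _ 0≈x⁻¹ _ = ⊥-elim (O.irrefl
      (R.trans (R.sym (R.zeroˡ x)) (R.trans (R.*-congʳ 0≈x⁻¹) (⁻¹-inverse (>0⇒≉0 0<x)))) 0<1)
    ... | tri> _ _ x⁻¹<0 = ⊥-elim (O.asym 0<1
      (<-respˡ (⁻¹-inverse (>0⇒≉0 0<x)) (<-respʳ (R.zeroˡ x) (*-monoˡ-< x 0<x x⁻¹<0))))

    1≤x⇒0<x : ∀ {x} → 1# ≤ x → 0# < x
    1≤x⇒0<x = <-≤-trans 0<1

    1≤x⇒x⁻¹≤1 : ∀ {x} → 1# ≤ x → x ⁻¹ ≤ 1#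
    1≤x⇒x⁻¹≤1 {x} 1≤x =
      ≤-respˡ (R.*-identityʳ (x ⁻¹)) (≤-respʳ (⁻¹-inverse (>0⇒≉0 (1≤x⇒0<x 1≤x)))
        (*-monoʳ-≤ (x ⁻¹) (inj₁ (⁻¹-positive (1≤x⇒0<x 1≤x))) 1≤x))

    x<1⇒1≤x⁻¹ : ∀ {x} → 0# < x → x < 1# → 1# ≤ x ⁻¹
    x<1⇒1≤x⁻¹ {x} 0<x x<1 =
      ≤-respˡ (⁻¹-inverse (>0⇒≉0 0<x)) (≤-respʳ (R.*-identityʳ (x ⁻¹))
        (*-monoʳ-≤ (x ⁻¹) (inj₁ (⁻¹-positive 0<x)) (inj₁ x<1)))

    fromℕ-mono : ∀ {m n} → m ℕ.≤ n → fromℕ m ≤ fromℕ n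
    fromℕ-mono {n = zero}  z≤n = inj₂ R.refl
    fromℕ-mono {n = suc n} z≤n = ≤-trans (fromℕ-mono {zero} {n} z≤n)
      (≤-respˡ (R.+-identityˡ (fromℕ n)) (+-monoˡ-≤ (fromℕ n) (inj₁ 0<1)))
    fromℕ-mono {suc m} {suc n} (s≤s m≤n) = +-monoʳ-≤ 1# (fromℕ-mono {m} {n} m≤n)

  open Properties

  -- The lower Darboux sum Σ (tᵢ₊₁ - tᵢ) / tᵢ₊₁ of the decreasing function
  -- t ↦ 1/t over a list of division points t₀ ≤ t₁ ≤ ⋯ ≤ tₖ.
  lowerSum : List Carrier → Carrier
  lowerSum (s ∷ t ∷ ts) = (t - s) * t ⁻¹ + lowerSum (t ∷ ts)
  lowerSum _            = 0#

  IsLowerSum : Carrier → Carrier → Set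
  IsLowerSum x r = ∃ λ ts → Linked _≤_ (1# ∷ ts ∷ʳ x) × r ≈ lowerSum (1# ∷ ts ∷ʳ x)

  private
    lowerSum-bound : ∀ s ts x → 1# ≤ s → Linked _≤_ (s ∷ ts ∷ʳ x) →
                     lowerSum (s ∷ ts ∷ʳ x) ≤ x - s
    step : ∀ s t → 1# ≤ s → s ≤ t → (t - s) * t ⁻¹ ≤ t - s
    step s t 1≤s s≤t = ≤-respʳ (R.*-identityʳ (t - s))
      (*-monoʳ-≤ (t - s) (≤⇒0≤- s≤t) (1≤x⇒x⁻¹≤1 (≤-trans 1≤s s≤t)))
    lowerSum-bound s [] x 1≤s (s≤x ∷ [-]) =
      ≤-respˡ (R.sym (R.+-identityʳ _)) (step s x 1≤s s≤x)
    lowerSum-bound s (t ∷ ts) x 1≤s (s≤t ∷ l) = ≤-respʳ (telescope s t x)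
      (≤-trans (+-monoˡ-≤ _ (step s t 1≤s s≤t))
               (+-monoʳ-≤ (t - s) (lowerSum-bound t ts x (≤-trans 1≤s s≤t) l)))

  -- ∫₁ˣ dt/t, as the supremum of the lower Darboux sums.
  ∫₁dt/t : ∀ x → 1# ≤ x → ∃ (IsSupremum (IsLowerSum x))
  ∫₁dt/t x 1≤x = completeness (IsLowerSum x)
    (_ , [] , 1≤x ∷ [-] , R.refl)
    (x - 1# , λ { (ts , l , r≈) →
      ≤-respˡ (R.sym r≈) (lowerSum-bound 1# ts x (inj₂ R.refl) l) })

  -- For 0 < x < 1, ∫₁ˣ dt/t = - ∫₁^(1/x) dt/t; for x ≤ 0 the value is junk.
  log : Carrier → Carrier
  log x with compare 1# x | 0# <? x
  ... | tri< 1<x _ _ | _       = proj₁ (∫₁dt/t x (inj₁ 1<x))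
  ... | tri≈ _ 1≈x _ | _       = proj₁ (∫₁dt/t x (inj₂ 1≈x))
  ... | tri> _ _ x<1 | yes 0<x = - proj₁ (∫₁dt/t (x ⁻¹) (x<1⇒1≤x⁻¹ 0<x x<1))
  ... | tri> _ _ _   | no _    = 0#

  primeBelow? : ∀ x p → Dec (Prime p × fromℕ p < x)
  primeBelow? x p = prime? p ×-dec (fromℕ p <? x)

  primesBelow : Carrier → List ℕ
  primesBelow x = filter (primeBelow? x) (upTo (proj₁ (archimedean x)))

  ∈-primesBelow : ∀ x p → p ∈ primesBelow x ⇔ (Prime p × fromℕ p < x)
  ∈-primesBelow x p = mk⇔ (λ p∈ → proj₂ (∈-filter⁻ (primeBelow? x) {xs = upTo N} p∈))
    λ (p-prime , p<x) → ∈-filter⁺ (primeBelow? x) (∈-upTo⁺ (below p<x)) (p-prime , p<x)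
    where
    N : ℕ
    N = proj₁ (archimedean x)

    below : fromℕ p < x → p ℕ.< N
    below p<x = ℕ.≰⇒> λ N≤p → O.irrefl R.refl
      (O.trans p<x (<-≤-trans (proj₂ (archimedean x)) (fromℕ-mono {N} {p} N≤p)))

  primesBelow-unique : ∀ x → Unique (primesBelow x)
  primesBelow-unique x = Unique.filter⁺ (primeBelow? x) (Unique.upTo⁺ (proj₁ (archimedean x)))

  ∑ₚ<_[_] : Carrier → (ℕ → ℕ) → ℕ
  ∑ₚ< x [ f ] = sum (map f (primesBelow x))

-- A solution has the form p·uvd, dku, dkv up to order, where ek = u + v and pe + 1 = 4uvd.  It is determined
-- by its ordering, by (u, d, k) and by e, which divides 4u²d + 1; taking u ≤ v gives udk ≤ p.  So the sum is at
-- most 6 ∑ τ(4u²d + 1) over udk < x.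
--
-- For every n, τ(n) is at most a constant times a weighted sum over divisors q of n with q³ ≤ n, where
-- q = ab²c⁴t² has weight (3/2)^ω(a) up to powers of τ(b), τ(c), τ(t).  To see this, colour the primes of n with
-- three colours: some class has product at most the cube root of n, and all but a small proportion of the
-- classes contain enough primes for the weight to compensate for the number of subsets.
--
-- If q³ ≤ 4u²d + 1 then q ≤ 2u or q ≤ 2d, so the pairs (u, d) with q ∣ 4u²d + 1 can be counted in residue
-- classes modulo q of u (at most τ(q) of them) or of d (at most one).  The sums over b, c, t converge, and the
-- sums over two of u, d, k and over a, weighted by 3^ω(a), give the fifth power of a harmonic sum.

module Submission where

open import Defs
import Algebra.Solver.Ring.NaturalCoefficients.Default as SemiringSolver
import Algebra.Properties.Semiring.Mult as SemiringMult
open import Algebra.Bundles using (CommutativeRing)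
import Data.Bool.Base as Bool
open import Data.Empty using (⊥-elim)
open import Data.List.Base using (List; []; _∷_; _∷ʳ_; _++_; map)
open import Data.List.Relation.Unary.All as All using (All; []; _∷_)
open import Data.List.Relation.Unary.Linked using (Linked; [-]; _∷_)
open import Data.Nat as ℕ using (ℕ; zero; suc; s≤s; z≤n)
import Data.Nat.Properties as ℕ
open import Data.Product using (∃-syntax; _×_; _,_; proj₁; proj₂)
open import Data.Sum using (inj₁; inj₂)
open import Data.Unit using (tt)
open import Function.Bundles using (module Equivalence)
open import Level using (0ℓ)
open import Relation.Binary.Bundles using (Preorder)
open import Relation.Binary.Definitions using (tri<; tri≈; tri>)
import Relation.Binary.PropositionalEquality as ≡
open ≡ using (_≡_)
import Relation.Binary.Reasoning.Preorder as PreorderReasoning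
open import Relation.Binary.Structures using (IsStrictTotalOrder)

-- Cube roots are the scale forced by the shape of `4u²d + 1`: a divisor `q` up to the square root
-- can exceed both `u` and `d` by far, and then neither variable runs through a full period modulo
-- `q`. Below the cube root one of the three factors u, u, d is at least about as large as `q`. The
-- price is the weight (3/2)^ω(a). It is encoded as τ₃/τ, because the τ(q) residue classes multiply
-- it and turn it into τ₃, whose sum against 1/a is at most the cube of a harmonic sum. The colour
-- classes with too few primes are controlled by a Chernoff-type change of measure, carried out with
-- integer weights (`slack`). All counting stays in ℕ: floor quotients `z ÷ q` stand for z/q and
-- compose exactly under iteration, and the fractional weights are multiplied by a factorial that
-- cancels at the end. Real numbers appear when harmonic sums are compared with the logarithm. The
-- factor (log log x)² enters through (2 log log x)² ≥ 1 for x ≥ 16.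

module Counting where
  open import Data.Bool.Base using (if_then_else_)
  open import Data.List.Base using (List; []; _∷_; _∷ʳ_; _++_; map; length; filter; concatMap; cartesianProduct; upTo; applyUpTo)
  open import Data.List.Properties using (length-map; length-++; length-filter; length-applyUpTo; length-upTo; applyUpTo-∷ʳ)
  open import Data.List.Membership.Propositional using (_∈_; find; lose)
  open import Data.List.Membership.Propositional.Properties
    using (∈-++⁺ˡ; ∈-++⁺ʳ; ∈-++⁻; ∈-∃++; ∈-map⁺; ∈-map⁻; ∈-filter⁺; ∈-filter⁻; ∈-applyUpTo⁺; ∈-applyUpTo⁻; ∈-upTo⁺; ∈-concatMap⁺; ∈-concatMap⁻; ∈-cartesianProduct⁺; ∈-cartesianProduct⁻)
  import Data.List.Relation.Unary.All.Properties as All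
  open import Data.List.Relation.Unary.AllPairs using ([]; _∷_)
  open import Data.List.Relation.Unary.Any using (here; there)
  open import Data.List.Relation.Unary.Unique.Propositional using (Unique)
  import Data.List.Relation.Unary.Unique.Propositional.Properties as Unique
  open import Data.List.Relation.Binary.Disjoint.Propositional using (Disjoint)
  open import Data.List.Relation.Binary.Permutation.Propositional.Properties using (All-resp-↭; shift)
  open import Data.Nat
  open import Data.Nat.Properties
  open import Data.Nat.Divisibility
  open import Data.Nat.DivMod
  open import Data.Nat.GCD using (gcd; gcd[m,n]∣m; gcd[m,n]∣n; gcd-greatest)
  open import Data.Nat.Coprimality as Coprimality using (Coprime; coprime-divisor)
  open import Data.Nat.ListAction using (sum; product)
  open import Data.Nat.ListAction.Properties using (product-↭; ∈⇒∣product)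
  open import Data.Nat.Primality using (Prime; euclidsLemma; prime⇒irreducible; prime⇒nonZero; ¬prime[1])
  open import Data.Nat.Primality.Factorisation using (PrimeFactorisation; factorise)
  open import Data.Nat.Tactic.RingSolver using (solve-∀)
  open import Data.Product using (∃; ∃-syntax; _×_; _,_; proj₁; proj₂)
  open import Data.Sum using (_⊎_; inj₁; inj₂; [_,_]′)
  open import Function.Base using (_∘_)
  open import Relation.Binary.PropositionalEquality using (_≡_; _≢_; refl; sym; trans; cong; cong₂; subst; subst₂; module ≡-Reasoning)
  open import Relation.Nullary using (¬_; Dec; yes; no; does)
  open import Relation.Nullary.Negation using (contradiction)

  private
    variable
      A A′ : Set
      P P′ : Set

  -- Finite sums

  ∑ : List A → (A → ℕ) → ℕ
  ∑ []       f = 0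
  ∑ (x ∷ xs) f = f x + ∑ xs f

  ∑-mono : ∀ (xs : List A) {f g : A → ℕ} → (∀ {x} → x ∈ xs → f x ≤ g x) → ∑ xs f ≤ ∑ xs g
  ∑-mono []       h = z≤n
  ∑-mono (x ∷ xs) h = +-mono-≤ (h (here refl)) (∑-mono xs (h ∘ there))

  ∑-mono′ : ∀ (xs : List A) {f g : A → ℕ} → (∀ x → f x ≤ g x) → ∑ xs f ≤ ∑ xs g
  ∑-mono′ xs h = ∑-mono xs λ {x} _ → h x

  ∑-cong : ∀ (xs : List A) {f g : A → ℕ} → (∀ x → f x ≡ g x) → ∑ xs f ≡ ∑ xs g
  ∑-cong []       h = refl
  ∑-cong (x ∷ xs) h = cong₂ _+_ (h x) (∑-cong xs h)

  ∑-++ : ∀ (xs ys : List A) (f : A → ℕ) → ∑ (xs ++ ys) f ≡ ∑ xs f + ∑ ys f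
  ∑-++ []       ys f = refl
  ∑-++ (x ∷ xs) ys f = trans (cong (f x +_) (∑-++ xs ys f)) (sym (+-assoc (f x) _ _))

  ∑-map : ∀ (h : A → A′) xs (f : A′ → ℕ) → ∑ (map h xs) f ≡ ∑ xs (f ∘ h)
  ∑-map h []       f = refl
  ∑-map h (x ∷ xs) f = cong (f (h x) +_) (∑-map h xs f)

  ∑-0 : ∀ (xs : List A) → ∑ xs (λ _ → 0) ≡ 0
  ∑-0 []       = refl
  ∑-0 (x ∷ xs) = ∑-0 xs

  ∑-+ : ∀ (xs : List A) (f g : A → ℕ) → ∑ xs (λ x → f x + g x) ≡ ∑ xs f + ∑ xs g
  ∑-+ []       f g = refl
  ∑-+ (x ∷ xs) f g rewrite ∑-+ xs f g = interchange (f x) (g x) (∑ xs f) (∑ xs g)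
    where
    interchange : ∀ a b c d → a + b + (c + d) ≡ a + c + (b + d)
    interchange = solve-∀

  ∑-*ˡ : ∀ c (xs : List A) (f : A → ℕ) → ∑ xs (λ x → c * f x) ≡ c * ∑ xs f
  ∑-*ˡ c []       f = sym (*-zeroʳ c)
  ∑-*ˡ c (x ∷ xs) f = trans (cong (c * f x +_) (∑-*ˡ c xs f)) (sym (*-distribˡ-+ c (f x) _))

  ∑-swap : ∀ (xs : List A) (ys : List A′) (f : A → A′ → ℕ) →
           ∑ xs (λ x → ∑ ys (f x)) ≡ ∑ ys (λ y → ∑ xs (λ x → f x y))
  ∑-swap []       ys f = sym (∑-0 ys)
  ∑-swap (x ∷ xs) ys f = trans (cong (∑ ys (f x) +_) (∑-swap xs ys f)) (sym (∑-+ ys _ _))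

  length≡∑1 : ∀ (xs : List A) → length xs ≡ ∑ xs (λ _ → 1)
  length≡∑1 []       = refl
  length≡∑1 (x ∷ xs) = cong suc (length≡∑1 xs)

  length-concatMap : ∀ (f : A → List A′) xs → length (concatMap f xs) ≡ ∑ xs (length ∘ f)
  length-concatMap f []       = refl
  length-concatMap f (x ∷ xs) =
    trans (length-++ (f x)) (cong (length (f x) +_) (length-concatMap f xs))

  -- The `y` matched with the head is removed from `ys` before the induction continues; injectivity
  -- of `R` ensures that no later `x` has the same partner. A relation is more convenient than a map
  -- here, since partners are produced by existence proofs and vanishing terms have none.
  ∑-inject : (R : A → A′ → Set) (xs : List A) (ys : List A′) {f : A → ℕ} {g : A′ → ℕ} → Unique xs →
             (∀ {x} → x ∈ xs → f x ≡ 0 ⊎ ∃ λ y → y ∈ ys × R x y × f x ≤ g y) →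
             (∀ {x x′ y} → R x y → R x′ y → x ≡ x′) →
             ∑ xs f ≤ ∑ ys g
  ∑-inject R []       ys _          _ _   = z≤n
  ∑-inject {A = A} {A′ = A′} R (x ∷ xs) ys {f} {g} (x≢ ∷ uniq) h inj with h (here refl)
  ... | inj₁ fx≡0 rewrite fx≡0 = ∑-inject R xs ys uniq (h ∘ there) inj
  ... | inj₂ (y , y∈ , Rxy , fx≤gy) with as , bs , refl ← ∈-∃++ y∈ = begin
    f x + ∑ xs f               ≤⟨ +-mono-≤ fx≤gy (∑-inject R xs (as ++ bs) uniq h′ inj) ⟩
    g y + ∑ (as ++ bs) g       ≡⟨ cong (g y +_) (∑-++ as bs g) ⟩
    g y + (∑ as g + ∑ bs g)    ≡⟨ rotate (g y) (∑ as g) (∑ bs g) ⟩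
    ∑ as g + (g y + ∑ bs g)    ≡⟨ ∑-++ as (y ∷ bs) g ⟨
    ∑ (as ++ y ∷ bs) g         ∎
    where
    open ≤-Reasoning
    rotate : ∀ a b c → a + (b + c) ≡ b + (a + c)
    rotate = solve-∀
    drop-y : ∀ {y′} → y′ ∈ as ++ y ∷ bs → y′ ≢ y → y′ ∈ as ++ bs
    drop-y y′∈ y′≢y with ∈-++⁻ as y′∈
    ... | inj₁ y′∈as         = ∈-++⁺ˡ y′∈as
    ... | inj₂ (here y′≡y)   = contradiction y′≡y y′≢y
    ... | inj₂ (there y′∈bs) = ∈-++⁺ʳ as y′∈bs
    h′ : ∀ {x′} → x′ ∈ xs → f x′ ≡ 0 ⊎ ∃ λ y′ → y′ ∈ as ++ bs × R x′ y′ × f x′ ≤ g y′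
    h′ x′∈ with h (there x′∈)
    ... | inj₁ z = inj₁ z
    ... | inj₂ (y′ , y′∈ , Rx′y′ , le) = inj₂ (y′ , drop-y y′∈ y′≢y , Rx′y′ , le)
      where
      y′≢y : y′ ≢ y
      y′≢y refl = All.lookup x≢ x′∈ (inj Rxy Rx′y′)

  ∑-⊆ : ∀ (xs ys : List A) (f : A → ℕ) → Unique xs →
        (∀ {x} → x ∈ xs → f x ≡ 0 ⊎ x ∈ ys) → ∑ xs f ≤ ∑ ys f
  ∑-⊆ xs ys f uniq h = ∑-inject _≡_ xs ys uniq
    (λ x∈ → [ inj₁ , (λ x∈ys → inj₂ (_ , x∈ys , refl , ≤-refl)) ]′ (h x∈))
    (λ p q → trans p (sym q))

  length-cartesianProduct : ∀ (xs : List A) (ys : List A′) → length (cartesianProduct xs ys) ≡ length xs * length ys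
  length-cartesianProduct []       ys = refl
  length-cartesianProduct (x ∷ xs) ys = trans (length-++ (map (x ,_) ys))
    (cong₂ _+_ (length-map (x ,_) ys) (length-cartesianProduct xs ys))

  ∑-cartesianProduct : ∀ (xs : List A) (ys : List A′) (f : A × A′ → ℕ) →
                       ∑ (cartesianProduct xs ys) f ≡ ∑ xs (λ x → ∑ ys (λ y → f (x , y)))
  ∑-cartesianProduct []       ys f = refl
  ∑-cartesianProduct (x ∷ xs) ys f = trans (∑-++ (map (x ,_) ys) _ f)
    (cong₂ _+_ (∑-map (x ,_) ys f) (∑-cartesianProduct xs ys f))

  concatMap-, : {C : A → List A′} {xs : List A} → Unique xs → (∀ x → Unique (C x)) →
                Unique (concatMap (λ x → map (x ,_) (C x)) xs)
  concatMap-, {xs = []} [] _ = []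
  concatMap-, {C = C} {xs = x ∷ xs} (x≢ ∷ uniq) C! =
    Unique.++⁺ (Unique.map⁺ (λ { refl → refl }) (C! x)) (concatMap-, uniq C!) disjoint
    where
    disjoint : Disjoint (map (x ,_) (C x)) (concatMap (λ x → map (x ,_) (C x)) xs)
    disjoint (y∈₁ , y∈₂) with ∈-map⁻ (x ,_) y∈₁ | ∈-concatMap⁻ (λ x → map (x ,_) (C x)) y∈₂
    ... | _ , _ , refl | any with x′ , x′∈ , y∈ ← find any with ∈-map⁻ (x′ ,_) y∈
    ... | _ , _ , refl = All.lookup x≢ x′∈ refl

  𝟙 : Dec P → ℕ
  𝟙 d = if does d then 1 else 0

  𝟙-yes : (d : Dec P) → P → 𝟙 d ≡ 1
  𝟙-yes (yes _) _ = refl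
  𝟙-yes (no ¬p) p = contradiction p ¬p

  𝟙-dec : (d : Dec P) → (P × 𝟙 d ≡ 1) ⊎ (¬ P × 𝟙 d ≡ 0)
  𝟙-dec (yes p) = inj₁ (p , refl)
  𝟙-dec (no ¬p) = inj₂ (¬p , refl)

  𝟙*-≤ : (d : Dec P) {x y : ℕ} → (P → x ≤ y) → 𝟙 d * x ≤ y
  𝟙*-≤ (yes p) {x} h = ≤-trans (≤-reflexive (+-identityʳ x)) (h p)
  𝟙*-≤ (no _)      _ = z≤n

  ∑-filter : {P : A → Set} (P? : ∀ x → Dec (P x)) (xs : List A) (f : A → ℕ) →
             ∑ (filter P? xs) f ≡ ∑ xs (λ x → 𝟙 (P? x) * f x)
  ∑-filter P? []       f = refl
  ∑-filter P? (x ∷ xs) f with P? x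
  ... | yes _ = cong₂ _+_ (sym (+-identityʳ (f x))) (∑-filter P? xs f)
  ... | no  _ = ∑-filter P? xs f

  -- Ranges and divisors

  range : ℕ → List ℕ
  range = applyUpTo suc

  ∈-range⁺ : ∀ {i n} → 0 < i → i ≤ n → i ∈ range n
  ∈-range⁺ {suc i} _ i<n = ∈-applyUpTo⁺ suc i<n

  ∈-range⁻ : ∀ {i n} → i ∈ range n → 0 < i × i ≤ n
  ∈-range⁻ i∈ with _ , j<n , refl ← ∈-applyUpTo⁻ suc i∈ = s≤s z≤n , j<n

  range! : ∀ n → Unique (range n)
  range! n = Unique.applyUpTo⁺₁ suc n λ i<j _ e → <⇒≢ i<j (suc-injective e)

  divisors : ℕ → List ℕ
  divisors n = filter (_∣? n) (range n)

  ∣-pos : ∀ {d n} → 0 < n → d ∣ n → 0 < d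
  ∣-pos {zero}  0<n d∣n = contradiction (sym (0∣⇒≡0 d∣n)) (<⇒≢ 0<n)
  ∣-pos {suc d} _   _   = s≤s z≤n

  ∣-≤ : ∀ {d n} → 0 < n → d ∣ n → d ≤ n
  ∣-≤ 0<n = ∣⇒≤ {{>-nonZero 0<n}}

  ∈-divisors⁺ : ∀ {d n} → 0 < n → d ∣ n → d ∈ divisors n
  ∈-divisors⁺ {n = n} 0<n d∣n = ∈-filter⁺ (_∣? n) (∈-range⁺ (∣-pos 0<n d∣n) (∣-≤ 0<n d∣n)) d∣n

  ∈-divisors⁻ : ∀ {d} n → d ∈ divisors n → 0 < d × d ∣ n
  ∈-divisors⁻ n d∈ = let d∈range , d∣n = ∈-filter⁻ (_∣? n) {xs = range n} d∈ in proj₁ (∈-range⁻ d∈range) , d∣n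

  divisors! : ∀ n → Unique (divisors n)
  divisors! n = Unique.filter⁺ (_∣? n) (range! n)

  τ : ℕ → ℕ
  τ n = ∑ (divisors n) (λ _ → 1)

  τ₃ : ℕ → ℕ
  τ₃ n = ∑ (divisors n) τ

  *-pos : ∀ {a b} → 0 < a → 0 < b → 0 < a * b
  *-pos {suc a} {suc b} _ _ = s≤s z≤n

  pos-*ˡ : ∀ a b → 0 < a * b → 0 < a
  pos-*ˡ (suc a) b _ = s≤s z≤n

  pos-*ʳ : ∀ a b → 0 < a * b → 0 < b
  pos-*ʳ a b 0<ab = pos-*ˡ b a (subst (0 <_) (*-comm a b) 0<ab)

  ^-pos : ∀ {a} k → 0 < a → 0 < a ^ k
  ^-pos zero    _   = s≤s z≤n
  ^-pos (suc k) 0<a = *-pos 0<a (^-pos k 0<a)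

  ^-distribʳ-* : ∀ k a b → (a * b) ^ k ≡ a ^ k * b ^ k
  ^-distribʳ-* zero    a b = refl
  ^-distribʳ-* (suc k) a b rewrite ^-distribʳ-* k a b = interchange a b (a ^ k) (b ^ k)
    where
    interchange : ∀ a b c d → a * b * (c * d) ≡ a * c * (b * d)
    interchange = solve-∀

  prime-pos : ∀ {p} → Prime p → 0 < p
  prime-pos pr = >-nonZero⁻¹ _ {{prime⇒nonZero pr}}

  coprime-quotients : ∀ a b → 0 < a → ∃[ g ] ∃[ a′ ] ∃[ b′ ]
                      0 < g × a ≡ g * a′ × b ≡ g * b′ × Coprime a′ b′ × g ≡ gcd a b
  coprime-quotients a b 0<a = g , quotient g∣a , quotient g∣b , 0<g ,
    m∣n⇒n≡m*quotient g∣a , m∣n⇒n≡m*quotient g∣b , coprime , refl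
    where
    g = gcd a b
    g∣a = gcd[m,n]∣m a b
    g∣b = gcd[m,n]∣n a b
    0<g : 0 < g
    0<g = ∣-pos 0<a g∣a
    coprime : Coprime (quotient g∣a) (quotient g∣b)
    coprime {i} (i∣a′ , i∣b′) = ∣1⇒≡1 (*-cancelˡ-∣ g {{>-nonZero 0<g}}
      (subst (g * i ∣_) (sym (*-identityʳ g)) (gcd-greatest
        (subst (g * i ∣_) (sym (m∣n⇒n≡m*quotient g∣a)) (*-monoʳ-∣ g i∣a′))
        (subst (g * i ∣_) (sym (m∣n⇒n≡m*quotient g∣b)) (*-monoʳ-∣ g i∣b′)))))

  -- Take `d` to be the gcd of `a` and `D`: the cofactor of `D` is coprime to that of `a`, hence
  -- divides `b`.
  ∣*-split : ∀ {D} a b → 0 < a → D ∣ a * b → ∃[ d ] ∃[ e ] d ∣ a × e ∣ b × D ≡ d * e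
  ∣*-split {D} a b 0<a D∣ab with coprime-quotients a D 0<a
  ... | g , a′ , k , 0<g , refl , refl , cop , _ =
    g , k , m∣m*n a′ , coprime-divisor (Coprimality.sym cop) k∣a′b , refl
    where
    k∣a′b : k ∣ a′ * b
    k∣a′b = *-cancelˡ-∣ g {{>-nonZero 0<g}} (subst (g * k ∣_) (*-assoc g a′ b) D∣ab)

  -- Each divisor `D` of the product is sent to some pair `(d , e)` with `D = d * e`. The pair is
  -- not unique when `a` and `b` share factors, but it determines `D`.
  τ-* : ∀ a b → 0 < a → 0 < b → τ (a * b) ≤ τ a * τ b
  τ-* a b 0<a 0<b = begin
    τ (a * b)
      ≤⟨ ∑-inject (λ D de → D ≡ proj₁ de * proj₂ de) (divisors (a * b)) pairs {g = λ _ → 1}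
           (divisors! (a * b)) split (λ p q → trans p (sym q)) ⟩
    ∑ pairs (λ _ → 1)                        ≡⟨ length≡∑1 pairs ⟨
    length pairs                             ≡⟨ length-concatMap _ (divisors a) ⟩
    ∑ (divisors a) (λ d → length (map (d ,_) (divisors b)))
      ≡⟨ ∑-cong (divisors a) (λ d → trans (length-map _ (divisors b)) (trans (length≡∑1 (divisors b)) (sym (*-identityʳ (τ b))))) ⟩
    ∑ (divisors a) (λ _ → τ b * 1)           ≡⟨ ∑-*ˡ (τ b) (divisors a) (λ _ → 1) ⟩
    τ b * τ a                                ≡⟨ *-comm (τ b) (τ a) ⟩
    τ a * τ b                                ∎
    where
    open ≤-Reasoning
    pairs : List (ℕ × ℕ)
    pairs = concatMap (λ d → map (d ,_) (divisors b)) (divisors a)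
    split : ∀ {D} → D ∈ divisors (a * b) → 1 ≡ 0 ⊎
            ∃ λ de → de ∈ pairs × D ≡ proj₁ de * proj₂ de × 1 ≤ 1
    split D∈ with d , e , d∣a , e∣b , D≡ ← ∣*-split a b 0<a (proj₂ (∈-divisors⁻ (a * b) D∈)) =
      inj₂ ((d , e) ,
        ∈-concatMap⁺ (λ d → map (d ,_) (divisors b))
          (lose (∈-divisors⁺ 0<a d∣a) (∈-map⁺ (d ,_) (∈-divisors⁺ 0<b e∣b))) ,
        D≡ , ≤-refl)

  τ-pos : ∀ {n} → 0 < n → 0 < τ n
  τ-pos {n} 0<n = ∑-⊆ (1 ∷ []) (divisors n) (λ _ → 1) ([] ∷ [])
    λ { (here refl) → inj₂ (∈-divisors⁺ 0<n (1∣ n)) }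

  τ-≤ : ∀ n → τ n ≤ n
  τ-≤ n = begin
    τ n                     ≡⟨ length≡∑1 (divisors n) ⟨
    length (divisors n)     ≤⟨ length-filter (_∣? n) (range n) ⟩
    length (range n)        ≡⟨ length-applyUpTo suc n ⟩
    n                       ∎
    where open ≤-Reasoning

  τ-^ : ∀ k a → 0 < a → τ (a ^ k) ≤ τ a ^ k
  τ-^ zero    a 0<a = ≤-refl
  τ-^ (suc k) a 0<a = ≤-trans (τ-* a (a ^ k) 0<a (^-pos k 0<a)) (*-monoʳ-≤ (τ a) (τ-^ k a 0<a))

  prime∤⇒coprime : ∀ {p n} → Prime p → ¬ p ∣ n → Coprime p n
  prime∤⇒coprime pr p∤n (i∣p , i∣n) with prime⇒irreducible pr i∣p
  ... | inj₁ i≡1  = i≡1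
  ... | inj₂ refl = contradiction i∣n p∤n

  -- The cofactor `E` decides: if `p` divides it, one factor `p` cancels and the induction applies;
  -- otherwise `E` is coprime to `p` and divides a power of `p`, so it is 1.
  divisor-of-prime-power : ∀ {p D} → Prime p → ∀ e → D ∣ p ^ e → ∃[ j ] j ≤ e × D ≡ p ^ j
  divisor-of-prime-power pr zero D∣1 = 0 , z≤n , ∣1⇒≡1 D∣1
  divisor-of-prime-power {p} {D} pr (suc e) D∣ = go (p ∣? quotient D∣)
    where
    E = quotient D∣
    p^≡DE : p * p ^ e ≡ D * E
    p^≡DE = m∣n⇒n≡m*quotient D∣
    instance p≢0 = prime⇒nonZero pr
    go : Dec (p ∣ E) → ∃[ j ] j ≤ suc e × D ≡ p ^ j
    go (yes p∣E) = let j , j≤e , D≡ = divisor-of-prime-power pr e D∣p^e in j , m≤n⇒m≤1+n j≤e , D≡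
      where
      D∣p^e : D ∣ p ^ e
      D∣p^e = divides (quotient p∣E) (*-cancelˡ-≡ (p ^ e) (quotient p∣E * D) p (begin
        p * p ^ e                ≡⟨ p^≡DE ⟩
        D * E                    ≡⟨ cong (D *_) (m∣n⇒n≡m*quotient p∣E) ⟩
        D * (p * quotient p∣E)   ≡⟨ rearrange D p (quotient p∣E) ⟩
        p * (quotient p∣E * D)   ∎))
        where
        open ≡-Reasoning
        rearrange : ∀ a b c → a * (b * c) ≡ b * (c * a)
        rearrange = solve-∀
    go (no p∤E) = suc e , ≤-refl , (begin
      D           ≡⟨ *-identityʳ D ⟨
      D * 1       ≡⟨ cong (D *_) (E≡1 (suc e) (divides D p^≡DE)) ⟨
      D * E       ≡⟨ p^≡DE ⟨
      p ^ suc e   ∎)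
      where
      open ≡-Reasoning
      E≡1 : ∀ k → E ∣ p ^ k → E ≡ 1
      E≡1 zero    E∣ = ∣1⇒≡1 E∣
      E≡1 (suc k) E∣ = E≡1 k (coprime-divisor (Coprimality.sym (prime∤⇒coprime pr p∤E)) E∣)

  τ-prime-power : ∀ {p} → Prime p → ∀ e → τ (p ^ e) ≤ suc e
  τ-prime-power {p} pr e = begin
    τ (p ^ e)                    ≤⟨ ∑-⊆ (divisors (p ^ e)) powers (λ _ → 1) (divisors! (p ^ e)) (λ D∈ → inj₂ (∈-powers D∈)) ⟩
    ∑ powers (λ _ → 1)           ≡⟨ length≡∑1 powers ⟨
    length powers                ≡⟨ length-applyUpTo (p ^_) (suc e) ⟩
    suc e                        ∎
    where
    open ≤-Reasoning
    powers = applyUpTo (p ^_) (suc e)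
    ∈-powers : ∀ {D} → D ∈ divisors (p ^ e) → D ∈ powers
    ∈-powers D∈ with j , j≤e , refl ← divisor-of-prime-power pr e (proj₂ (∈-divisors⁻ (p ^ e) D∈)) =
      ∈-applyUpTo⁺ (p ^_) (s≤s j≤e)

  -- Since `p` does not divide `a`, the divisors of `a` and their multiples by `p` are disjoint
  -- families of divisors of `p * a`.
  ∑-divisors-prime* : ∀ {p a} → Prime p → 0 < a → ¬ p ∣ a → (F : ℕ → ℕ) →
                      ∑ (divisors a) F + ∑ (divisors a) (λ d → F (p * d)) ≤ ∑ (divisors (p * a)) F
  ∑-divisors-prime* {p} {a} pr 0<a p∤a F = begin
    ∑ (divisors a) F + ∑ (divisors a) (λ d → F (p * d))
      ≡⟨ cong (∑ (divisors a) F +_) (∑-map (p *_) (divisors a) F) ⟨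
    ∑ (divisors a) F + ∑ (map (p *_) (divisors a)) F
      ≡⟨ ∑-++ (divisors a) _ F ⟨
    ∑ (divisors a ++ map (p *_) (divisors a)) F
      ≤⟨ ∑-⊆ _ (divisors (p * a)) F
           (Unique.++⁺ (divisors! a) (Unique.map⁺ (*-cancelˡ-≡ _ _ p) (divisors! a)) disjoint)
           (λ d∈ → inj₂ (∈-divisors⁺ (*-pos (prime-pos pr) 0<a) (divides-pa d∈))) ⟩
    ∑ (divisors (p * a)) F  ∎
    where
    open ≤-Reasoning
    instance p≢0 = prime⇒nonZero pr
    disjoint : Disjoint (divisors a) (map (p *_) (divisors a))
    disjoint (d∈ , pd∈) with _ , _ , refl ← ∈-map⁻ (p *_) pd∈ =
      p∤a (∣-trans (m∣m*n _) (proj₂ (∈-divisors⁻ a d∈)))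
    divides-pa : ∀ {d} → d ∈ divisors a ++ map (p *_) (divisors a) → d ∣ p * a
    divides-pa d∈ with ∈-++⁻ (divisors a) d∈
    ... | inj₁ d∈a = ∣n⇒∣m*n p (proj₂ (∈-divisors⁻ a d∈a))
    ... | inj₂ d∈pa with _ , e∈ , refl ← ∈-map⁻ (p *_) d∈pa = *-monoʳ-∣ p (proj₂ (∈-divisors⁻ a e∈))

  2τ≤τ-prime* : ∀ {p a} → Prime p → 0 < a → ¬ p ∣ a → 2 * τ a ≤ τ (p * a)
  2τ≤τ-prime* {a = a} pr 0<a p∤a = ≤-trans
    (≤-reflexive (cong (τ a +_) (+-identityʳ (τ a)))) (∑-divisors-prime* pr 0<a p∤a (λ _ → 1))

  τ-prime*≤2τ : ∀ {p a} → Prime p → 0 < a → τ (p * a) ≤ 2 * τ a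
  τ-prime*≤2τ {p} {a} pr 0<a = ≤-trans (τ-* p a (prime-pos pr) 0<a)
    (*-monoˡ-≤ (τ a) (subst (λ q → τ q ≤ 2) (*-identityʳ p) (τ-prime-power pr 1)))

  3τ₃≤τ₃-prime* : ∀ {p a} → Prime p → 0 < a → ¬ p ∣ a → 3 * τ₃ a ≤ τ₃ (p * a)
  3τ₃≤τ₃-prime* {p} {a} pr 0<a p∤a = begin
    τ₃ a + 2 * τ₃ a
      ≡⟨ cong (τ₃ a +_) (∑-*ˡ 2 (divisors a) τ) ⟨
    τ₃ a + ∑ (divisors a) (λ d → 2 * τ d)
      ≤⟨ +-monoʳ-≤ (τ₃ a) (∑-mono (divisors a) (λ d∈ → let 0<d , d∣a = ∈-divisors⁻ a d∈ in
           2τ≤τ-prime* pr 0<d (λ p∣d → p∤a (∣-trans p∣d d∣a)))) ⟩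
    τ₃ a + ∑ (divisors a) (λ d → τ (p * d))
      ≤⟨ ∑-divisors-prime* pr 0<a p∤a τ ⟩
    τ₃ (p * a)  ∎
    where open ≤-Reasoning

  -- Substitute `t = d * e`. Both factors stay within `range B`; pairs whose product exceeds `B`
  -- only enlarge the right side.
  ∑-range-divisors : ∀ B (f : ℕ → ℕ → ℕ) →
    ∑ (range B) (λ t → ∑ (divisors t) (λ d → f d t)) ≤ ∑ (range B) (λ d → ∑ (range B) (λ e → f d (d * e)))
  ∑-range-divisors B f = begin
    ∑ (range B) (λ t → ∑ (divisors t) (λ d → f d t))
      ≤⟨ ∑-mono (range B) (λ {t} t∈ → ∑-⊆-range t (proj₂ (∈-range⁻ t∈))) ⟩
    ∑ (range B) (λ t → ∑ (range B) (λ d → 𝟙 (d ∣? t) * f d t))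
      ≡⟨ ∑-swap (range B) (range B) _ ⟩
    ∑ (range B) (λ d → ∑ (range B) (λ t → 𝟙 (d ∣? t) * f d t))
      ≤⟨ ∑-mono (range B) (λ {d} d∈ → ∑-inject (λ t e → t ≡ d * e) (range B) (range B) (range! B)
           (factor d (proj₁ (∈-range⁻ d∈))) (λ p q → trans p (sym q))) ⟩
    ∑ (range B) (λ d → ∑ (range B) (λ e → f d (d * e)))  ∎
    where
    open ≤-Reasoning
    ∑-⊆-range : ∀ t → t ≤ B → ∑ (divisors t) (λ d → f d t) ≤ ∑ (range B) (λ d → 𝟙 (d ∣? t) * f d t)
    ∑-⊆-range t t≤B = ∑-inject _≡_ (divisors t) (range B) (divisors! t)
      (λ {d} d∈ → let 0<d , d≤t = ∈-range⁻ (proj₁ (∈-filter⁻ (_∣? t) {xs = range t} d∈))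
                      d∣t = proj₂ (∈-divisors⁻ t d∈) in
        inj₂ (d , ∈-range⁺ 0<d (≤-trans d≤t t≤B) , refl ,
          ≤-reflexive (sym (trans (cong (_* f d t) (𝟙-yes (d ∣? t) d∣t)) (*-identityˡ _)))))
      (λ p q → trans p (sym q))
    factor : ∀ d → 0 < d → ∀ {t} → t ∈ range B → 𝟙 (d ∣? t) * f d t ≡ 0 ⊎
             ∃ λ e → e ∈ range B × t ≡ d * e × 𝟙 (d ∣? t) * f d t ≤ f d (d * e)
    factor d 0<d {t} t∈ with d ∣? t
    ... | no _ = inj₁ refl
    ... | yes d∣t = inj₂ (e , ∈-range⁺ 0<e (≤-trans e≤t (proj₂ (∈-range⁻ t∈))) , t≡ ,
                    ≤-reflexive (trans (+-identityʳ _) (cong (f d) t≡)))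
      where
      e = quotient d∣t
      t≡ = m∣n⇒n≡m*quotient d∣t
      0<e : 0 < e
      0<e = pos-*ʳ d e (subst (0 <_) t≡ (proj₁ (∈-range⁻ t∈)))
      e≤t : e ≤ t
      e≤t = ∣-≤ (proj₁ (∈-range⁻ t∈)) (quotient-∣ d∣t)

  -- Weighted subsets of a set of prime powers

  pow4 : ℕ → ℕ
  pow4 y = (y * y) * (y * y)

  pow4-mono : ∀ {x y} → x ≤ y → pow4 x ≤ pow4 y
  pow4-mono x≤y = *-mono-≤ (*-mono-≤ x≤y x≤y) (*-mono-≤ x≤y x≤y)

  -- Xo, Yo are the weights of leaving the item out of a subset, Xi, Yi those of putting it in.  For the
  -- subset itself ν = 2 per item left out counts the 3-colourings of which it is the first class.
  -- The bounds say that gain · slack⁴ dominates ν⁵θ, while the total slack is only 18 per item.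
  record Item : Set where
    constructor item
    field
      size θ Xo Xi Yo Yi : ℕ
      out-bound : 41472 * θ ≤ 3 * Xo * pow4 Yo
      in-bound  : 1296 * θ ≤ 3 * Xi * pow4 Yi
      Y-total   : Yo + Yi ≡ 18
  open Item

  record Choice : Set where
    constructor choice
    field
      chosen ν gain slack : ℕ
  open Choice

  leave take : Item → Choice → Choice
  leave it c = choice (chosen c) (2 * ν c) (Xo it * gain c) (Yo it * slack c)
  take  it c = choice (size it * chosen c) (ν c) (Xi it * gain c) (Yi it * slack c)

  choices : List Item → List Choice
  choices []         = choice 1 1 1 1 ∷ []
  choices (it ∷ its) = map (leave it) (choices its) ++ map (take it) (choices its)

  ∑-choices : ∀ it its (F : Choice → ℕ) →
    ∑ (choices (it ∷ its)) F ≡ ∑ (choices its) (F ∘ leave it) + ∑ (choices its) (F ∘ take it)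
  ∑-choices it its F = trans (∑-++ (map (leave it) (choices its)) _ F)
    (cong₂ _+_ (∑-map (leave it) (choices its) F) (∑-map (take it) (choices its) F))

  sizes θs : List Item → ℕ
  sizes its = product (map size its)
  θs its = product (map θ its)

  -- Divided by `6 ^ length its`, the slacks have total `3 ^ length its`, which is also the total of
  -- `ν` (2 + 1 per item). After this normalisation `slack` is a second distribution of the same
  -- mass over the subsets.
  ∑slack : ∀ its → ∑ (choices its) slack ≡ 6 ^ length its * 3 ^ length its
  ∑slack []         = refl
  ∑slack (it ∷ its) = begin
    ∑ (choices (it ∷ its)) slack
      ≡⟨ ∑-choices it its slack ⟩
    ∑ (choices its) (λ c → Yo it * slack c) + ∑ (choices its) (λ c → Yi it * slack c)
      ≡⟨ cong₂ _+_ (∑-*ˡ (Yo it) (choices its) slack) (∑-*ˡ (Yi it) (choices its) slack) ⟩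
    Yo it * ∑ (choices its) slack + Yi it * ∑ (choices its) slack
      ≡⟨ *-distribʳ-+ (∑ (choices its) slack) (Yo it) (Yi it) ⟨
    (Yo it + Yi it) * ∑ (choices its) slack
      ≡⟨ cong₂ _*_ (Y-total it) (∑slack its) ⟩
    18 * (6 ^ length its * 3 ^ length its)
      ≡⟨ split (6 ^ length its) (3 ^ length its) ⟩
    6 * 6 ^ length its * (3 * 3 ^ length its)  ∎
    where
    open ≡-Reasoning
    split : ∀ a b → 18 * (a * b) ≡ 6 * a * (3 * b)
    split = solve-∀

  -- Divided out, this says Θν ≤ 3ʳ · gain · λ⁴ with λ = slack / (6ʳν), the likelihood ratio of the
  -- two distributions: a Chernoff bound with exponent 4. The constants 41472 = 2⁵ · 6⁴ and 1296 =
  -- 6⁴ in `Item` are the growth of the left side per item. For an item of exponent 1 the inequality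
  -- Θν ≤ 3ʳ · gain needs a proportion log(4/3) / log 3 ≈ 0.262 of the primes in the class; the
  -- expected proportion is 1/3, and the tilted one, 5/18, lies between them.
  Balanced : ℕ → ℕ → Choice → Set
  Balanced r Θ c = ν c * pow4 (ν c) * Θ * pow4 (6 ^ r) ≤ 3 ^ r * gain c * pow4 (slack c)

  balanced : ∀ its → All (Balanced (length its) (θs its)) (choices its)
  balanced [] = ≤-refl ∷ []
  balanced (it ∷ its) = All.++⁺
    (All.map⁺ (All.map (λ {c} → leave-ok c) (balanced its))) (All.map⁺ (All.map (λ {c} → take-ok c) (balanced its)))
    where
    open ≤-Reasoning
    r = length its
    Θ = θs its
    mix : ∀ Xa Ya b Ξ Υ → 3 * Xa * ((Ya * Ya) * (Ya * Ya)) * (b * Ξ * ((Υ * Υ) * (Υ * Υ)))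
          ≡ 3 * b * (Xa * Ξ) * ((Ya * Υ * (Ya * Υ)) * (Ya * Υ * (Ya * Υ)))
    mix = solve-∀
    leave-ok : ∀ c → Balanced r Θ c → Balanced (suc r) (θ it * Θ) (leave it c)
    leave-ok c h = begin
      2 * ν c * pow4 (2 * ν c) * (θ it * Θ) * pow4 (6 * 6 ^ r)
        ≡⟨ split (ν c) (θ it) Θ (6 ^ r) ⟩
      41472 * θ it * (ν c * pow4 (ν c) * Θ * pow4 (6 ^ r))
        ≤⟨ *-mono-≤ (out-bound it) h ⟩
      3 * Xo it * pow4 (Yo it) * (3 ^ r * gain c * pow4 (slack c))
        ≡⟨ mix (Xo it) (Yo it) (3 ^ r) (gain c) (slack c) ⟩
      3 * 3 ^ r * (Xo it * gain c) * pow4 (Yo it * slack c)  ∎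
      where
      split : ∀ n t T s → 2 * n * ((2 * n * (2 * n)) * (2 * n * (2 * n))) * (t * T) * ((6 * s * (6 * s)) * (6 * s * (6 * s)))
              ≡ 41472 * t * (n * ((n * n) * (n * n)) * T * ((s * s) * (s * s)))
      split = solve-∀
    take-ok : ∀ c → Balanced r Θ c → Balanced (suc r) (θ it * Θ) (take it c)
    take-ok c h = begin
      ν c * pow4 (ν c) * (θ it * Θ) * pow4 (6 * 6 ^ r)
        ≡⟨ split (ν c) (θ it) Θ (6 ^ r) ⟩
      1296 * θ it * (ν c * pow4 (ν c) * Θ * pow4 (6 ^ r))
        ≤⟨ *-mono-≤ (in-bound it) h ⟩
      3 * Xi it * pow4 (Yi it) * (3 ^ r * gain c * pow4 (slack c))
        ≡⟨ mix (Xi it) (Yi it) (3 ^ r) (gain c) (slack c) ⟩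
      3 * 3 ^ r * (Xi it * gain c) * pow4 (Yi it * slack c)  ∎
      where
      split : ∀ n t T s → n * ((n * n) * (n * n)) * (t * T) * ((6 * s * (6 * s)) * (6 * s * (6 * s)))
              ≡ 1296 * t * (n * ((n * n) * (n * n)) * T * ((s * s) * (s * s)))
      split = solve-∀

  -- Either Θν ≤ 6⁴·3ʳ·gain, or slack is at least 6 times 6ʳν.
  balanced⇒linear : ∀ r Θ c → Balanced r Θ c →
    6 * 6 ^ r * Θ * ν c ≤ 7776 * (6 ^ r * 3 ^ r) * gain c + Θ * slack c
  balanced⇒linear r Θ c h with Θ * ν c ≤? 1296 * (3 ^ r * gain c) | 6 * 6 ^ r * ν c ≤? slack c
  ... | yes small | _ = begin
    6 * 6 ^ r * Θ * ν c                         ≡⟨ *-assoc (6 * 6 ^ r) Θ (ν c) ⟩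
    6 * 6 ^ r * (Θ * ν c)                       ≤⟨ *-monoʳ-≤ (6 * 6 ^ r) small ⟩
    6 * 6 ^ r * (1296 * (3 ^ r * gain c))          ≡⟨ regroup (6 ^ r) (3 ^ r) (gain c) ⟩
    7776 * (6 ^ r * 3 ^ r) * gain c                ≤⟨ m≤m+n _ _ ⟩
    7776 * (6 ^ r * 3 ^ r) * gain c + Θ * slack c      ∎
    where
    open ≤-Reasoning
    regroup : ∀ s t x → 6 * s * (1296 * (t * x)) ≡ 7776 * (s * t) * x
    regroup = solve-∀
  ... | no _ | yes big = begin
    6 * 6 ^ r * Θ * ν c                         ≡⟨ regroup (6 ^ r) Θ (ν c) ⟩
    Θ * (6 * 6 ^ r * ν c)                       ≤⟨ *-monoʳ-≤ Θ big ⟩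
    Θ * slack c                                     ≤⟨ m≤n+m _ _ ⟩
    7776 * (6 ^ r * 3 ^ r) * gain c + Θ * slack c      ∎
    where
    open ≤-Reasoning
    regroup : ∀ s t x → 6 * s * t * x ≡ t * (6 * s * x)
    regroup = solve-∀
  ... | no large | no small = contradiction Θν≤ large
    where
    open ≤-Reasoning
    s = 6 ^ r
    0<ν : 0 < ν c
    0<ν = pos-*ʳ (6 * s) (ν c) (≤-<-trans z≤n (≰⇒> small))
    0<sν : 0 < pow4 (s * ν c)
    0<sν = let h = *-pos (^-pos r (s≤s z≤n)) 0<ν in *-pos (*-pos h h) (*-pos h h)
    regroup₁ : ∀ n s t → t * n * ((s * n * (s * n)) * (s * n * (s * n)))
               ≡ n * ((n * n) * (n * n)) * t * ((s * s) * (s * s))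
    regroup₁ = solve-∀
    regroup₂ : ∀ n s u → u * ((6 * s * n * (6 * s * n)) * (6 * s * n * (6 * s * n)))
               ≡ 1296 * u * ((s * n * (s * n)) * (s * n * (s * n)))
    regroup₂ = solve-∀
    Θν≤ : Θ * ν c ≤ 1296 * (3 ^ r * gain c)
    Θν≤ = *-cancelʳ-≤ _ _ (pow4 (s * ν c)) {{>-nonZero 0<sν}} (begin
      Θ * ν c * pow4 (s * ν c)                ≡⟨ regroup₁ (ν c) s Θ ⟩
      ν c * pow4 (ν c) * Θ * pow4 s           ≤⟨ h ⟩
      3 ^ r * gain c * pow4 (slack c)                ≤⟨ *-monoʳ-≤ (3 ^ r * gain c) (pow4-mono (<⇒≤ (≰⇒> small))) ⟩
      3 ^ r * gain c * pow4 (6 * s * ν c)        ≡⟨ regroup₂ (ν c) s (3 ^ r * gain c) ⟩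
      1296 * (3 ^ r * gain c) * pow4 (s * ν c)   ∎)

  -- The sum of F over all 3-colourings, applied to the products of the colour classes.
  ∑₃ : List Item → (ℕ → ℕ → ℕ → ℕ) → ℕ
  ∑₃ []         F = F 1 1 1
  ∑₃ (it ∷ its) F = ∑₃ its (λ x y z → F (size it * x) y z)
                  + ∑₃ its (λ x y z → F x (size it * y) z)
                  + ∑₃ its (λ x y z → F x y (size it * z))

  3^≤∑₃ : ∀ its F → (∀ x y z → x * y * z ≡ sizes its → 1 ≤ F x y z) → 3 ^ length its ≤ ∑₃ its F
  3^≤∑₃ []         F h = h 1 1 1 refl
  3^≤∑₃ (it ∷ its) F h = begin
    3 * 3 ^ length its
      ≡⟨ triple (3 ^ length its) ⟩
    3 ^ length its + 3 ^ length its + 3 ^ length its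
      ≤⟨ +-mono-≤ (+-mono-≤
           (3^≤∑₃ its _ λ x y z e → h _ _ _ (trans (move₁ (size it) x y z) (cong (size it *_) e)))
           (3^≤∑₃ its _ λ x y z e → h _ _ _ (trans (move₂ (size it) x y z) (cong (size it *_) e))))
           (3^≤∑₃ its _ λ x y z e → h _ _ _ (trans (move₃ (size it) x y z) (cong (size it *_) e))) ⟩
    ∑₃ (it ∷ its) F  ∎
    where
    open ≤-Reasoning
    triple : ∀ a → 3 * a ≡ a + a + a
    triple = solve-∀
    move₁ : ∀ s x y z → s * x * y * z ≡ s * (x * y * z)
    move₁ = solve-∀
    move₂ : ∀ s x y z → x * (s * y) * z ≡ s * (x * y * z)
    move₂ = solve-∀
    move₃ : ∀ s x y z → x * y * (s * z) ≡ s * (x * y * z)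
    move₃ = solve-∀

  ∑₃-+ : ∀ its F G → ∑₃ its (λ x y z → F x y z + G x y z) ≡ ∑₃ its F + ∑₃ its G
  ∑₃-+ []         F G = refl
  ∑₃-+ (it ∷ its) F G
    rewrite ∑₃-+ its (λ x y z → F (size it * x) y z) (λ x y z → G (size it * x) y z)
          | ∑₃-+ its (λ x y z → F x (size it * y) z) (λ x y z → G x (size it * y) z)
          | ∑₃-+ its (λ x y z → F x y (size it * z)) (λ x y z → G x y (size it * z)) =
    interchange (∑₃ its (λ x y z → F (size it * x) y z)) _ (∑₃ its (λ x y z → F x (size it * y) z)) _
                (∑₃ its (λ x y z → F x y (size it * z))) _
    where
    interchange : ∀ a b c d e f → a + b + (c + d) + (e + f) ≡ a + c + e + (b + d + f)
    interchange = solve-∀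

  ∑ν : List Item → (ℕ → ℕ) → ℕ
  ∑ν its G = ∑ (choices its) (λ c → ν c * G (chosen c))

  ∑ν-∷ : ∀ it its G → ∑ν (it ∷ its) G ≡ 2 * ∑ν its G + ∑ν its (λ x → G (size it * x))
  ∑ν-∷ it its G = trans (∑-choices it its _) (cong (_+ ∑ν its (λ x → G (size it * x))) (trans
    (∑-cong (choices its) (λ c → *-assoc 2 (ν c) (G (chosen c)))) (∑-*ˡ 2 (choices its) _)))

  -- For a fixed first class, every item outside it has two colours to choose from, which is the
  -- factor 2 per omitted item in `ν`.
  ∑₃-marginal₁ : ∀ its G → ∑₃ its (λ x y z → G x) ≡ ∑ν its G
  ∑₃-marginal₁ []         G = sym (trans (+-identityʳ _) (+-identityʳ _))
  ∑₃-marginal₁ (it ∷ its) G rewrite ∑ν-∷ it its G | ∑₃-marginal₁ its G | ∑₃-marginal₁ its (λ x → G (size it * x)) =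
    regroup (∑ν its (λ x → G (size it * x))) (∑ν its G)
    where
    regroup : ∀ a b → a + b + b ≡ 2 * b + a
    regroup = solve-∀

  ∑₃-marginal₂ : ∀ its G → ∑₃ its (λ x y z → G y) ≡ ∑ν its G
  ∑₃-marginal₂ []         G = sym (trans (+-identityʳ _) (+-identityʳ _))
  ∑₃-marginal₂ (it ∷ its) G rewrite ∑ν-∷ it its G | ∑₃-marginal₂ its G | ∑₃-marginal₂ its (λ x → G (size it * x)) =
    regroup (∑ν its (λ x → G (size it * x))) (∑ν its G)
    where
    regroup : ∀ a b → b + a + b ≡ 2 * b + a
    regroup = solve-∀

  ∑₃-marginal₃ : ∀ its G → ∑₃ its (λ x y z → G z) ≡ ∑ν its G
  ∑₃-marginal₃ []         G = sym (trans (+-identityʳ _) (+-identityʳ _))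
  ∑₃-marginal₃ (it ∷ its) G rewrite ∑ν-∷ it its G | ∑₃-marginal₃ its G | ∑₃-marginal₃ its (λ x → G (size it * x)) =
    regroup (∑ν its (λ x → G (size it * x))) (∑ν its G)
    where
    regroup : ∀ a b → b + b + a ≡ 2 * b + a
    regroup = solve-∀

  cube : ℕ → ℕ
  cube x = x * x * x

  small? : ∀ w x → Dec (cube x ≤ w)
  small? w x = cube x ≤? w

  -- One of three numbers with product w has its cube at most w.
  3^≤3∑ν : ∀ its → 3 ^ length its ≤ 3 * ∑ν its (λ x → 𝟙 (small? (sizes its) x))
  3^≤3∑ν its = begin
    3 ^ length its
      ≤⟨ 3^≤∑₃ its _ one-small ⟩
    ∑₃ its (λ x y z → G x + G y + G z)
      ≡⟨ ∑₃-+ its (λ x y z → G x + G y) (λ x y z → G z) ⟩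
    ∑₃ its (λ x y z → G x + G y) + ∑₃ its (λ x y z → G z)
      ≡⟨ cong (_+ ∑₃ its (λ x y z → G z)) (∑₃-+ its (λ x y z → G x) (λ x y z → G y)) ⟩
    ∑₃ its (λ x y z → G x) + ∑₃ its (λ x y z → G y) + ∑₃ its (λ x y z → G z)
      ≡⟨ cong₂ _+_ (cong₂ _+_ (∑₃-marginal₁ its G) (∑₃-marginal₂ its G)) (∑₃-marginal₃ its G) ⟩
    ∑ν its G + ∑ν its G + ∑ν its G
      ≡⟨ triple (∑ν its G) ⟩
    3 * ∑ν its G  ∎
    where
    open ≤-Reasoning
    w = sizes its
    G = λ x → 𝟙 (small? w x)
    triple : ∀ a → a + a + a ≡ 3 * a
    triple = solve-∀
    regroup : ∀ x y z → x * x * x * (y * y * y) * (z * z * z) ≡ x * y * z * (x * y * z) * (x * y * z)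
    regroup = solve-∀
    one-small : ∀ x y z → x * y * z ≡ w → 1 ≤ G x + G y + G z
    one-small x y z e with 𝟙-dec (small? w x) | 𝟙-dec (small? w y) | 𝟙-dec (small? w z)
    ... | inj₁ (_ , x≡) | _             | _             = ≤-trans (≤-reflexive (sym x≡)) (≤-trans (m≤m+n (G x) (G y)) (m≤m+n _ (G z)))
    ... | _             | inj₁ (_ , y≡) | _             = ≤-trans (≤-reflexive (sym y≡)) (≤-trans (m≤n+m (G y) (G x)) (m≤m+n _ (G z)))
    ... | _             | _             | inj₁ (_ , z≡) = ≤-trans (≤-reflexive (sym z≡)) (m≤n+m (G z) (G x + G y))
    ... | inj₂ (x≰ , _) | inj₂ (y≰ , _) | inj₂ (z≰ , _) = contradiction
      (*-mono-< (*-mono-< (≰⇒> x≰) (≰⇒> y≰)) (≰⇒> z≰))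
      (≤⇒≯ (≤-reflexive (trans (regroup x y z) (cong cube e))))

  ∑gain : List Item → (ℕ → ℕ) → ℕ
  ∑gain its G = ∑ (choices its) (λ c → gain c * G (chosen c))

  private
    -- The error term is left without the indicator, because `slack` is summed over all choices and
    -- not over the small ones alone.
    scale : ∀ {P : Set} {g} a x b y {e} → (P × g ≡ 1) ⊎ (¬ P × g ≡ 0) →
            a * x ≤ b * y + e → a * (x * g) ≤ b * (y * g) + e
    scale a x b y (inj₁ (_ , refl)) h rewrite *-identityʳ x | *-identityʳ y = h
    scale a x b y (inj₂ (_ , refl)) _ rewrite *-zeroʳ x | *-zeroʳ a = z≤n

  -- A Markov argument. Small classes carry at least 1/3 of the mass of `ν`, and those with slack at
  -- least 6 · 6ʳν carry at most 1/6 of it. The remaining 1/6 satisfies Θν ≤ 6⁴ · 3ʳ · gain, so the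
  -- constant is 6 · 6⁴ = 7776.
  θs≤∑gain : ∀ its → θs its ≤ 7776 * ∑gain its (λ x → 𝟙 (small? (sizes its) x))
  θs≤∑gain its = *-cancelˡ-≤ 3 (+-cancelʳ-≤ (3 * Θ) (3 * Θ) (3 * (7776 * M)) (*-cancelˡ-≤ (S * T) {{>-nonZero 0<ST}} (begin
    S * T * (3 * Θ + 3 * Θ)
      ≡⟨ regroup₁ S T Θ ⟩
    6 * S * Θ * T
      ≤⟨ *-monoʳ-≤ (6 * S * Θ) (3^≤3∑ν its) ⟩
    6 * S * Θ * (3 * ∑ν its G)
      ≡⟨ regroup₂ (6 * S * Θ) (∑ν its G) ⟩
    3 * (6 * S * Θ * ∑ν its G)
      ≡⟨ cong (3 *_) (∑-*ˡ (6 * S * Θ) (choices its) _) ⟨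
    3 * ∑ (choices its) (λ c → 6 * S * Θ * (ν c * G (chosen c)))
      ≤⟨ *-monoʳ-≤ 3 (∑-mono (choices its) (λ {c} c∈ → pointwise c (All.lookup (balanced its) c∈))) ⟩
    3 * ∑ (choices its) (λ c → 7776 * (S * T) * (gain c * G (chosen c)) + Θ * slack c)
      ≡⟨ cong (3 *_) (trans (∑-+ (choices its) _ _) (cong₂ _+_ (∑-*ˡ (7776 * (S * T)) (choices its) _)
           (trans (∑-*ˡ Θ (choices its) slack) (cong (Θ *_) (∑slack its))))) ⟩
    3 * (7776 * (S * T) * M + Θ * (S * T))
      ≡⟨ regroup₃ (S * T) M Θ ⟩
    S * T * (3 * (7776 * M) + 3 * Θ)  ∎)))
    where
    open ≤-Reasoning
    r = length its
    S = 6 ^ r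
    T = 3 ^ r
    Θ = θs its
    G = λ x → 𝟙 (small? (sizes its) x)
    M = ∑gain its G
    0<ST : 0 < S * T
    0<ST = *-pos {S} {T} (^-pos r (s≤s z≤n)) (^-pos r (s≤s z≤n))
    regroup₁ : ∀ s t u → s * t * (3 * u + 3 * u) ≡ 6 * s * u * t
    regroup₁ = solve-∀
    regroup₂ : ∀ a b → a * (3 * b) ≡ 3 * (a * b)
    regroup₂ = solve-∀
    regroup₃ : ∀ a m u → 3 * (7776 * a * m + u * a) ≡ a * (3 * (7776 * m) + 3 * u)
    regroup₃ = solve-∀
    pointwise : ∀ c → Balanced r Θ c → 6 * S * Θ * (ν c * G (chosen c)) ≤ 7776 * (S * T) * (gain c * G (chosen c)) + Θ * slack c
    pointwise c h = scale (6 * S * Θ) (ν c) (7776 * (S * T)) (gain c) (𝟙-dec (small? (sizes its) (chosen c))) (balanced⇒linear r Θ c h)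

  -- Divisors up to the cube root

  -- θ is τ(pᵉ) for e = 1, 2, 4; for e = 1 it is doubled along with the weights 1 and 3/2 to make these integral.
  prime-item square-item fourth-item : ℕ → Item
  prime-item p = item p 4 2 3 13 5 (≤ᵇ⇒≤ _ _ tt) (≤ᵇ⇒≤ _ _ tt) refl
  square-item p = item (p ^ 2) 3 1 16 15 3 (≤ᵇ⇒≤ _ _ tt) (≤ᵇ⇒≤ _ _ tt) refl
  fourth-item p = item (p ^ 4) 5 1 4096 17 1 (≤ᵇ⇒≤ _ _ tt) (≤ᵇ⇒≤ _ _ tt) refl

  -- From weighted subsets of primes to weighted divisor sums

  ∑-subsets : (o i e : ℕ) → List ℕ → (ℕ → ℕ) → ℕ
  ∑-subsets o i e []       G = G 1
  ∑-subsets o i e (p ∷ ps) G = o * ∑-subsets o i e ps G + i * ∑-subsets o i e ps (λ a → G (p ^ e * a))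

  ∑-subsets-cong : ∀ o i e ps {F G} → (∀ a → F a ≡ G a) → ∑-subsets o i e ps F ≡ ∑-subsets o i e ps G
  ∑-subsets-cong o i e []       h = h 1
  ∑-subsets-cong o i e (p ∷ ps) h = cong₂ (λ x y → o * x + i * y)
    (∑-subsets-cong o i e ps h) (∑-subsets-cong o i e ps (λ a → h (p ^ e * a)))

  ∑-subsets-mono : ∀ o i e ps {F G} → (∀ a → F a ≤ G a) → ∑-subsets o i e ps F ≤ ∑-subsets o i e ps G
  ∑-subsets-mono o i e []       h = h 1
  ∑-subsets-mono o i e (p ∷ ps) h = +-mono-≤
    (*-monoʳ-≤ o (∑-subsets-mono o i e ps h)) (*-monoʳ-≤ i (∑-subsets-mono o i e ps (λ a → h (p ^ e * a))))

  ∑gain-cong : ∀ its {F G} → (∀ a → F a ≡ G a) → ∑gain its F ≡ ∑gain its G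
  ∑gain-cong its h = ∑-cong (choices its) (λ c → cong (gain c *_) (h (chosen c)))
    where open Choice

  ∑gain-∷ : ∀ it its G → ∑gain (it ∷ its) G ≡ Item.Xo it * ∑gain its G + Item.Xi it * ∑gain its (λ a → G (Item.size it * a))
  ∑gain-∷ it its G = trans (∑-choices it its _) (cong₂ _+_
    (trans (∑-cong (choices its) (λ c → *-assoc (Item.Xo it) (Choice.gain c) _)) (∑-*ˡ (Item.Xo it) (choices its) _))
    (trans (∑-cong (choices its) (λ c → *-assoc (Item.Xi it) (Choice.gain c) _)) (∑-*ˡ (Item.Xi it) (choices its) _)))

  ∑gain-block : ∀ (mk : ℕ → Item) o i e → (∀ p → Item.Xo (mk p) ≡ o) → (∀ p → Item.Xi (mk p) ≡ i) →
             (∀ p → Item.size (mk p) ≡ p ^ e) → ∀ ps rest G →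
             ∑gain (map mk ps ++ rest) G ≡ ∑-subsets o i e ps (λ a → ∑gain rest (λ b → G (a * b)))
  ∑gain-block mk o i e Xo≡ Xi≡ size≡ []       rest G = ∑gain-cong rest (λ b → cong G (sym (+-identityʳ b)))
  ∑gain-block mk o i e Xo≡ Xi≡ size≡ (p ∷ ps) rest G = begin
    ∑gain (mk p ∷ (map mk ps ++ rest)) G
      ≡⟨ ∑gain-∷ (mk p) (map mk ps ++ rest) G ⟩
    Item.Xo (mk p) * ∑gain (map mk ps ++ rest) G + Item.Xi (mk p) * ∑gain (map mk ps ++ rest) (λ a → G (Item.size (mk p) * a))
      ≡⟨ cong₂ _+_ (cong₂ _*_ (Xo≡ p) (IH G)) (cong₂ _*_ (Xi≡ p) (IH (λ a → G (Item.size (mk p) * a)))) ⟩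
    o * ∑-subsets o i e ps (λ a → ∑gain rest (λ b → G (a * b)))
    + i * ∑-subsets o i e ps (λ a → ∑gain rest (λ b → G (Item.size (mk p) * (a * b))))
      ≡⟨ cong (λ x → o * ∑-subsets o i e ps (λ a → ∑gain rest (λ b → G (a * b))) + i * x)
           (∑-subsets-cong o i e ps (λ a → ∑gain-cong rest (λ b → cong G
             (trans (cong (_* (a * b)) (size≡ p)) (sym (*-assoc (p ^ e) a b)))))) ⟩
    ∑-subsets o i e (p ∷ ps) (λ a → ∑gain rest (λ b → G (a * b)))  ∎
    where
    open ≡-Reasoning
    IH = ∑gain-block mk o i e Xo≡ Xi≡ size≡ ps rest

  product-pos : ∀ {ps} → All Prime ps → 0 < product ps
  product-pos []         = s≤s z≤n
  product-pos (pr ∷ prs) = *-pos (prime-pos pr) (product-pos prs)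

  prime∣product : ∀ {p ps} → Prime p → All Prime ps → p ∣ product ps → p ∈ ps
  prime∣product pr [] p∣1 = contradiction (subst Prime (∣1⇒≡1 p∣1) pr) ¬prime[1]
  prime∣product {p} {p′ ∷ ps} pr (pr′ ∷ prs) p∣ with euclidsLemma p′ (product ps) pr p∣
  ... | inj₂ p∣ps = there (prime∣product pr prs p∣ps)
  ... | inj₁ p∣p′ with prime⇒irreducible pr′ p∣p′
  ...   | inj₁ refl = contradiction pr ¬prime[1]
  ...   | inj₂ p≡p′ = here p≡p′

  -- The hypothesis says that `v` grows at least by the factor i/o with each new prime, so v(a) ≥
  -- (i/o)^ω(a) · v(1) on the divisors of the squarefree product. The power of `o` collects the
  -- weight of leaving out every prime.
  ∑-subsets≤∑-divisors : ∀ o i e (v : ℕ → ℕ) ps → All Prime ps → Unique ps →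
    (∀ {p a} → Prime p → 0 < a → ¬ p ∣ a → p * a ∣ product ps → i * v a ≤ o * v (p * a)) → ∀ G →
    v 1 * ∑-subsets o i e ps G ≤ o ^ length ps * ∑ (divisors (product ps)) (λ a → v a * G (a ^ e))
  ∑-subsets≤∑-divisors o i e v [] _ _ _ G = ≤-reflexive (trans
    (trans (cong (λ x → v 1 * G x) (sym (^-zeroˡ e))) (sym (+-identityʳ (v 1 * G (1 ^ e)))))
    (sym (+-identityʳ (v 1 * G (1 ^ e) + 0))))
  ∑-subsets≤∑-divisors o i e v (p ∷ ps) (pr ∷ prs) (p≢ ∷ uniq) h G = begin
    v 1 * (o * S G + i * S (λ a → G (p ^ e * a)))
      ≡⟨ regroup₁ (v 1) o i (S G) _ ⟩
    o * (v 1 * S G) + i * (v 1 * S (λ a → G (p ^ e * a)))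
      ≤⟨ +-mono-≤ (*-monoʳ-≤ o (IH G)) (*-monoʳ-≤ i (IH (λ a → G (p ^ e * a)))) ⟩
    o * (o ^ r * ∑ (divisors m) (λ a → v a * G (a ^ e))) + i * (o ^ r * ∑ (divisors m) (λ a → v a * G (p ^ e * a ^ e)))
      ≡⟨ regroup₂ o i (o ^ r) _ _ ⟩
    o ^ suc r * ∑ (divisors m) (λ a → v a * G (a ^ e)) + o ^ r * (i * ∑ (divisors m) (λ a → v a * G (p ^ e * a ^ e)))
      ≡⟨ cong (λ x → o ^ suc r * ∑ (divisors m) (λ a → v a * G (a ^ e)) + o ^ r * x) (sym (∑-*ˡ i (divisors m) _)) ⟩
    o ^ suc r * ∑ (divisors m) (λ a → v a * G (a ^ e)) + o ^ r * ∑ (divisors m) (λ a → i * (v a * G (p ^ e * a ^ e)))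
      ≤⟨ +-monoʳ-≤ (o ^ suc r * ∑ (divisors m) (λ a → v a * G (a ^ e))) (*-monoʳ-≤ (o ^ r) (∑-mono (divisors m) pointwise)) ⟩
    o ^ suc r * ∑ (divisors m) (λ a → v a * G (a ^ e)) + o ^ r * ∑ (divisors m) (λ a → o * (v (p * a) * G ((p * a) ^ e)))
      ≡⟨ cong (λ x → o ^ suc r * ∑ (divisors m) (λ a → v a * G (a ^ e)) + o ^ r * x) (∑-*ˡ o (divisors m) _) ⟩
    o ^ suc r * ∑ (divisors m) (λ a → v a * G (a ^ e)) + o ^ r * (o * ∑ (divisors m) (λ a → v (p * a) * G ((p * a) ^ e)))
      ≡⟨ regroup₃ o (o ^ r) (∑ (divisors m) (λ a → v a * G (a ^ e))) _ ⟩
    o ^ suc r * (∑ (divisors m) (λ a → v a * G (a ^ e)) + ∑ (divisors m) (λ a → v (p * a) * G ((p * a) ^ e)))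
      ≤⟨ *-monoʳ-≤ (o ^ suc r) (∑-divisors-prime* pr (product-pos prs) p∤m (λ a → v a * G (a ^ e))) ⟩
    o ^ suc r * ∑ (divisors (p * m)) (λ a → v a * G (a ^ e))  ∎
    where
    open ≤-Reasoning
    m = product ps
    r = length ps
    S = ∑-subsets o i e ps
    p∤m : ¬ p ∣ m
    p∤m p∣m = All.lookup p≢ (prime∣product pr prs p∣m) refl
    IH = ∑-subsets≤∑-divisors o i e v ps prs uniq (λ pr′ 0<a p′∤a p′a∣m → h pr′ 0<a p′∤a (∣n⇒∣m*n p p′a∣m))
    pointwise : ∀ {a} → a ∈ divisors m → i * (v a * G (p ^ e * a ^ e)) ≤ o * (v (p * a) * G ((p * a) ^ e))
    pointwise {a} a∈ = let 0<a , a∣m = ∈-divisors⁻ m a∈ in begin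
      i * (v a * G (p ^ e * a ^ e))        ≡⟨ *-assoc i (v a) _ ⟨
      i * v a * G (p ^ e * a ^ e)          ≡⟨ cong (λ x → i * v a * G x) (^-distribʳ-* e p a) ⟨
      i * v a * G ((p * a) ^ e)            ≤⟨ *-monoˡ-≤ _ (h pr 0<a (λ p∣a → p∤m (∣-trans p∣a a∣m)) (*-monoʳ-∣ p a∣m)) ⟩
      o * v (p * a) * G ((p * a) ^ e)      ≡⟨ *-assoc o (v (p * a)) _ ⟩
      o * (v (p * a) * G ((p * a) ^ e))    ∎
    regroup₁ : ∀ v o i x y → v * (o * x + i * y) ≡ o * (v * x) + i * (v * y)
    regroup₁ = solve-∀
    regroup₂ : ∀ o i r x y → o * (r * x) + i * (r * y) ≡ o * r * x + r * (i * y)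
    regroup₂ = solve-∀
    regroup₃ : ∀ o r x y → o * r * x + r * (o * y) ≡ o * r * (x + y)
    regroup₃ = solve-∀

  unique-drop : ∀ {A : Set} (as : List A) {x bs} → Unique (as ++ x ∷ bs) → Unique (as ++ bs)
  unique-drop []       (_ ∷ u)  = u
  unique-drop (a ∷ as) (a≢ ∷ u) =
    All.++⁺ (All.++⁻ˡ as a≢) (All.tail (All.++⁻ʳ as a≢)) ∷ unique-drop as u

  -- Squarefree parts and the divisor inequality at the cube root

  record SquarefreeTimesSquare (n : ℕ) : Set where
    field
      ps     : List ℕ
      primes : All Prime ps
      uniq   : Unique ps
      s      : ℕ
      n≡     : n ≡ product ps * s ^ 2

  abstract
    squarefree-times-square : ∀ {n} → 0 < n → SquarefreeTimesSquare n
    squarefree-times-square {n} 0<n = subst SquarefreeTimesSquare (sym isFactorisation) (go factors factorsPrime)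
      where
      open PrimeFactorisation (factorise n {{>-nonZero 0<n}})
      go : ∀ qs → All Prime qs → SquarefreeTimesSquare (product qs)
      go [] [] = record { ps = [] ; primes = [] ; uniq = [] ; s = 1 ; n≡ = refl }
      go (p ∷ qs) (pr ∷ prs) with go qs prs
      ... | record { ps = ps ; primes = primes ; uniq = uniq ; s = s ; n≡ = n≡ } with p ∣? product ps
      ...   | no p∤ = record
        { ps = p ∷ ps ; primes = pr ∷ primes
        ; uniq = All.tabulate (λ {p′} p′∈ p≡p′ → p∤ (subst (_∣ product ps) (sym p≡p′) (∈⇒∣product p′∈))) ∷ uniq
        ; s = s ; n≡ = trans (cong (p *_) n≡) (sym (*-assoc p (product ps) (s ^ 2))) }
      -- A repeated prime is taken out of the squarefree part, and its two copies become one factor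
      -- `p` of `s`.
      ...   | yes p∣ with as , bs , refl ← ∈-∃++ (prime∣product pr primes p∣) = record
        { ps = as ++ bs
        ; primes = All.tail (All-resp-↭ (shift p as bs) primes)
        ; uniq = unique-drop as uniq
        ; s = p * s
        ; n≡ = begin
            p * product qs                        ≡⟨ cong (p *_) n≡ ⟩
            p * (product (as ++ p ∷ bs) * s ^ 2)  ≡⟨ cong (λ x → p * (x * s ^ 2)) (product-↭ (shift p as bs)) ⟩
            p * (p * product (as ++ bs) * s ^ 2)  ≡⟨ regroup p (product (as ++ bs)) s ⟩
            product (as ++ bs) * (p * s) ^ 2      ∎ }
        where
        open ≡-Reasoning
        regroup : ∀ p m s → p * (p * m * (s * (s * 1))) ≡ m * (p * s * (p * s * 1))
        regroup = solve-∀

  τ-product-^ : ∀ e {ps} → All Prime ps → τ (product ps ^ e) ≤ suc e ^ length ps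
  τ-product-^ e [] = ≤-reflexive (cong τ (^-zeroˡ e))
  τ-product-^ e {p ∷ ps} (pr ∷ prs) = begin
    τ ((p * product ps) ^ e)          ≡⟨ cong τ (^-distribʳ-* e p (product ps)) ⟩
    τ (p ^ e * product ps ^ e)        ≤⟨ τ-* (p ^ e) (product ps ^ e) (^-pos e (prime-pos pr)) (^-pos e (product-pos prs)) ⟩
    τ (p ^ e) * τ (product ps ^ e)    ≤⟨ *-mono-≤ (τ-prime-power pr e) (τ-product-^ e prs) ⟩
    suc e * suc e ^ length ps         ∎
    where open ≤-Reasoning

  -- The exponents 1, 2, 4 belong to the three kinds of items. The exponent of `t` is 2 because the
  -- cube t⁶ must fit into the factor t⁸ of n, while the sum over `t` must converge.
  modulus : ℕ → ℕ → ℕ → ℕ → ℕ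
  modulus a b c t = a * (b ^ 2 * (c ^ 4 * t ^ 2))

  -- On squarefree arguments `τ b ^ 4` and `τ c ^ 12` multiply by 16 = 2⁴ and 4096 = 2¹² for each
  -- prime, the weights of taking a square or fourth-power item. The power `τ t ^ 8` pays for τ(t⁸).
  weight : (ℕ → ℕ) → ℕ → ℕ → ℕ → ℕ → ℕ
  weight g a b c t = g a * (τ b ^ 4 * (τ c ^ 12 * τ t ^ 8))

  ∑⁴ : ℕ → (ℕ → ℕ → ℕ → ℕ → ℕ) → ℕ
  ∑⁴ B f = ∑ (range B) λ a → ∑ (range B) λ b → ∑ (range B) λ c → ∑ (range B) λ t → f a b c t

  θs-block : ∀ (mk : ℕ → Item) k → (∀ p → Item.θ (mk p) ≡ k) → ∀ ps rest → θs (map mk ps ++ rest) ≡ k ^ length ps * θs rest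
  θs-block mk k θ≡ []       rest = sym (+-identityʳ _)
  θs-block mk k θ≡ (p ∷ ps) rest = trans (cong₂ _*_ (θ≡ p) (θs-block mk k θ≡ ps rest)) (sym (*-assoc k _ _))

  sizes-block : ∀ (mk : ℕ → Item) e → (∀ p → Item.size (mk p) ≡ p ^ e) → ∀ ps rest →
                sizes (map mk ps ++ rest) ≡ product ps ^ e * sizes rest
  sizes-block mk e size≡ []       rest = sym (trans (cong (_* sizes rest) (^-zeroˡ e)) (+-identityʳ _))
  sizes-block mk e size≡ (p ∷ ps) rest = begin
    Item.size (mk p) * sizes (map mk ps ++ rest)  ≡⟨ cong₂ _*_ (size≡ p) (sizes-block mk e size≡ ps rest) ⟩
    p ^ e * (product ps ^ e * sizes rest)         ≡⟨ *-assoc (p ^ e) _ _ ⟨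
    p ^ e * product ps ^ e * sizes rest           ≡⟨ cong (_* sizes rest) (^-distribʳ-* e p (product ps)) ⟨
    (p * product ps) ^ e * sizes rest             ∎
    where open ≡-Reasoning

  ∑-scale : ∀ {m B} → 0 < m → m ≤ B → ∀ k (v F F′ : ℕ → ℕ) →
            (∀ {a} → 0 < a → a ∣ m → k * v a * F a ≤ F′ a) →
            k * ∑ (divisors m) (λ a → v a * F a) ≤ ∑ (range B) F′
  ∑-scale {m} {B} 0<m m≤B k v F F′ h = begin
    k * ∑ (divisors m) (λ a → v a * F a)     ≡⟨ ∑-*ˡ k (divisors m) _ ⟨
    ∑ (divisors m) (λ a → k * (v a * F a))   ≤⟨ ∑-inject _≡_ (divisors m) (range B) (divisors! m) embed (λ p q → trans p (sym q)) ⟩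
    ∑ (range B) F′                           ∎
    where
    open ≤-Reasoning
    embed : ∀ {a} → a ∈ divisors m → k * (v a * F a) ≡ 0 ⊎
            ∃ λ a′ → a′ ∈ range B × a ≡ a′ × k * (v a * F a) ≤ F′ a′
    embed {a} a∈ = let 0<a , a∣m = ∈-divisors⁻ m a∈ in
      inj₂ (a , ∈-range⁺ 0<a (≤-trans (∣-≤ 0<m a∣m) m≤B) , refl ,
            ≤-trans (≤-reflexive (sym (*-assoc k (v a) (F a)))) (h 0<a a∣m))

  2^τ^≤τ^-prime* : ∀ k {p a} → Prime p → 0 < a → ¬ p ∣ a → 2 ^ k * τ a ^ k ≤ 1 * τ (p * a) ^ k
  2^τ^≤τ^-prime* k {p} {a} pr 0<a p∤a = begin
    2 ^ k * τ a ^ k        ≡⟨ ^-distribʳ-* k 2 (τ a) ⟨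
    (2 * τ a) ^ k          ≤⟨ ^-monoˡ-≤ k (2τ≤τ-prime* pr 0<a p∤a) ⟩
    τ (p * a) ^ k          ≡⟨ *-identityˡ _ ⟨
    1 * τ (p * a) ^ k      ∎
    where open ≤-Reasoning

  ∑-subsets≤∑τ^ : ∀ k e {ps} → All Prime ps → Unique ps → ∀ G →
                  ∑-subsets 1 (2 ^ k) e ps G ≤ ∑ (divisors (product ps)) (λ a → τ a ^ k * G (a ^ e))
  ∑-subsets≤∑τ^ k e {ps} prs uniq G = begin
    ∑-subsets 1 (2 ^ k) e ps G              ≡⟨ *-identityˡ _ ⟨
    1 * ∑-subsets 1 (2 ^ k) e ps G          ≡⟨ cong (_* ∑-subsets 1 (2 ^ k) e ps G) (^-zeroˡ k) ⟨
    τ 1 ^ k * ∑-subsets 1 (2 ^ k) e ps G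
      ≤⟨ ∑-subsets≤∑-divisors 1 (2 ^ k) e (λ a → τ a ^ k) ps prs uniq (λ pr 0<a p∤a _ → 2^τ^≤τ^-prime* k pr 0<a p∤a) G ⟩
    1 ^ length ps * ∑ (divisors (product ps)) (λ a → τ a ^ k * G (a ^ e))
      ≡⟨ trans (cong (_* ∑ (divisors (product ps)) (λ a → τ a ^ k * G (a ^ e))) (^-zeroˡ (length ps))) (*-identityˡ _) ⟩
    ∑ (divisors (product ps)) (λ a → τ a ^ k * G (a ^ e))  ∎
    where open ≤-Reasoning

  -- The multiple R of τ₃ / τ; on squarefree a this is R (3/2)^ω(a).
  IsRatio : ℕ → ℕ → (ℕ → ℕ) → Set
  IsRatio R B g = ∀ {a} → 0 < a → a ≤ B → g a * τ a ≡ R * τ₃ a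

  -- `g` is known only through its product with τ, so the comparison is made after multiplying by
  -- `τ a`: a new prime multiplies τ₃ by at least 3 and τ by at most 2.
  ratio-prime* : ∀ {R B g} → IsRatio R B g → ∀ {p a} → Prime p → 0 < a → ¬ p ∣ a → p * a ≤ B → 3 * g a ≤ 2 * g (p * a)
  ratio-prime* {R} {B} {g} ratio {p} {a} pr 0<a p∤a pa≤B = *-cancelʳ-≤ _ _ (τ a) {{>-nonZero (τ-pos 0<a)}} (begin
    3 * g a * τ a            ≡⟨ *-assoc 3 (g a) (τ a) ⟩
    3 * (g a * τ a)          ≡⟨ cong (3 *_) (ratio 0<a (≤-trans (m≤n*m a p {{prime⇒nonZero pr}}) pa≤B)) ⟩
    3 * (R * τ₃ a)           ≡⟨ swap 3 R (τ₃ a) ⟩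
    R * (3 * τ₃ a)           ≤⟨ *-monoʳ-≤ R (3τ₃≤τ₃-prime* pr 0<a p∤a) ⟩
    R * τ₃ (p * a)           ≡⟨ ratio (*-pos (prime-pos pr) 0<a) pa≤B ⟨
    g (p * a) * τ (p * a)    ≤⟨ *-monoʳ-≤ (g (p * a)) (τ-prime*≤2τ pr 0<a) ⟩
    g (p * a) * (2 * τ a)    ≡⟨ regroup (g (p * a)) (τ a) ⟩
    2 * g (p * a) * τ a      ∎)
    where
    open ≤-Reasoning
    swap : ∀ a b c → a * (b * c) ≡ b * (a * c)
    swap = solve-∀
    regroup : ∀ a b → a * (2 * b) ≡ 2 * a * b
    regroup = solve-∀

  -- Extracting a squarefree part k times leaves an uncoloured factor t to the power 2^k, of which q
  -- can contain tʲ only when 3j ≤ 2^k. A convergent sum over t needs j ≥ 2, hence k = 3: n =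
  -- P₀P₁²P₂⁴t⁸, and q receives t². The three squarefree parts are coloured prime by prime.
  module Landreau {R B g} (ratio : IsRatio R B g) {n} (0<n : 0 < n) (n≤B : n ≤ B) where
    private
      module D₀ = SquarefreeTimesSquare (squarefree-times-square 0<n)
      0<s₀² : 0 < D₀.s ^ 2
      0<s₀² = pos-*ʳ (product D₀.ps) _ (subst (0 <_) D₀.n≡ 0<n)
      module D₁ = SquarefreeTimesSquare (squarefree-times-square (pos-*ˡ D₀.s _ 0<s₀²))
      0<s₁² : 0 < D₁.s ^ 2
      0<s₁² = pos-*ʳ (product D₁.ps) _ (subst (0 <_) D₁.n≡ (pos-*ˡ D₀.s _ 0<s₀²))
      module D₂ = SquarefreeTimesSquare (squarefree-times-square (pos-*ˡ D₁.s _ 0<s₁²))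
      P₀ P₁ P₂ t r₀ r₁ r₂ w : ℕ
      P₀ = product D₀.ps
      P₁ = product D₁.ps
      P₂ = product D₂.ps
      t  = D₂.s
      r₀ = length D₀.ps
      r₁ = length D₁.ps
      r₂ = length D₂.ps
      w  = P₀ * (P₁ ^ 2 * P₂ ^ 4)

      0<P₀ = product-pos D₀.primes
      0<P₁ = product-pos D₁.primes
      0<P₂ = product-pos D₂.primes
      0<t : 0 < t
      0<t = pos-*ˡ t _ (pos-*ʳ P₂ (t ^ 2) (subst (0 <_) D₂.n≡ (pos-*ˡ D₁.s _ 0<s₁²)))

      n≡ : n ≡ P₀ * (P₁ ^ 2 * (P₂ ^ 4 * t ^ 8))
      n≡ = begin
        n                                  ≡⟨ D₀.n≡ ⟩
        P₀ * D₀.s ^ 2                      ≡⟨ cong (λ x → P₀ * x ^ 2) D₁.n≡ ⟩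
        P₀ * (P₁ * D₁.s ^ 2) ^ 2           ≡⟨ cong (λ x → P₀ * (P₁ * x ^ 2) ^ 2) D₂.n≡ ⟩
        P₀ * (P₁ * (P₂ * t ^ 2) ^ 2) ^ 2   ≡⟨ cong (P₀ *_) (expand P₁ P₂ t) ⟩
        P₀ * (P₁ ^ 2 * (P₂ ^ 4 * t ^ 8))   ∎
        where
        open ≡-Reasoning
        expand : ∀ a b c → (a * (b * (c * (c * 1)) * (b * (c * (c * 1)) * 1))) * ((a * (b * (c * (c * 1)) * (b * (c * (c * 1)) * 1))) * 1)
          ≡ a * (a * 1) * (b * (b * (b * (b * 1))) * (c * (c * (c * (c * (c * (c * (c * (c * 1)))))))))
        expand = solve-∀

      n≡w*t⁸ : n ≡ w * t ^ 8
      n≡w*t⁸ = trans n≡ (regroup P₀ (P₁ ^ 2) (P₂ ^ 4) (t ^ 8))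
        where
        regroup : ∀ a b c d → a * (b * (c * d)) ≡ a * (b * c) * d
        regroup = solve-∀

      its₂ its₁ its : List Item
      its₂ = map fourth-item D₂.ps ++ []
      its₁ = map square-item D₁.ps ++ its₂
      its  = map prime-item D₀.ps ++ its₁

      sizes≡ : sizes its ≡ w
      sizes≡ = trans (sizes-block prime-item 1 (λ p → sym (*-identityʳ p)) D₀.ps its₁)
        (cong₂ _*_ (*-identityʳ P₀) (trans (sizes-block square-item 2 (λ p → refl) D₁.ps its₂)
          (cong (P₁ ^ 2 *_) (trans (sizes-block fourth-item 4 (λ p → refl) D₂.ps []) (*-identityʳ (P₂ ^ 4))))))

      θs≡ : θs its ≡ 4 ^ r₀ * (3 ^ r₁ * 5 ^ r₂)
      θs≡ = trans (θs-block prime-item 4 (λ p → refl) D₀.ps its₁)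
        (cong (4 ^ r₀ *_) (trans (θs-block square-item 3 (λ p → refl) D₁.ps its₂)
          (cong (3 ^ r₁ *_) (trans (θs-block fourth-item 5 (λ p → refl) D₂.ps []) (*-identityʳ (5 ^ r₂))))))

      S₁ : (ℕ → ℕ) → ℕ → ℕ
      S₁ G x = ∑ (divisors P₁) λ b → τ b ^ 4 * ∑ (divisors P₂) λ c → τ c ^ 12 * G (x * (b ^ 2 * (c ^ 4 * 1)))

      S : (ℕ → ℕ) → ℕ
      S G = ∑ (divisors P₀) λ a → g a * S₁ G (a ^ 1)

      P₀∣n : P₀ ∣ n
      P₀∣n = subst (P₀ ∣_) (sym n≡) (m∣m*n _)

      g1≡R : g 1 ≡ R
      g1≡R = trans (sym (*-identityʳ (g 1))) (trans (ratio (s≤s z≤n) (≤-trans 0<n n≤B)) (*-identityʳ R))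

      -- The factor `R` is `g 1`, the normalisation required by `∑-subsets≤∑-divisors`, and `2 ^ r₀`
      -- is the weight 2 of omitting a prime item, once for each of them.
      R∑gain≤ : ∀ G → R * ∑gain its G ≤ 2 ^ r₀ * S G
      R∑gain≤ G = begin
        R * ∑gain its G
          ≡⟨ cong (R *_) (trans (∑gain-block prime-item 2 3 1 (λ p → refl) (λ p → refl) (λ p → sym (*-identityʳ p)) D₀.ps its₁ G)
               (∑-subsets-cong 2 3 1 D₀.ps λ a → trans (∑gain-block square-item 1 16 2 (λ p → refl) (λ p → refl) (λ p → refl) D₁.ps its₂ (λ y → G (a * y)))
               (∑-subsets-cong 1 16 2 D₁.ps λ b → trans (∑gain-block fourth-item 1 4096 4 (λ p → refl) (λ p → refl) (λ p → refl) D₂.ps [] (λ y → G (a * (b * y))))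
               (∑-subsets-cong 1 4096 4 D₂.ps λ c →
                 trans (+-identityʳ (G (a * (b * (c * 1))) + 0)) (+-identityʳ (G (a * (b * (c * 1))))))))) ⟩
        R * ∑-subsets 2 3 1 D₀.ps (λ a → ∑-subsets 1 16 2 D₁.ps (λ b → ∑-subsets 1 4096 4 D₂.ps (λ c → G (a * (b * (c * 1))))))
          ≤⟨ *-monoʳ-≤ R (∑-subsets-mono 2 3 1 D₀.ps λ a → ≤-trans
               (∑-subsets-mono 1 16 2 D₁.ps λ b → ∑-subsets≤∑τ^ 12 4 D₂.primes D₂.uniq (λ x → G (a * (b * (x * 1)))))
               (∑-subsets≤∑τ^ 4 2 D₁.primes D₁.uniq
                 (λ x → ∑ (divisors P₂) λ c → τ c ^ 12 * G (a * (x * (c ^ 4 * 1)))))) ⟩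
        R * ∑-subsets 2 3 1 D₀.ps (S₁ G)
          ≡⟨ cong (_* ∑-subsets 2 3 1 D₀.ps (S₁ G)) g1≡R ⟨
        g 1 * ∑-subsets 2 3 1 D₀.ps (S₁ G)
          ≤⟨ ∑-subsets≤∑-divisors 2 3 1 g D₀.ps D₀.primes D₀.uniq
               (λ pr 0<a p∤a pa∣P₀ → ratio-prime* {R} {B} {g} ratio pr 0<a p∤a
                 (≤-trans (∣-≤ 0<n (∣-trans pa∣P₀ P₀∣n)) n≤B)) (S₁ G) ⟩
        2 ^ r₀ * S G  ∎
        where open ≤-Reasoning

      G₀ : ℕ → ℕ
      G₀ x = 𝟙 (small? w x)

      θs-bound : R * (2 ^ r₀ * (3 ^ r₁ * 5 ^ r₂)) ≤ 7776 * S G₀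
      -- `4 ^ r₀` contains the doubling of θ and the bound `2 ^ r₀` for τ(P₀). The doubling cancels
      -- against the doubled weights of the prime items.
      θs-bound = *-cancelˡ-≤ (2 ^ r₀) {{>-nonZero (^-pos r₀ (s≤s z≤n))}} (begin
        2 ^ r₀ * (R * (2 ^ r₀ * (3 ^ r₁ * 5 ^ r₂)))   ≡⟨ regroup₁ (2 ^ r₀) R (3 ^ r₁ * 5 ^ r₂) ⟩
        R * (2 ^ r₀ * 2 ^ r₀ * (3 ^ r₁ * 5 ^ r₂))     ≡⟨ cong (λ x → R * (x * (3 ^ r₁ * 5 ^ r₂))) (^-distribʳ-* r₀ 2 2) ⟨
        R * (4 ^ r₀ * (3 ^ r₁ * 5 ^ r₂))              ≡⟨ cong (R *_) θs≡ ⟨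
        R * θs its                                    ≤⟨ *-monoʳ-≤ R (θs≤∑gain its) ⟩
        R * (7776 * ∑gain its (λ x → 𝟙 (small? (sizes its) x)))
          ≡⟨ cong (λ v → R * (7776 * ∑gain its (λ x → 𝟙 (small? v x)))) sizes≡ ⟩
        R * (7776 * ∑gain its G₀)                        ≡⟨ regroup₂ R 7776 (∑gain its G₀) ⟩
        7776 * (R * ∑gain its G₀)                        ≤⟨ *-monoʳ-≤ 7776 (R∑gain≤ G₀) ⟩
        7776 * (2 ^ r₀ * S G₀)                        ≡⟨ regroup₂ 7776 (2 ^ r₀) (S G₀) ⟩
        2 ^ r₀ * (7776 * S G₀)                        ∎)
        where
        open ≤-Reasoning
        regroup₁ : ∀ a b c → a * (b * (a * c)) ≡ b * (a * a * c)
        regroup₁ = solve-∀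
        regroup₂ : ∀ a b c → a * (b * c) ≡ b * (a * c)
        regroup₂ = solve-∀

      τn≤ : τ n ≤ 2 ^ r₀ * (3 ^ r₁ * 5 ^ r₂) * τ t ^ 8
      τn≤ = begin
        τ n                                             ≡⟨ cong τ n≡ ⟩
        τ (P₀ * (P₁ ^ 2 * (P₂ ^ 4 * t ^ 8)))            ≤⟨ τ-* P₀ _ 0<P₀ (*-pos 0<P₁² (*-pos 0<P₂⁴ 0<t⁸)) ⟩
        τ P₀ * τ (P₁ ^ 2 * (P₂ ^ 4 * t ^ 8))            ≤⟨ *-monoʳ-≤ (τ P₀) (τ-* (P₁ ^ 2) _ 0<P₁² (*-pos 0<P₂⁴ 0<t⁸)) ⟩
        τ P₀ * (τ (P₁ ^ 2) * τ (P₂ ^ 4 * t ^ 8))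
          ≤⟨ *-monoʳ-≤ (τ P₀) (*-monoʳ-≤ (τ (P₁ ^ 2)) (τ-* (P₂ ^ 4) _ 0<P₂⁴ 0<t⁸)) ⟩
        τ P₀ * (τ (P₁ ^ 2) * (τ (P₂ ^ 4) * τ (t ^ 8)))
          ≤⟨ *-mono-≤ (subst (λ x → τ x ≤ 2 ^ r₀) (*-identityʳ P₀) (τ-product-^ 1 D₀.primes))
               (*-mono-≤ (τ-product-^ 2 D₁.primes) (*-mono-≤ (τ-product-^ 4 D₂.primes) (τ-^ 8 t 0<t))) ⟩
        2 ^ r₀ * (3 ^ r₁ * (5 ^ r₂ * τ t ^ 8))          ≡⟨ regroup (2 ^ r₀) (3 ^ r₁) (5 ^ r₂) (τ t ^ 8) ⟩
        2 ^ r₀ * (3 ^ r₁ * 5 ^ r₂) * τ t ^ 8            ∎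
        where
        open ≤-Reasoning
        0<P₁² = ^-pos 2 0<P₁
        0<P₂⁴ = ^-pos 4 0<P₂
        0<t⁸ = ^-pos 8 0<t
        regroup : ∀ a b c d → a * (b * (c * d)) ≡ a * (b * c) * d
        regroup = solve-∀

      term : ℕ → ℕ → ℕ → ℕ → ℕ
      term a b c t = 𝟙 (modulus a b c t ∣? n) * (𝟙 (small? n (modulus a b c t)) * weight g a b c t)

      ≤B : ∀ {x} → x ∣ n → x ≤ B
      ≤B x∣n = ≤-trans (∣-≤ 0<n x∣n) n≤B

      P₁∣n : P₁ ∣ n
      P₁∣n = subst (P₁ ∣_) (sym n≡) (∣n⇒∣m*n P₀ (∣m⇒∣m*n _ (m∣m*n _)))
      P₂∣n : P₂ ∣ n
      P₂∣n = subst (P₂ ∣_) (sym n≡) (∣n⇒∣m*n P₀ (∣n⇒∣m*n (P₁ ^ 2) (∣m⇒∣m*n _ (m∣m*n _))))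
      t∣n : t ∣ n
      t∣n = subst (t ∣_) (sym n≡) (∣n⇒∣m*n P₀ (∣n⇒∣m*n (P₁ ^ 2) (∣n⇒∣m*n (P₂ ^ 4) (m∣m*n _))))

      term-bound : ∀ {a b c} → a ∣ P₀ → b ∣ P₁ → c ∣ P₂ →
                   τ t ^ 8 * g a * τ b ^ 4 * τ c ^ 12 * G₀ (a ^ 1 * (b ^ 2 * (c ^ 4 * 1))) ≤ term a b c t
      term-bound {a} {b} {c} a∣ b∣ c∣ = ≤-trans (≤-reflexive (*-comm (τ t ^ 8 * g a * τ b ^ 4 * τ c ^ 12) (G₀ x))) (𝟙*-≤ (small? w x) λ sm → ≤-reflexive (begin
        τ t ^ 8 * g a * τ b ^ 4 * τ c ^ 12       ≡⟨ regroup (τ t ^ 8) (g a) (τ b ^ 4) (τ c ^ 12) ⟩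
        weight g a b c t                         ≡⟨ *-identityˡ (weight g a b c t) ⟨
        1 * weight g a b c t                     ≡⟨ *-identityˡ (1 * weight g a b c t) ⟨
        1 * (1 * weight g a b c t)               ≡⟨ cong₂ (λ x y → x * (y * weight g a b c t)) (𝟙-yes (modulus a b c t ∣? n) q∣n) (𝟙-yes (small? n (modulus a b c t)) (q³≤n sm)) ⟨
        term a b c t                             ∎))
        where
        open ≡-Reasoning
        x : ℕ
        x = a ^ 1 * (b ^ 2 * (c ^ 4 * 1))
        regroup : ∀ a b c d → a * b * c * d ≡ b * (c * (d * a))
        regroup = solve-∀
        ^-pres-∣ : ∀ k {x y} → x ∣ y → x ^ k ∣ y ^ k
        ^-pres-∣ zero    x∣y = ∣-refl
        ^-pres-∣ (suc k) x∣y = *-pres-∣ x∣y (^-pres-∣ k x∣y)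
        q∣n : modulus a b c t ∣ n
        q∣n = subst (modulus a b c t ∣_) (sym n≡) (*-pres-∣ a∣ (*-pres-∣ (^-pres-∣ 2 b∣) (*-pres-∣ (^-pres-∣ 4 c∣)
          (divides (t ^ 6) (^-distribˡ-+-* t 6 2)))))
        split : ∀ a b c t → cube (a * (b * (c * (t * (t * 1)))))
                ≡ cube (a * 1 * (b * (c * 1))) * (t * (t * (t * (t * (t * (t * 1))))))
        split a b c t = poly a b c t
          where
          poly : ∀ a b c t → (a * (b * (c * (t * (t * 1))))) * (a * (b * (c * (t * (t * 1))))) * (a * (b * (c * (t * (t * 1)))))
            ≡ (a * 1 * (b * (c * 1))) * (a * 1 * (b * (c * 1))) * (a * 1 * (b * (c * 1))) * (t * (t * (t * (t * (t * (t * 1))))))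
          poly = solve-∀
        q³≤n : cube (a ^ 1 * (b ^ 2 * (c ^ 4 * 1))) ≤ w → cube (modulus a b c t) ≤ n
        q³≤n sm = ≤-trans (≤-reflexive (split a (b ^ 2) (c ^ 4) t)) (≤-trans
          (*-mono-≤ sm (^-monoʳ-≤ t {{>-nonZero 0<t}} {6} {8} (s≤s (s≤s (s≤s (s≤s (s≤s (s≤s z≤n))))))))
          (≤-reflexive (sym n≡w*t⁸)))

      S-bound : τ t ^ 8 * S G₀ ≤ ∑⁴ B term
      S-bound =
        ∑-scale 0<P₀ (≤B P₀∣n) (τ t ^ 8) g _ _ λ {a} _ a∣ →
        ∑-scale 0<P₁ (≤B P₁∣n) (τ t ^ 8 * g a) (λ b → τ b ^ 4) _ _ λ {b} _ b∣ →
        ∑-scale 0<P₂ (≤B P₂∣n) (τ t ^ 8 * g a * τ b ^ 4) (λ c → τ c ^ 12) _ _ λ {c} _ c∣ →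
        ≤-trans (term-bound a∣ b∣ c∣) (∑-term (∈-range⁺ 0<t (≤B t∣n)))
        where
        ∑-term : ∀ {x} {xs : List ℕ} {F : ℕ → ℕ} → x ∈ xs → F x ≤ ∑ xs F
        ∑-term (here refl) = m≤m+n _ _
        ∑-term (there x∈)  = ≤-trans (∑-term x∈) (m≤n+m _ _)

    Rτ≤ : R * τ n ≤ 7776 * ∑⁴ B (λ a b c t →
            𝟙 (modulus a b c t ∣? n) * (𝟙 (small? n (modulus a b c t)) * weight g a b c t))
    Rτ≤ = begin
      R * τ n                                                ≤⟨ *-monoʳ-≤ R τn≤ ⟩
      R * (2 ^ r₀ * (3 ^ r₁ * 5 ^ r₂) * τ t ^ 8)             ≡⟨ *-assoc R _ (τ t ^ 8) ⟨
      R * (2 ^ r₀ * (3 ^ r₁ * 5 ^ r₂)) * τ t ^ 8             ≤⟨ *-monoˡ-≤ (τ t ^ 8) θs-bound ⟩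
      7776 * S G₀ * τ t ^ 8                                  ≡⟨ regroup 7776 (S G₀) (τ t ^ 8) ⟩
      7776 * (τ t ^ 8 * S G₀)                                ≤⟨ *-monoʳ-≤ 7776 S-bound ⟩
      7776 * ∑⁴ B term                                       ∎
      where
      open ≤-Reasoning
      regroup : ∀ a b c → a * b * c ≡ a * (c * b)
      regroup = solve-∀

  abstract
    landreau : ∃[ L ] (∀ {R B g n} → IsRatio R B g → 0 < n → n ≤ B →
      R * τ n ≤ L * ∑⁴ B (λ a b c t →
        𝟙 (modulus a b c t ∣? n) * (𝟙 (small? n (modulus a b c t)) * weight g a b c t)))
    landreau = 7776 , λ {R} {B} {g} {n} ratio 0<n n≤B → Landreau.Rτ≤ {R} {B} {g} ratio {n} 0<n n≤B

  -- Sums of truncated quotients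

  infixl 7 _÷_
  -- The value 0 at divisor 0 makes the quotient total, so that iterated sums and the composition
  -- law `÷-÷` carry no side conditions.
  _÷_ : ℕ → ℕ → ℕ
  z ÷ zero  = 0
  z ÷ suc i = z / suc i

  ÷-*-≤ : ∀ z q → z ÷ q * q ≤ z
  ÷-*-≤ z zero    = z≤n
  ÷-*-≤ z (suc q) = m/n*n≤m z (suc q)

  ≤-÷ : ∀ {y z q} → 0 < q → y * q ≤ z → y ≤ z ÷ q
  ≤-÷ {y} {z} {suc q} _ yq≤z = subst (_≤ z / suc q) (m*n/n≡m y (suc q)) (/-monoˡ-≤ (suc q) yq≤z)

  ÷-monoˡ-≤ : ∀ {y z} q → y ≤ z → y ÷ q ≤ z ÷ q
  ÷-monoˡ-≤ zero    _   = z≤n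
  ÷-monoˡ-≤ (suc q) y≤z = /-monoˡ-≤ (suc q) y≤z

  ÷-antimonoʳ-≤ : ∀ z {q r} → 0 < q → q ≤ r → z ÷ r ≤ z ÷ q
  ÷-antimonoʳ-≤ z {q} {r} 0<q q≤r = ≤-÷ 0<q (≤-trans (*-monoʳ-≤ (z ÷ r) q≤r) (÷-*-≤ z r))

  0÷ : ∀ q → 0 ÷ q ≡ 0
  0÷ zero    = refl
  0÷ (suc q) = 0/n≡0 (suc q)

  -- Floors of successive quotients compose without loss. This exactness lets a sum over a product
  -- of variables be carried out one variable at a time inside ℕ.
  ÷-÷ : ∀ z a b → z ÷ (a * b) ≡ z ÷ a ÷ b
  ÷-÷ z zero    b       = sym (0÷ b)
  ÷-÷ z (suc a) zero    rewrite *-zeroʳ a = refl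
  ÷-÷ z (suc a) (suc b) = sym (m/n/o≡m/[n*o] z (suc a) (suc b))

  1≤÷ : ∀ {z q} → 0 < q → q ≤ z → 1 ≤ z ÷ q
  1≤÷ {z} {q} 0<q q≤z = ≤-÷ 0<q (≤-trans (≤-reflexive (+-identityʳ q)) q≤z)

  range-suc : ∀ n (f : ℕ → ℕ) → ∑ (range (suc n)) f ≡ ∑ (range n) f + f (suc n)
  range-suc n f = begin
    ∑ (range (suc n)) f                   ≡⟨ cong (λ xs → ∑ xs f) (applyUpTo-∷ʳ suc n) ⟨
    ∑ (range n ∷ʳ suc n) f                ≡⟨ ∑-++ (range n) (suc n ∷ []) f ⟩
    ∑ (range n) f + (f (suc n) + 0)       ≡⟨ cong (∑ (range n) f +_) (+-identityʳ _) ⟩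
    ∑ (range n) f + f (suc n)             ∎
    where open ≡-Reasoning

  -- ∑_{t ≤ n} 1/t² ≤ 2 - 1/n
  ∑÷²-telescoped : ∀ n z → suc n * ∑ (range (suc n)) (λ t → z ÷ t ^ 2) + z ≤ 2 * suc n * z
  ∑÷²-telescoped zero z = ≤-reflexive (trans (cong (λ x → x + 0 + 0 + z) (n/1≡n z)) (regroup z))
    where
    regroup : ∀ z → z + 0 + 0 + z ≡ 2 * z
    regroup = solve-∀
  ∑÷²-telescoped (suc n) z = *-cancelˡ-≤ (b * suc b) (begin
    b * suc b * (suc b * ∑ (range (suc b)) f + z)
      ≡⟨ cong (λ x → b * suc b * (suc b * x + z)) (range-suc b f) ⟩
    b * suc b * (suc b * (S + x) + z)
      ≡⟨ split b S x z ⟩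
    suc b * suc b * (b * S) + b * (x * suc b ^ 2) + b * suc b * z
      ≤⟨ +-monoˡ-≤ (b * suc b * z) (+-monoʳ-≤ (suc b * suc b * (b * S)) (*-monoʳ-≤ b (÷-*-≤ z (suc b ^ 2)))) ⟩
    suc b * suc b * (b * S) + b * z + b * suc b * z
      ≤⟨ m≤m+n _ z ⟩
    suc b * suc b * (b * S) + b * z + b * suc b * z + z
      ≡⟨ collect b S z ⟩
    suc b * suc b * (b * S + z)
      ≤⟨ *-monoʳ-≤ (suc b * suc b) (∑÷²-telescoped n z) ⟩
    suc b * suc b * (2 * b * z)
      ≡⟨ regroup b z ⟩
    b * suc b * (2 * suc b * z)  ∎)
    where
    open ≤-Reasoning
    b = suc n
    f = λ t → z ÷ t ^ 2
    S = ∑ (range b) f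
    x = f (suc b)
    split : ∀ b S x z → b * (1 + b) * ((1 + b) * (S + x) + z)
      ≡ (1 + b) * (1 + b) * (b * S) + b * (x * ((1 + b) * ((1 + b) * 1))) + b * (1 + b) * z
    split = solve-∀
    collect : ∀ b S z → (1 + b) * (1 + b) * (b * S) + b * z + b * (1 + b) * z + z ≡ (1 + b) * (1 + b) * (b * S + z)
    collect = solve-∀
    regroup : ∀ b z → (1 + b) * (1 + b) * (2 * b * z) ≡ b * (1 + b) * (2 * (1 + b) * z)
    regroup = solve-∀

  abstract
    -- Induction on `j`: one factor τ(t) is written as a sum over divisors, `t = d * e` is
    -- substituted, and submultiplicativity separates the variables. Each step squares the constant.
    ∑τ^÷² : ∀ j → ∃[ C ] (∀ B z → ∑ (range B) (λ t → τ t ^ j * (z ÷ t ^ 2)) ≤ C * z)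
    ∑τ^÷² zero = 2 , bound
      where
      open ≤-Reasoning
      bound : ∀ B z → ∑ (range B) (λ t → 1 * (z ÷ t ^ 2)) ≤ 2 * z
      bound zero    z = z≤n
      bound (suc n) z = *-cancelˡ-≤ (suc n) (begin
        suc n * ∑ (range (suc n)) (λ t → 1 * (z ÷ t ^ 2))  ≡⟨ cong (suc n *_) (∑-cong (range (suc n)) (λ t → *-identityˡ _)) ⟩
        suc n * ∑ (range (suc n)) (λ t → z ÷ t ^ 2)        ≤⟨ m≤m+n _ z ⟩
        suc n * ∑ (range (suc n)) (λ t → z ÷ t ^ 2) + z    ≤⟨ ∑÷²-telescoped n z ⟩
        2 * suc n * z                                      ≡⟨ regroup (suc n) z ⟩
        suc n * (2 * z)                                    ∎)
        where
        regroup : ∀ n z → 2 * n * z ≡ n * (2 * z)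
        regroup = solve-∀
    ∑τ^÷² (suc j) = let C , bound = ∑τ^÷² j in C * C , λ B z → begin
      ∑ (range B) (λ t → τ t ^ suc j * (z ÷ t ^ 2))
        ≡⟨ ∑-cong (range B) (expand z) ⟩
      ∑ (range B) (λ t → ∑ (divisors t) (λ d → τ t ^ j * (z ÷ t ^ 2)))
        ≤⟨ ∑-range-divisors B (λ d t → τ t ^ j * (z ÷ t ^ 2)) ⟩
      ∑ (range B) (λ d → ∑ (range B) (λ e → τ (d * e) ^ j * (z ÷ (d * e) ^ 2)))
        ≤⟨ ∑-mono (range B) (λ {d} d∈ → ∑-mono (range B) (λ {e} e∈ → separate z d e (proj₁ (∈-range⁻ d∈)) (proj₁ (∈-range⁻ e∈)))) ⟩
      ∑ (range B) (λ d → ∑ (range B) (λ e → τ d ^ j * (τ e ^ j * (z ÷ d ^ 2 ÷ e ^ 2))))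
        ≡⟨ ∑-cong (range B) (λ d → ∑-*ˡ (τ d ^ j) (range B) _) ⟩
      ∑ (range B) (λ d → τ d ^ j * ∑ (range B) (λ e → τ e ^ j * (z ÷ d ^ 2 ÷ e ^ 2)))
        ≤⟨ ∑-mono′ (range B) (λ d → *-monoʳ-≤ (τ d ^ j) (bound B (z ÷ d ^ 2))) ⟩
      ∑ (range B) (λ d → τ d ^ j * (C * (z ÷ d ^ 2)))
        ≡⟨ ∑-cong (range B) (λ d → swap (τ d ^ j) C (z ÷ d ^ 2)) ⟩
      ∑ (range B) (λ d → C * (τ d ^ j * (z ÷ d ^ 2)))
        ≡⟨ ∑-*ˡ C (range B) _ ⟩
      C * ∑ (range B) (λ d → τ d ^ j * (z ÷ d ^ 2))
        ≤⟨ *-monoʳ-≤ C (bound B z) ⟩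
      C * (C * z)
        ≡⟨ *-assoc C C z ⟨
      C * C * z  ∎
      where
      open ≤-Reasoning
      swap : ∀ a b c → a * (b * c) ≡ b * (a * c)
      swap = solve-∀
      expand : ∀ z t → τ t ^ suc j * (z ÷ t ^ 2) ≡ ∑ (divisors t) (λ d → τ t ^ j * (z ÷ t ^ 2))
      expand z t = trans (regroup (τ t) (τ t ^ j) (z ÷ t ^ 2)) (trans (sym (∑-*ˡ (τ t ^ j * (z ÷ t ^ 2)) (divisors t) (λ _ → 1)))
        (∑-cong (divisors t) (λ _ → *-identityʳ _)))
        where
        regroup : ∀ a b c → a * b * c ≡ b * c * a
        regroup = solve-∀
      separate : ∀ z d e → 0 < d → 0 < e →
                 τ (d * e) ^ j * (z ÷ (d * e) ^ 2) ≤ τ d ^ j * (τ e ^ j * (z ÷ d ^ 2 ÷ e ^ 2))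
      separate z d e 0<d 0<e = begin
        τ (d * e) ^ j * (z ÷ (d * e) ^ 2)
          ≤⟨ *-monoˡ-≤ _ (^-monoˡ-≤ j (τ-* d e 0<d 0<e)) ⟩
        (τ d * τ e) ^ j * (z ÷ (d * e) ^ 2)
          ≡⟨ cong₂ _*_ (^-distribʳ-* j (τ d) (τ e)) (trans (cong (z ÷_) (^-distribʳ-* 2 d e)) (÷-÷ z (d ^ 2) (e ^ 2))) ⟩
        τ d ^ j * τ e ^ j * (z ÷ d ^ 2 ÷ e ^ 2)
          ≡⟨ *-assoc (τ d ^ j) (τ e ^ j) _ ⟩
        τ d ^ j * (τ e ^ j * (z ÷ d ^ 2 ÷ e ^ 2))  ∎

    ∑τ^÷⁴ : ∀ j → ∃[ C ] (∀ B z → ∑ (range B) (λ t → τ t ^ j * (z ÷ t ^ 4)) ≤ C * z)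
    ∑τ^÷⁴ j = let C , bound = ∑τ^÷² j in C , λ B z → ≤-trans
      (∑-mono (range B) (λ {t} t∈ → let 0<t = proj₁ (∈-range⁻ t∈) in
        *-monoʳ-≤ (τ t ^ j) (÷-antimonoʳ-≤ z (^-pos 2 0<t) (^-monoʳ-≤ t {{>-nonZero 0<t}} {2} {4} (s≤s (s≤s z≤n))))))
      (bound B z)

  -- The sum of ⌊z / (i₁ ⋯ iⱼ)⌋ over all j-tuples from `range B`, an integer substitute for z times
  -- the j-th power of a harmonic sum.
  ∑÷ : ℕ → ℕ → ℕ → ℕ
  ∑÷ B zero    z = z
  ∑÷ B (suc j) z = ∑ (range B) (λ i → ∑÷ B j (z ÷ i))

  ∑τ÷ : ∀ B z → ∑ (range B) (λ a → τ a * (z ÷ a)) ≤ ∑÷ B 2 z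
  ∑τ÷ B z = begin
    ∑ (range B) (λ a → τ a * (z ÷ a))
      ≡⟨ ∑-cong (range B) (λ a → trans (*-comm (τ a) (z ÷ a)) (trans (sym (∑-*ˡ (z ÷ a) (divisors a) (λ _ → 1)))
           (∑-cong (divisors a) (λ _ → *-identityʳ _)))) ⟩
    ∑ (range B) (λ a → ∑ (divisors a) (λ _ → z ÷ a))
      ≤⟨ ∑-range-divisors B (λ _ a → z ÷ a) ⟩
    ∑ (range B) (λ d → ∑ (range B) (λ e → z ÷ (d * e)))
      ≡⟨ ∑-cong (range B) (λ d → ∑-cong (range B) (λ e → ÷-÷ z d e)) ⟩
    ∑÷ B 2 z  ∎
    where open ≤-Reasoning

  -- τ₃ is opened as a sum of τ over divisors `d`. The cofactor becomes the outer variable, so that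
  -- the inner sum is the one already bounded for τ.
  ∑τ₃÷ : ∀ B z → ∑ (range B) (λ a → τ₃ a * (z ÷ a)) ≤ ∑÷ B 3 z
  ∑τ₃÷ B z = begin
    ∑ (range B) (λ a → τ₃ a * (z ÷ a))
      ≡⟨ ∑-cong (range B) (λ a → trans (*-comm (τ₃ a) (z ÷ a)) (trans (sym (∑-*ˡ (z ÷ a) (divisors a) τ))
           (∑-cong (divisors a) (λ d → *-comm (z ÷ a) (τ d))))) ⟩
    ∑ (range B) (λ a → ∑ (divisors a) (λ d → τ d * (z ÷ a)))
      ≤⟨ ∑-range-divisors B (λ d a → τ d * (z ÷ a)) ⟩
    ∑ (range B) (λ d → ∑ (range B) (λ e → τ d * (z ÷ (d * e))))
      ≡⟨ ∑-swap (range B) (range B) _ ⟩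
    ∑ (range B) (λ e → ∑ (range B) (λ d → τ d * (z ÷ (d * e))))
      ≡⟨ ∑-cong (range B) (λ e → ∑-cong (range B) (λ d → cong (τ d *_) (trans (cong (z ÷_) (*-comm d e)) (÷-÷ z e d)))) ⟩
    ∑ (range B) (λ e → ∑ (range B) (λ d → τ d * (z ÷ e ÷ d)))
      ≤⟨ ∑-mono′ (range B) (λ e → ∑τ÷ B (z ÷ e)) ⟩
    ∑÷ B 3 z  ∎
    where open ≤-Reasoning

  -- Solutions of congruences in an interval

  value : ℕ → ℕ → ℕ
  value u d = 4 * (u * u * d) + 1

  ÷-+-*ʳ : ∀ {q} a k → 0 < q → (a + k * q) ÷ q ≡ a ÷ q + k
  ÷-+-*ʳ {suc q} a k _ = trans (+-distrib-/-∣ʳ a {k * suc q} (n∣m*n k)) (cong (a / suc q +_) (m*n/n≡m k (suc q)))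

  same-quotient : ∀ {q a e} → 0 < q → q ∣ e → a ÷ q ≡ (a + e) ÷ q → e ≡ 0
  same-quotient {q} {a} {e} 0<q (divides k refl) eq = cong (_* q) k≡0
    where
    k≡0 : k ≡ 0
    k≡0 = +-cancelˡ-≡ (a ÷ q) k 0 (trans (sym (÷-+-*ʳ a k 0<q)) (trans (sym eq) (sym (+-identityʳ _))))

  ≡-by-order : {P : ℕ → Set} → (∀ x e → P x → P (x + e) → e ≡ 0) → ∀ {x y} → P x → P y → x ≡ y
  ≡-by-order {P} h {x} {y} Px Py with ≤-total x y
  ... | inj₁ x≤y = let x+e≡y = m+[n∸m]≡n x≤y in
    trans (sym (+-identityʳ x)) (trans (cong (x +_) (sym (h x (y ∸ x) Px (subst P (sym x+e≡y) Py)))) x+e≡y)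
  ... | inj₂ y≤x = let y+e≡x = m+[n∸m]≡n y≤x in sym
    (trans (sym (+-identityʳ y)) (trans (cong (y +_) (sym (h y (x ∸ y) Py (subst P (sym y+e≡x) Px)))) y+e≡x))

  -- `value u d` is one more than 4u²d, so a divisor of both is 1. Every coprimality in the
  -- congruence counts is derived from this.
  ∣∣⇒∣1 : ∀ {q u d i} → q ∣ value u d → i ∣ q → i ∣ 4 * (u * u * d) → i ≡ 1
  ∣∣⇒∣1 q∣ i∣q i∣4u²d = ∣1⇒≡1 (∣m+n∣m⇒∣n (∣-trans i∣q q∣) i∣4u²d)

  -- A solution makes `q` coprime to 4u², so two solutions `d` differ by a multiple of `q`. A
  -- solution is therefore determined by its block `d ÷ q`, and there are `suc (X ÷ q)` blocks.
  count-d : ∀ u q X → 0 < q → ∑ (range X) (λ d → 𝟙 (q ∣? value u d)) ≤ suc (X ÷ q)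
  count-d u q X 0<q = begin
    ∑ (range X) (λ d → 𝟙 (q ∣? value u d))
      ≤⟨ ∑-inject R (range X) (upTo (suc (X ÷ q))) {g = λ _ → 1} (range! X) embed (λ r r′ → injective r r′) ⟩
    ∑ (upTo (suc (X ÷ q))) (λ _ → 1)     ≡⟨ length≡∑1 (upTo (suc (X ÷ q))) ⟨
    length (upTo (suc (X ÷ q)))          ≡⟨ length-upTo (suc (X ÷ q)) ⟩
    suc (X ÷ q)                          ∎
    where
    open ≤-Reasoning
    R : ℕ → ℕ → Set
    R d k = q ∣ value u d × d ÷ q ≡ k
    embed : ∀ {d} → d ∈ range X → 𝟙 (q ∣? value u d) ≡ 0 ⊎
            ∃ λ k → k ∈ upTo (suc (X ÷ q)) × R d k × 𝟙 (q ∣? value u d) ≤ 1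
    embed {d} d∈ with q ∣? value u d
    ... | no _   = inj₁ refl
    ... | yes q∣ = inj₂ (d ÷ q , ∈-upTo⁺ (s≤s (÷-monoˡ-≤ q (proj₂ (∈-range⁻ d∈)))) , (q∣ , refl) , ≤-refl)
    injective : ∀ {d d′ k} → R d k → R d′ k → d ≡ d′
    injective {k = k} = ≡-by-order {P = λ d → R d k} λ { d e (q∣ , quot) (q∣′ , quot′) →
      let coprime : Coprime q (4 * (u * u))
          coprime = λ { {i} (i∣q , i∣4u²) → ∣∣⇒∣1 {u = u} {d = d} q∣ i∣q (subst (i ∣_) (*-assoc 4 (u * u) d) (∣m⇒∣m*n d i∣4u²)) }
          q∣e : q ∣ e
          q∣e = coprime-divisor coprime (∣m+n∣m⇒∣n (subst (q ∣_) (expand u d e) q∣′) q∣)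
      in same-quotient 0<q q∣e (trans quot (sym quot′)) }
      where
      expand : ∀ u d e → 4 * (u * u * (d + e)) + 1 ≡ 4 * (u * u * d) + 1 + 4 * (u * u) * e
      expand = solve-∀

  -- r is a fixed solution beyond X.  If q ∣ 4u²d + 1 then q ∣ (r - u)(r + u), and gcd q (r + u)
  -- determines u modulo q.
  module CountU (d q X r : ℕ) (0<q : 0 < q) (X≤r : X ≤ r) (q∣r : q ∣ value r d) where

    -- The two values differ by 4d · a(r + u) with a = r - u, and `q` is coprime to 4d.
    difference : ∀ {u a} → r ≡ u + a → q ∣ value u d → q ∣ a * (r + u)
    difference {u} {a} refl q∣u = coprime-divisor coprime
      (∣m+n∣m⇒∣n (subst (q ∣_) (expand u a d) q∣r) q∣u)
      where
      coprime : Coprime q (4 * d)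
      coprime {i} (i∣q , i∣4d) = ∣∣⇒∣1 {u = u} {d = d} q∣u i∣q (subst (i ∣_) (regroup u d) (∣n⇒∣m*n (u * u) i∣4d))
        where
        regroup : ∀ u d → u * u * (4 * d) ≡ 4 * (u * u * d)
        regroup = solve-∀
      expand : ∀ u a d → 4 * ((u + a) * (u + a) * d) + 1 ≡ 4 * (u * u * d) + 1 + 4 * d * (a * (u + a + u))
      expand = solve-∀

    -- Write q = gh with g the common gcd. The cofactor h divides both r - u and r - (u + e), hence
    -- e, and g divides both r + u and r + u + e, hence e. A common divisor of g and h divides r + u
    -- and r - u, so 2u and then 4u²d, and is 1. Thus gh divides e.
    determined : ∀ {g} u e → u + e ≤ r → q ∣ value u d → q ∣ value (u + e) d →
                 gcd q (r + u) ≡ g → gcd q (r + (u + e)) ≡ g → q ∣ e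
    determined {g} u e u+e≤r q∣u q∣u+e g≡ g≡′
      with coprime-quotients q (r + u) 0<q | coprime-quotients q (r + (u + e)) 0<q
    ... | g₁ , h , w , 0<g , q≡ , r+u≡ , cop , g₁≡ | g₂ , h′ , w′ , _ , q≡′ , r+u+e≡ , cop′ , g₂≡
      with refl ← trans g₁≡ g≡ | refl ← trans g₂≡ g≡′
      with refl ← *-cancelˡ-≡ h h′ g {{>-nonZero 0<g}} (trans (sym q≡) q≡′) = q∣e
      where
      a′ = r ∸ (u + e)
      r≡′ : r ≡ (u + e) + a′
      r≡′ = sym (m+[n∸m]≡n u+e≤r)
      r≡ : r ≡ u + (e + a′)
      r≡ = trans r≡′ (+-assoc u e a′)
      h∣ : ∀ {v b w} → r ≡ v + b → q ∣ value v d → r + v ≡ g * w → Coprime h w → h ∣ b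
      h∣ {v} {b} {w} r≡v+b q∣v r+v≡ c = coprime-divisor c (*-cancelˡ-∣ g {{>-nonZero 0<g}}
        (subst₂ _∣_ q≡ (trans (cong (b *_) r+v≡) (regroup b g w)) (difference {v} {b} r≡v+b q∣v)))
        where
        regroup : ∀ b g w → b * (g * w) ≡ g * (w * b)
        regroup = solve-∀
      h∣e : h ∣ e
      h∣e = ∣m+n∣m⇒∣n (subst (h ∣_) (+-comm e a′) (h∣ r≡ q∣u r+u≡ cop)) (h∣ r≡′ q∣u+e r+u+e≡ cop′)
      g∣e : g ∣ e
      g∣e = ∣m+n∣m⇒∣n (subst (g ∣_) (sym (+-assoc r u e)) (subst (g ∣_) (sym r+u+e≡) (m∣m*n w′)))
        (subst (g ∣_) (sym r+u≡) (m∣m*n w))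
      coprime : Coprime h g
      coprime {i} (i∣h , i∣g) = ∣∣⇒∣1 {u = u} {d = d} q∣u i∣q
        (subst (i ∣_) (regroup u d) (∣m⇒∣m*n (2 * u * d) i∣2u))
        where
        regroup : ∀ u d → 2 * u * (2 * u * d) ≡ 4 * (u * u * d)
        regroup = solve-∀
        double : ∀ u a → u + a + u ≡ a + 2 * u
        double = solve-∀
        i∣q : i ∣ q
        i∣q = subst (i ∣_) (sym q≡) (∣m⇒∣m*n h i∣g)
        i∣a : i ∣ e + a′
        i∣a = ∣-trans i∣h (h∣ r≡ q∣u r+u≡ cop)
        i∣2u : i ∣ 2 * u
        i∣2u = ∣m+n∣m⇒∣n (subst (i ∣_) (trans (cong (_+ u) r≡) (double u (e + a′)))
          (subst (i ∣_) (sym r+u≡) (∣m⇒∣m*n w i∣g))) i∣a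
      q∣e : q ∣ e
      q∣e with divides k e≡ ← g∣e = subst₂ _∣_ (trans (*-comm h g) (sym q≡)) (sym e≡)
        (*-monoˡ-∣ g (coprime-divisor coprime (subst (h ∣_) (trans e≡ (*-comm k g)) h∣e)))

    pairs : List (ℕ × ℕ)
    pairs = cartesianProduct (divisors q) (upTo (suc (X ÷ q)))

    bound : ∑ (range X) (λ u → 𝟙 (q ∣? value u d)) ≤ length pairs
    bound = ≤-trans
      (∑-inject R (range X) pairs {g = λ _ → 1} (range! X) embed (λ s s′ → injective s s′))
      (≤-reflexive (sym (length≡∑1 pairs)))
      where
      R : ℕ → ℕ × ℕ → Set
      R u gk = (q ∣ value u d × u ≤ r) × gcd q (r + u) ≡ proj₁ gk × u ÷ q ≡ proj₂ gk
      embed : ∀ {u} → u ∈ range X → 𝟙 (q ∣? value u d) ≡ 0 ⊎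
              ∃ λ gk → gk ∈ pairs × R u gk × 𝟙 (q ∣? value u d) ≤ 1
      embed {u} u∈ with q ∣? value u d
      ... | no _   = inj₁ refl
      ... | yes q∣ = let u≤X = proj₂ (∈-range⁻ u∈) in inj₂ ((gcd q (r + u) , u ÷ q) ,
        ∈-cartesianProduct⁺ (∈-divisors⁺ 0<q (gcd[m,n]∣m q (r + u))) (∈-upTo⁺ (s≤s (÷-monoˡ-≤ q u≤X))) ,
        ((q∣ , ≤-trans u≤X X≤r) , refl , refl) , ≤-refl)
      injective : ∀ {u u′ gk} → R u gk → R u′ gk → u ≡ u′
      injective {gk = gk} = ≡-by-order {P = λ u → R u gk}
        λ { u e ((q∣ , _) , g≡ , k≡) ((q∣′ , u+e≤r) , g≡′ , k≡′) →
          same-quotient 0<q (determined u e u+e≤r q∣ q∣′ g≡ g≡′) (trans k≡ (sym k≡′)) }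

  -- A solution is determined by the divisor gcd(q, r + u) of `q` and the block `u ÷ q`. If the
  -- interval contains no solution, there is no reference point `r` and the sum is 0.
  count-u : ∀ d q X → 0 < q → ∑ (range X) (λ u → 𝟙 (q ∣? value u d)) ≤ τ q * suc (X ÷ q)
  count-u d q X 0<q with filter (λ u → q ∣? value u d) (range X) in eq
  ... | [] = ≤-trans (≤-reflexive (trans (∑-cong (range X) (λ u → sym (*-identityʳ _)))
               (trans (sym (∑-filter (λ u → q ∣? value u d) (range X) (λ _ → 1))) (cong (λ xs → ∑ xs (λ _ → 1)) eq)))) z≤n
  ... | r₀ ∷ _ = begin
    ∑ (range X) (λ u → 𝟙 (q ∣? value u d))      ≤⟨ bound ⟩
    length pairs                                ≡⟨ length-cartesianProduct (divisors q) (upTo (suc (X ÷ q))) ⟩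
    length (divisors q) * length (upTo (suc (X ÷ q)))
      ≡⟨ cong₂ _*_ (length≡∑1 (divisors q)) (length-upTo (suc (X ÷ q))) ⟩
    τ q * suc (X ÷ q)                           ∎
    where
    open ≤-Reasoning
    q∣r₀ : q ∣ value r₀ d
    q∣r₀ = proj₂ (∈-filter⁻ (λ u → q ∣? value u d) {xs = range X} (subst (r₀ ∈_) (sym eq) (here refl)))
    shifted : ∀ r q X d → 4 * (r * r * d) + 1 + q * (4 * d * X * (2 * r + q * X)) ≡ 4 * ((r + q * X) * (r + q * X) * d) + 1
    shifted = solve-∀
    -- The found solution is moved by a multiple of `q` beyond `X`, so that every difference r - u
    -- is a natural number.
    q∣r : q ∣ value (r₀ + q * X) d
    q∣r = subst (q ∣_) (shifted r₀ q X d) (∣m∣n⇒∣m+n q∣r₀ (m∣m*n _))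
    open CountU d q X (r₀ + q * X) 0<q (≤-trans (m≤n*m X q {{>-nonZero 0<q}}) (m≤n+m (q * X) r₀)) q∣r

  -- The mean value of τ(4u²d + 1)

  -- If q ≤ 2x occurs for some x ≤ X = N ÷ m, then q ≤ 2X ≤ 2N ÷ m, so 2N ÷ m ÷ q is at least 1 and
  -- absorbs the additional 1 in the count of blocks. This is the origin of 2N. For q > 2X every
  -- term vanishes.
  bounded-count : ∀ {N m q T} {A P : ℕ → Set} (A? : ∀ x → Dec (A x)) (P? : ∀ x → Dec (P x)) → 0 < m → 0 < q →
    (∀ x → A x → x * m ≤ N) → (∀ X → ∑ (range X) (λ x → 𝟙 (P? x)) ≤ T * suc (X ÷ q)) →
    ∑ (range N) (λ x → 𝟙 (A? x) * (𝟙 (q ≤? 2 * x) * 𝟙 (P? x))) ≤ 2 * T * (2 * N ÷ m ÷ q)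
  bounded-count {N} {m} {q} {T} A? P? 0<m 0<q A⇒≤ count with q ≤? 2 * (N ÷ m)
  ... | yes q≤2X = begin
    ∑ (range N) (λ x → 𝟙 (A? x) * (𝟙 (q ≤? 2 * x) * 𝟙 (P? x)))
      ≤⟨ ∑-inject _≡_ (range N) (range X) (range! N) embed (λ p p′ → trans p (sym p′)) ⟩
    ∑ (range X) (λ x → 𝟙 (P? x))    ≤⟨ count X ⟩
    T * suc (X ÷ q)                 ≤⟨ *-monoʳ-≤ T (+-mono-≤ (1≤÷ 0<q (≤-trans q≤2X 2X≤)) (≤-trans (÷-monoˡ-≤ q X≤) (m≤m+n _ 0))) ⟩
    T * (2 * (2 * N ÷ m ÷ q))       ≡⟨ regroup T (2 * N ÷ m ÷ q) ⟩
    2 * T * (2 * N ÷ m ÷ q)         ∎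
    where
    open ≤-Reasoning
    X = N ÷ m
    regroup : ∀ a b → a * (2 * b) ≡ 2 * a * b
    regroup = solve-∀
    2X≤ : 2 * X ≤ 2 * N ÷ m
    2X≤ = ≤-÷ 0<m (≤-trans (≤-reflexive (*-assoc 2 X m)) (*-monoʳ-≤ 2 (÷-*-≤ N m)))
    X≤ : X ≤ 2 * N ÷ m
    X≤ = ≤-trans (m≤n*m X 2) 2X≤
    embed : ∀ {x} → x ∈ range N → 𝟙 (A? x) * (𝟙 (q ≤? 2 * x) * 𝟙 (P? x)) ≡ 0 ⊎
            ∃ λ x′ → x′ ∈ range X × x ≡ x′ × 𝟙 (A? x) * (𝟙 (q ≤? 2 * x) * 𝟙 (P? x)) ≤ 𝟙 (P? x′)
    embed {x} x∈ with 𝟙-dec (A? x)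
    ... | inj₂ (_ , e) = inj₁ (cong (_* (𝟙 (q ≤? 2 * x) * 𝟙 (P? x))) e)
    ... | inj₁ (a , _) = inj₂ (x , ∈-range⁺ (proj₁ (∈-range⁻ x∈)) (≤-÷ 0<m (A⇒≤ x a)) , refl ,
                               𝟙*-≤ (A? x) (λ _ → 𝟙*-≤ (q ≤? 2 * x) (λ _ → ≤-refl)))
  ... | no q≰2X = ≤-trans (∑-mono′ (range N) {g = λ _ → 0} vanish) (≤-trans (≤-reflexive (∑-0 (range N))) z≤n)
    where
    vanish : ∀ x → 𝟙 (A? x) * (𝟙 (q ≤? 2 * x) * 𝟙 (P? x)) ≤ 0
    vanish x = 𝟙*-≤ (A? x) λ a → 𝟙*-≤ (q ≤? 2 * x) λ q≤2x →
      contradiction (≤-trans q≤2x (*-monoʳ-≤ 2 (≤-÷ {x} 0<m (A⇒≤ x a)))) q≰2X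

  -- If `q` exceeded both 2u and 2d, its cube would be at least (2u + 1)²(2d + 1), which is larger
  -- than 4u²d + 1.
  small⇒≤ : ∀ u d q → 0 < d → cube q ≤ value u d → q ≤ 2 * d ⊎ q ≤ 2 * u
  small⇒≤ u (suc d) q _ q³≤ with q ≤? 2 * suc d | q ≤? 2 * u
  ... | yes q≤ | _      = inj₁ q≤
  ... | no _   | yes q≤ = inj₂ q≤
  ... | no q≰d | no q≰u = contradiction q³≤ (<⇒≱ (begin
    suc (value u (suc d))                                        ≤⟨ m≤m+n _ _ ⟩
    suc (value u (suc d)) + (4 * u * u * (1 + d) + 8 * u * (1 + d) + 4 * u * u + 4 * u + 2 * d + 1)
                                                                 ≡⟨ expand u d ⟩
    suc (2 * u) * suc (2 * u) * suc (2 * suc d)                  ≤⟨ *-mono-≤ (*-mono-≤ (≰⇒> q≰u) (≰⇒> q≰u)) (≰⇒> q≰d) ⟩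
    cube q                                                       ∎))
    where
    open ≤-Reasoning
    expand : ∀ u d → 1 + (4 * (u * u * (1 + d)) + 1) + (4 * u * u * (1 + d) + 8 * u * (1 + d) + 4 * u * u + 4 * u + 2 * d + 1)
             ≡ (1 + 2 * u) * (1 + 2 * u) * (1 + 2 * (1 + d))
    expand = solve-∀

  triples : ℕ → List (ℕ × ℕ × ℕ)
  triples N = cartesianProduct (range N) (cartesianProduct (range N) (range N))

  ∑-triples : ∀ N (f : ℕ → ℕ → ℕ → ℕ) → ∑ (triples N) (λ (u , d , k) → f u d k) ≡
              ∑ (range N) λ u → ∑ (range N) λ d → ∑ (range N) λ k → f u d k
  ∑-triples N f = trans (∑-cartesianProduct (range N) _ _)
    (∑-cong (range N) λ u → ∑-cartesianProduct (range N) (range N) _)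

  quads : ℕ → List (ℕ × ℕ × ℕ × ℕ)
  quads B = cartesianProduct (range B) (triples B)

  ∑⁴≡ : ∀ B (f : ℕ → ℕ → ℕ → ℕ → ℕ) → ∑⁴ B f ≡ ∑ (quads B) λ (a , b , c , t) → f a b c t
  ∑⁴≡ B f = sym (trans (∑-cartesianProduct (range B) _ _) (∑-cong (range B) λ a → ∑-triples B (f a)))

  inside : ℕ → ℕ × ℕ × ℕ → ℕ
  inside N (u , d , k) = 𝟙 (u * d * k ≤? N)

  -- What is left after counting `d` for fixed `u`, `k`, or `u` for fixed `d`, `k`; both cases have
  -- the same form in the two remaining variables.
  ∑∑÷ : ℕ → ℕ → ℕ
  ∑∑÷ N q = ∑ (range N) λ i → ∑ (range N) λ k → 2 * N ÷ (i * k) ÷ q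

  -- The condition on the cube is replaced by q ≤ 2d or q ≤ 2u. The order of summation is then
  -- changed so that the variable that is long compared with `q` is innermost.
  count-triples : ∀ N q → 0 < q →
    ∑ (triples N) (λ (u , d , k) → inside N (u , d , k) * (𝟙 (q ∣? value u d) * 𝟙 (small? (value u d) q)))
    ≤ 4 * τ q * ∑∑÷ N q
  count-triples N q 0<q = begin
    ∑ (triples N) (λ (u , d , k) → inside N (u , d , k) * (𝟙 (q ∣? value u d) * 𝟙 (small? (value u d) q)))
      ≤⟨ ∑-mono (triples N) (λ {x} x∈ → pointwise x x∈) ⟩
    ∑ (triples N) (λ (u , d , k) → byD u d k + byU u d k)
      ≡⟨ ∑-+ (triples N) (λ (u , d , k) → byD u d k) (λ (u , d , k) → byU u d k) ⟩
    ∑ (triples N) (λ (u , d , k) → byD u d k) + ∑ (triples N) (λ (u , d , k) → byU u d k)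
      ≡⟨ cong₂ _+_ (∑-triples N byD) (∑-triples N byU) ⟩
    (∑ r λ u → ∑ r λ d → ∑ r λ k → byD u d k) + (∑ r λ u → ∑ r λ d → ∑ r λ k → byU u d k)
      ≡⟨ cong₂ _+_ (∑-cong r (λ u → ∑-swap r r (byD u)))
           (trans (∑-swap r r _) (∑-cong r (λ d → ∑-swap r r (λ u → byU u d)))) ⟩
    (∑ r λ u → ∑ r λ k → ∑ r λ d → byD u d k) + (∑ r λ d → ∑ r λ k → ∑ r λ u → byU u d k)
      ≤⟨ +-mono-≤
           (∑-mono r λ {u} u∈ → ∑-mono r λ {k} k∈ → bounded-count {T = τ q} (λ d → u * d * k ≤? N) (λ d → q ∣? value u d)
             (*-pos (proj₁ (∈-range⁻ u∈)) (proj₁ (∈-range⁻ k∈))) 0<q (λ d → ≤-trans (≤-reflexive (reorder₁ u d k)))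
             (λ X → ≤-trans (count-d u q X 0<q) (m≤n*m (suc (X ÷ q)) (τ q) {{>-nonZero (τ-pos 0<q)}})))
           (∑-mono r λ {d} d∈ → ∑-mono r λ {k} k∈ → bounded-count {T = τ q} (λ u → u * d * k ≤? N) (λ u → q ∣? value u d)
             (*-pos (proj₁ (∈-range⁻ d∈)) (proj₁ (∈-range⁻ k∈))) 0<q (λ u → ≤-trans (≤-reflexive (sym (*-assoc u d k))))
             (λ X → count-u d q X 0<q)) ⟩
    S + S
      ≡⟨ cong₂ _+_ S≡ S≡ ⟩
    2 * τ q * ∑∑÷ N q + 2 * τ q * ∑∑÷ N q
      ≡⟨ double (τ q) (∑∑÷ N q) ⟩
    4 * τ q * ∑∑÷ N q  ∎
    where
    open ≤-Reasoning
    r = range N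
    byD byU : ℕ → ℕ → ℕ → ℕ
    byD u d k = 𝟙 (u * d * k ≤? N) * (𝟙 (q ≤? 2 * d) * 𝟙 (q ∣? value u d))
    byU u d k = 𝟙 (u * d * k ≤? N) * (𝟙 (q ≤? 2 * u) * 𝟙 (q ∣? value u d))
    S = ∑ r λ i → ∑ r λ k → 2 * τ q * (2 * N ÷ (i * k) ÷ q)
    S≡ : S ≡ 2 * τ q * ∑∑÷ N q
    S≡ = trans (∑-cong r (λ i → ∑-*ˡ (2 * τ q) r _)) (∑-*ˡ (2 * τ q) r _)
    reorder₁ : ∀ u d k → d * (u * k) ≡ u * d * k
    reorder₁ = solve-∀
    double : ∀ a b → 2 * a * b + 2 * a * b ≡ 4 * a * b
    double = solve-∀
    pointwise : ∀ ((u , d , k) : ℕ × ℕ × ℕ) → (u , d , k) ∈ triples N →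
      inside N (u , d , k) * (𝟙 (q ∣? value u d) * 𝟙 (small? (value u d) q)) ≤ byD u d k + byU u d k
    pointwise (u , d , k) x∈ = ≤-trans (*-monoʳ-≤ (𝟙 (u * d * k ≤? N)) (begin
        𝟙 (q ∣? value u d) * 𝟙 (small? (value u d) q)
          ≡⟨ *-comm (𝟙 (q ∣? value u d)) (𝟙 (small? (value u d) q)) ⟩
        𝟙 (small? (value u d) q) * I
          ≤⟨ 𝟙*-≤ (small? (value u d) q) (λ sm → choose (small⇒≤ u d q 0<d sm)) ⟩
        𝟙 (q ≤? 2 * d) * I + 𝟙 (q ≤? 2 * u) * I  ∎))
      (≤-reflexive (*-distribˡ-+ (𝟙 (u * d * k ≤? N)) _ _))
      where
      I = 𝟙 (q ∣? value u d)
      0<d : 0 < d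
      0<d = proj₁ (∈-range⁻ (proj₁ (∈-cartesianProduct⁻ r r (proj₂ (∈-cartesianProduct⁻ r (cartesianProduct r r) x∈)))))
      choose : q ≤ 2 * d ⊎ q ≤ 2 * u → I ≤ 𝟙 (q ≤? 2 * d) * I + 𝟙 (q ≤? 2 * u) * I
      choose (inj₁ h) = ≤-trans (≤-reflexive (sym (trans (cong (_* I) (𝟙-yes (q ≤? 2 * d) h)) (*-identityˡ I)))) (m≤m+n _ _)
      choose (inj₂ h) = ≤-trans (≤-reflexive (sym (trans (cong (_* I) (𝟙-yes (q ≤? 2 * u) h)) (*-identityˡ I)))) (m≤n+m _ (𝟙 (q ≤? 2 * d) * I))

  full-weight : ℕ → ℕ → ℕ → ℕ → ℕ → ℕ
  full-weight z a b c t = τ₃ a * (τ b ^ 6 * (τ c ^ 16 * (τ t ^ 10 * (z ÷ modulus a b c t))))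

  -- Factors of τ(q) join those of the weight: `b` gets 4 + 2, `c` gets 12 + 4, `t` gets 8 + 2, and
  -- the factor τ(a) turns g(a) into Rτ₃(a). The last identity is the reason for the choice of
  -- `IsRatio`.
  weight*τ : ∀ {R B g} → IsRatio R B g → ∀ {a b c t} z → 0 < a → a ≤ B → 0 < b → 0 < c → 0 < t →
    weight g a b c t * τ (modulus a b c t) * (z ÷ modulus a b c t) ≤ R * full-weight z a b c t
  weight*τ {R} {B} {g} ratio {a} {b} {c} {t} z 0<a a≤B 0<b 0<c 0<t = begin
    weight g a b c t * τ (modulus a b c t) * y
      ≤⟨ *-monoˡ-≤ y (*-monoʳ-≤ (weight g a b c t) τq≤) ⟩
    weight g a b c t * (τ a * (τ b ^ 2 * (τ c ^ 4 * τ t ^ 2))) * y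
      ≡⟨ regroup (g a) (τ b ^ 4) (τ c ^ 12) (τ t ^ 8) (τ a) (τ b ^ 2) (τ c ^ 4) (τ t ^ 2) y ⟩
    g a * τ a * (τ b ^ 4 * τ b ^ 2 * (τ c ^ 12 * τ c ^ 4 * (τ t ^ 8 * τ t ^ 2 * y)))
      ≡⟨ cong₂ (λ p q → p * (q * (τ c ^ 12 * τ c ^ 4 * (τ t ^ 8 * τ t ^ 2 * y)))) (ratio 0<a a≤B) (sym (^-distribˡ-+-* (τ b) 4 2)) ⟩
    R * τ₃ a * (τ b ^ 6 * (τ c ^ 12 * τ c ^ 4 * (τ t ^ 8 * τ t ^ 2 * y)))
      ≡⟨ cong₂ (λ p q → R * τ₃ a * (τ b ^ 6 * (p * (q * y)))) (sym (^-distribˡ-+-* (τ c) 12 4)) (sym (^-distribˡ-+-* (τ t) 8 2)) ⟩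
    R * τ₃ a * (τ b ^ 6 * (τ c ^ 16 * (τ t ^ 10 * y)))
      ≡⟨ *-assoc R (τ₃ a) _ ⟩
    R * full-weight z a b c t  ∎
    where
    open ≤-Reasoning
    y = z ÷ modulus a b c t
    regroup : ∀ g b c t a b′ c′ t′ y → g * (b * (c * t)) * (a * (b′ * (c′ * t′))) * y
              ≡ g * a * (b * b′ * (c * c′ * (t * t′ * y)))
    regroup = solve-∀
    0<b² = ^-pos 2 0<b
    0<c⁴ = ^-pos 4 0<c
    0<t² = ^-pos 2 0<t
    τq≤ : τ (modulus a b c t) ≤ τ a * (τ b ^ 2 * (τ c ^ 4 * τ t ^ 2))
    τq≤ = ≤-trans (τ-* a _ 0<a (*-pos 0<b² (*-pos 0<c⁴ 0<t²))) (*-monoʳ-≤ (τ a)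
      (≤-trans (τ-* (b ^ 2) _ 0<b² (*-pos 0<c⁴ 0<t²)) (*-mono-≤ (τ-^ 2 b 0<b)
      (≤-trans (τ-* (c ^ 4) _ 0<c⁴ 0<t²) (*-mono-≤ (τ-^ 4 c 0<c) (τ-^ 2 t 0<t))))))

  ∑³-factor : ∀ (xs : List ℕ) k (β γ δ : ℕ → ℕ) (y : ℕ → ℕ → ℕ → ℕ) →
    (∑ xs λ b → ∑ xs λ c → ∑ xs λ t → k * (β b * (γ c * (δ t * y b c t)))) ≡
    k * ∑ xs λ b → β b * ∑ xs λ c → γ c * ∑ xs λ t → δ t * y b c t
  ∑³-factor xs k β γ δ y = trans (∑-cong xs λ b → trans (∑-cong xs λ c → trans (∑-*ˡ k xs _)
      (cong (k *_) (trans (∑-*ˡ (β b) xs _) (cong (β b *_) (∑-*ˡ (γ c) xs _)))))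
      (trans (∑-*ˡ k xs _) (cong (k *_) (∑-*ˡ (β b) xs _))))
    (∑-*ˡ k xs _)

  ∑-iterate : ∀ (xs : List ℕ) (β γ δ h₁ h₂ h₃ : ℕ → ℕ) C₁ C₂ C₃ →
    (∀ y → ∑ xs (λ b → β b * (y ÷ h₁ b)) ≤ C₁ * y) →
    (∀ y → ∑ xs (λ c → γ c * (y ÷ h₂ c)) ≤ C₂ * y) →
    (∀ y → ∑ xs (λ t → δ t * (y ÷ h₃ t)) ≤ C₃ * y) → ∀ z →
    (∑ xs λ b → β b * ∑ xs λ c → γ c * ∑ xs λ t → δ t * (z ÷ h₁ b ÷ h₂ c ÷ h₃ t)) ≤ C₃ * (C₂ * (C₁ * z))
  ∑-iterate xs β γ δ h₁ h₂ h₃ C₁ C₂ C₃ b₁ b₂ b₃ z = begin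
    (∑ xs λ b → β b * ∑ xs λ c → γ c * ∑ xs λ t → δ t * (z ÷ h₁ b ÷ h₂ c ÷ h₃ t))
      ≤⟨ ∑-mono′ xs (λ b → *-monoʳ-≤ (β b) (begin
           (∑ xs λ c → γ c * ∑ xs λ t → δ t * (z ÷ h₁ b ÷ h₂ c ÷ h₃ t))
             ≤⟨ ∑-mono′ xs (λ c → *-monoʳ-≤ (γ c) (b₃ (z ÷ h₁ b ÷ h₂ c))) ⟩
           (∑ xs λ c → γ c * (C₃ * (z ÷ h₁ b ÷ h₂ c)))
             ≡⟨ trans (∑-cong xs (λ c → swap (γ c) C₃ _)) (∑-*ˡ C₃ xs _) ⟩
           C₃ * (∑ xs λ c → γ c * (z ÷ h₁ b ÷ h₂ c))
             ≤⟨ *-monoʳ-≤ C₃ (b₂ (z ÷ h₁ b)) ⟩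
           C₃ * (C₂ * (z ÷ h₁ b)) ∎)) ⟩
    (∑ xs λ b → β b * (C₃ * (C₂ * (z ÷ h₁ b))))
      ≡⟨ trans (∑-cong xs (λ b → swap₂ (β b) C₃ C₂ _)) (∑-*ˡ (C₃ * C₂) xs _) ⟩
    C₃ * C₂ * (∑ xs λ b → β b * (z ÷ h₁ b))
      ≤⟨ *-monoʳ-≤ (C₃ * C₂) (b₁ z) ⟩
    C₃ * C₂ * (C₁ * z)
      ≡⟨ *-assoc C₃ C₂ (C₁ * z) ⟩
    C₃ * (C₂ * (C₁ * z))  ∎
    where
    open ≤-Reasoning
    swap : ∀ a b c → a * (b * c) ≡ b * (a * c)
    swap = solve-∀
    swap₂ : ∀ a b c d → a * (b * (c * d)) ≡ b * c * (a * d)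
    swap₂ = solve-∀

  ÷-modulus : ∀ z a b c t → z ÷ modulus a b c t ≡ z ÷ a ÷ b ^ 2 ÷ c ^ 4 ÷ t ^ 2
  ÷-modulus z a b c t = trans (÷-÷ z a _) (trans (÷-÷ (z ÷ a) (b ^ 2) _) (÷-÷ (z ÷ a ÷ b ^ 2) (c ^ 4) _))

  -- The exponents 2, 4, 2 of `b`, `c`, `t` in the modulus outweigh any fixed power of τ, so these
  -- three sums cost a constant and `a` alone produces logarithms.
  ∑-full-weight-a : ∃[ C ] (∀ B z a →
    (∑ (range B) λ b → ∑ (range B) λ c → ∑ (range B) λ t → full-weight z a b c t) ≤ C * (τ₃ a * (z ÷ a)))
  ∑-full-weight-a = let C₀ , b₀ = ∑τ^÷² 6 ; C₁ , b₁ = ∑τ^÷⁴ 16 ; C₂ , b₂ = ∑τ^÷² 10 in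
    C₂ * (C₁ * C₀) , λ B z a → begin
      (∑ (range B) λ b → ∑ (range B) λ c → ∑ (range B) λ t → full-weight z a b c t)
        ≡⟨ ∑-cong (range B) (λ b → ∑-cong (range B) (λ c → ∑-cong (range B) (λ t →
             cong (λ y → τ₃ a * (τ b ^ 6 * (τ c ^ 16 * (τ t ^ 10 * y)))) (÷-modulus z a b c t)))) ⟩
      _ ≡⟨ ∑³-factor (range B) (τ₃ a) (λ b → τ b ^ 6) (λ c → τ c ^ 16) (λ t → τ t ^ 10) (λ b c t → z ÷ a ÷ b ^ 2 ÷ c ^ 4 ÷ t ^ 2) ⟩
      _ ≤⟨ *-monoʳ-≤ (τ₃ a) (∑-iterate (range B) (λ b → τ b ^ 6) (λ c → τ c ^ 16) (λ t → τ t ^ 10) (_^ 2) (_^ 4) (_^ 2)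
             C₀ C₁ C₂ (b₀ B) (b₁ B) (b₂ B) (z ÷ a)) ⟩
      τ₃ a * (C₂ * (C₁ * (C₀ * (z ÷ a))))
        ≡⟨ regroup (τ₃ a) C₂ C₁ C₀ (z ÷ a) ⟩
      C₂ * (C₁ * C₀) * (τ₃ a * (z ÷ a))  ∎
    where
    open ≤-Reasoning
    regroup : ∀ s a b c y → s * (a * (b * (c * y))) ≡ a * (b * c) * (s * y)
    regroup = solve-∀

  ∑-full-weight : ∃[ C ] (∀ B z → ∑⁴ B (full-weight z) ≤ C * ∑÷ B 3 z)
  ∑-full-weight = let C , inner = ∑-full-weight-a in C , λ B z → begin
    ∑⁴ B (full-weight z)                                   ≤⟨ ∑-mono′ (range B) (λ a → inner B z a) ⟩
    ∑ (range B) (λ a → C * (τ₃ a * (z ÷ a)))               ≡⟨ ∑-*ˡ C (range B) _ ⟩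
    C * ∑ (range B) (λ a → τ₃ a * (z ÷ a))                 ≤⟨ *-monoʳ-≤ C (∑τ₃÷ B z) ⟩
    C * ∑÷ B 3 z                                           ∎
    where open ≤-Reasoning

  ∣! : ∀ {m n} → 0 < m → m ≤ n → m ∣ n !
  ∣! {suc m} _ m≤n = ∣-trans (m∣m*n (m !)) (m≤n⇒m!∣n! m≤n)

  -- For 0 < a ≤ B one has τ(a) ≤ a ≤ B, so τ(a) divides `B !` and the quotient is exact.
  ratio : ℕ → ℕ → ℕ
  ratio B a = τ₃ a * (B ! ÷ τ a)

  isRatio : ∀ B → IsRatio (B !) B (ratio B)
  isRatio B {a} 0<a a≤B = begin
    τ₃ a * (B ! ÷ τ a) * τ a     ≡⟨ *-assoc (τ₃ a) _ _ ⟩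
    τ₃ a * (B ! ÷ τ a * τ a)     ≡⟨ cong (τ₃ a *_) (÷-*-∣ (τ-pos 0<a) (∣! (τ-pos 0<a) (≤-trans (τ-≤ a) a≤B))) ⟩
    τ₃ a * B !                   ≡⟨ *-comm (τ₃ a) (B !) ⟩
    B ! * τ₃ a                   ∎
    where
    open ≡-Reasoning
    ÷-*-∣ : ∀ {z q} → 0 < q → q ∣ z → z ÷ q * q ≡ z
    ÷-*-∣ {z} {suc q} _ q∣z = m/n*n≡m q∣z

  module MeanValue (N : ℕ) where
    L K C : ℕ
    L = proj₁ landreau
    K = 4 * L
    C = proj₁ ∑-full-weight
    open ≤-Reasoning
    B R : ℕ
    -- The largest of the values considered. It bounds all their divisors, hence all components of
    -- the moduli.
    B = value N N
    R = B !
    g = ratio B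
    Z : ℕ → ℕ → ℕ
    Z i k = 2 * N ÷ (i * k)
    r = range N

    value≤B : ∀ {u d} → u ≤ N → d ≤ N → value u d ≤ B
    value≤B u≤N d≤N = +-monoˡ-≤ 1 (*-monoʳ-≤ 4 (*-mono-≤ (*-mono-≤ u≤N u≤N) d≤N))
    N≤B : N ≤ B
    N≤B = go N
      where
      go : ∀ N → N ≤ value N N
      go zero    = z≤n
      go (suc n) = ≤-trans (m≤n*m (suc n) (4 * (suc n * suc n))) (≤-trans (≤-reflexive (*-assoc 4 (suc n * suc n) (suc n))) (m≤m+n _ 1))

    W : ℕ × ℕ × ℕ × ℕ → ℕ
    W (a , b , c , t) = weight g a b c t
    Q : ℕ × ℕ × ℕ × ℕ → ℕ
    Q (a , b , c , t) = modulus a b c t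
    E : ℕ → ℕ × ℕ × ℕ → ℕ
    E q (u , d , k) = inside N (u , d , k) * (𝟙 (q ∣? value u d) * 𝟙 (small? (value u d) q))

    per-triple : ∀ {x} → x ∈ triples N → R * (inside N x * τ (value (proj₁ x) (proj₁ (proj₂ x)))) ≤
               ∑ (quads B) λ y → L * W y * E (Q y) x
    per-triple {u , d , k} x∈ = begin
      R * (I * τ v)                                   ≡⟨ swap R I (τ v) ⟩
      I * (R * τ v)                                   ≤⟨ *-monoʳ-≤ I (proj₂ landreau {R} {B} {g} (isRatio B) (m≤n+m 1 _) (value≤B u≤N d≤N)) ⟩
      I * (L * ∑⁴ B (λ a b c t → 𝟙 (modulus a b c t ∣? v) * (𝟙 (small? v (modulus a b c t)) * weight g a b c t)))
        ≡⟨ cong (λ s → I * (L * s)) (∑⁴≡ B _) ⟩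
      I * (L * ∑ (quads B) (λ y → 𝟙 (Q y ∣? v) * (𝟙 (small? v (Q y)) * W y)))
        ≡⟨ *-assoc I L _ ⟨
      I * L * ∑ (quads B) (λ y → 𝟙 (Q y ∣? v) * (𝟙 (small? v (Q y)) * W y))
        ≡⟨ ∑-*ˡ (I * L) (quads B) _ ⟨
      ∑ (quads B) (λ y → I * L * (𝟙 (Q y ∣? v) * (𝟙 (small? v (Q y)) * W y)))
        ≡⟨ ∑-cong (quads B) (λ y → regroup I L (𝟙 (Q y ∣? v)) (𝟙 (small? v (Q y))) (W y)) ⟩
      ∑ (quads B) (λ y → L * W y * E (Q y) (u , d , k))  ∎
      where
      v = value u d
      I = inside N (u , d , k)
      u≤N = proj₂ (∈-range⁻ (proj₁ (∈-cartesianProduct⁻ r (cartesianProduct r r) x∈)))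
      d≤N = proj₂ (∈-range⁻ (proj₁ (∈-cartesianProduct⁻ r r (proj₂ (∈-cartesianProduct⁻ r (cartesianProduct r r) x∈)))))
      swap : ∀ a b c → a * (b * c) ≡ b * (a * c)
      swap = solve-∀
      regroup : ∀ i k x y w → i * k * (x * (y * w)) ≡ k * w * (i * (x * y))
      regroup = solve-∀

    quad-bound : ∀ {y} → y ∈ quads B → L * W y * ∑ (triples N) (E (Q y)) ≤
                 ∑ r λ i → ∑ r λ k → K * (R * full-weight (Z i k) (proj₁ y) (proj₁ (proj₂ y)) (proj₁ (proj₂ (proj₂ y))) (proj₂ (proj₂ (proj₂ y))))
    quad-bound {a , b , c , t} y∈ = begin
      L * w * ∑ (triples N) (E q)
        ≤⟨ *-monoʳ-≤ (L * w) (count-triples N q 0<q) ⟩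
      L * w * (4 * τ q * ∑∑÷ N q)
        ≡⟨ regroup L w (τ q) (∑∑÷ N q) ⟩
      K * (w * τ q) * ∑∑÷ N q
        ≡⟨ trans (∑-cong r (λ i → ∑-*ˡ (K * (w * τ q)) r _)) (∑-*ˡ (K * (w * τ q)) r _) ⟨
      (∑ r λ i → ∑ r λ k → K * (w * τ q) * (Z i k ÷ q))
        ≤⟨ ∑-mono′ r (λ i → ∑-mono′ r (λ k → ≤-trans (≤-reflexive (*-assoc K (w * τ q) (Z i k ÷ q)))
             (*-monoʳ-≤ K (weight*τ {R} {B} {g} (isRatio B) (Z i k) 0<a a≤B 0<b 0<c 0<t)))) ⟩
      (∑ r λ i → ∑ r λ k → K * (R * full-weight (Z i k) a b c t))  ∎
      where
      w = weight g a b c t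
      q = modulus a b c t
      rB = range B
      a∈ = ∈-cartesianProduct⁻ rB (triples B) y∈
      b∈ = ∈-cartesianProduct⁻ rB (cartesianProduct rB rB) (proj₂ a∈)
      c∈ = ∈-cartesianProduct⁻ rB rB (proj₂ b∈)
      0<a = proj₁ (∈-range⁻ (proj₁ a∈))
      a≤B = proj₂ (∈-range⁻ (proj₁ a∈))
      0<b = proj₁ (∈-range⁻ (proj₁ b∈))
      0<c = proj₁ (∈-range⁻ (proj₁ c∈))
      0<t = proj₁ (∈-range⁻ (proj₂ c∈))
      0<q : 0 < q
      0<q = *-pos 0<a (*-pos (^-pos 2 0<b) (*-pos (^-pos 4 0<c) (^-pos 2 0<t)))
      regroup : ∀ L w x y → L * w * (4 * x * y) ≡ 4 * L * (w * x) * y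
      regroup = solve-∀

    range-shrink : ∀ f → ∑ r f ≤ ∑ (range B) f
    range-shrink f = ∑-⊆ r (range B) f (range! N) (λ i∈ → let 0<i , i≤N = ∈-range⁻ i∈ in inj₂ (∈-range⁺ 0<i (≤-trans i≤N N≤B)))

    -- After the sums over triples and moduli are exchanged, the two free variables `i`, `k`
    -- contribute two of the five nested quotient sums and τ₃(a) the other three. The ranges of `i`
    -- and `k` are extended to `range B` to match.
    main : R * ∑ (triples N) (λ (u , d , k) → inside N (u , d , k) * τ (value u d)) ≤ R * (K * C * ∑÷ B 5 (2 * N))
    main = begin
      R * ∑ (triples N) (λ (u , d , k) → inside N (u , d , k) * τ (value u d))
        ≡⟨ ∑-*ˡ R (triples N) _ ⟨
      ∑ (triples N) (λ (u , d , k) → R * (inside N (u , d , k) * τ (value u d)))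
        ≤⟨ ∑-mono (triples N) per-triple ⟩
      ∑ (triples N) (λ x → ∑ (quads B) λ y → L * W y * E (Q y) x)
        ≡⟨ ∑-swap (triples N) (quads B) _ ⟩
      ∑ (quads B) (λ y → ∑ (triples N) λ x → L * W y * E (Q y) x)
        ≡⟨ ∑-cong (quads B) (λ y → ∑-*ˡ (L * W y) (triples N) (E (Q y))) ⟩
      ∑ (quads B) (λ y → L * W y * ∑ (triples N) (E (Q y)))
        ≤⟨ ∑-mono (quads B) quad-bound ⟩
      ∑ (quads B) (λ (a , b , c , t) → ∑ r λ i → ∑ r λ k → K * (R * full-weight (Z i k) a b c t))
        ≡⟨ trans (∑-swap (quads B) r _) (∑-cong r (λ i → ∑-swap (quads B) r _)) ⟩
      (∑ r λ i → ∑ r λ k → ∑ (quads B) λ (a , b , c , t) → K * (R * full-weight (Z i k) a b c t))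
        ≤⟨ ∑-mono′ r (λ i → ∑-mono′ r (λ k → per-ik i k)) ⟩
      (∑ r λ i → ∑ r λ k → R * (K * C) * ∑÷ B 3 (2 * N ÷ i ÷ k))
        ≡⟨ trans (∑-cong r (λ i → ∑-*ˡ (R * (K * C)) r _)) (∑-*ˡ (R * (K * C)) r _) ⟩
      R * (K * C) * (∑ r λ i → ∑ r λ k → ∑÷ B 3 (2 * N ÷ i ÷ k))
        ≤⟨ *-monoʳ-≤ (R * (K * C)) (≤-trans (∑-mono′ r (λ i → range-shrink _)) (range-shrink _)) ⟩
      R * (K * C) * ∑÷ B 5 (2 * N)
        ≡⟨ *-assoc R (K * C) _ ⟩
      R * (K * C * ∑÷ B 5 (2 * N))  ∎
      where
      per-ik : ∀ i k → ∑ (quads B) (λ (a , b , c , t) → K * (R * full-weight (Z i k) a b c t))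
               ≤ R * (K * C) * ∑÷ B 3 (2 * N ÷ i ÷ k)
      per-ik i k = begin
        ∑ (quads B) (λ (a , b , c , t) → K * (R * full-weight (Z i k) a b c t))
          ≡⟨ trans (∑-*ˡ K (quads B) _) (cong (K *_) (trans (∑-*ˡ R (quads B) _) (cong (R *_) (sym (∑⁴≡ B _))))) ⟩
        K * (R * ∑⁴ B (full-weight (Z i k)))
          ≤⟨ *-monoʳ-≤ K (*-monoʳ-≤ R (proj₂ ∑-full-weight B (Z i k))) ⟩
        K * (R * (C * ∑÷ B 3 (Z i k)))
          ≡⟨ regroup K R C (∑÷ B 3 (Z i k)) ⟩
        R * (K * C) * ∑÷ B 3 (Z i k)
          ≡⟨ cong (λ z → R * (K * C) * ∑÷ B 3 z) (÷-÷ (2 * N) i k) ⟩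
        R * (K * C) * ∑÷ B 3 (2 * N ÷ i ÷ k)  ∎
        where
        regroup : ∀ k r c x → k * (r * (c * x)) ≡ r * (k * c) * x
        regroup = solve-∀

  ∑τ-value : ∃[ C ] (∀ N → ∑ (triples N) (λ (u , d , k) → inside N (u , d , k) * τ (value u d))
                            ≤ C * ∑÷ (value N N) 5 (2 * N))
  ∑τ-value = 4 * proj₁ landreau * proj₁ ∑-full-weight , λ N →
    *-cancelˡ-≤ (value N N !) {{>-nonZero (n!>0 (value N N))}} (MeanValue.main N)
    where
    n!>0 : ∀ n → 0 < n !
    n!>0 zero    = s≤s z≤n
    n!>0 (suc n) = *-pos {suc n} (s≤s z≤n) (n!>0 n)

  -- Parametrisation of the solutions

  record Parameters (p u v d k e : ℕ) : Set where
    field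
      0<u : 0 < u
      0<v : 0 < v
      0<d : 0 < d
      0<k : 0 < k
      0<e : 0 < e
      ek≡ : e * k ≡ u + v
      pe≡ : p * e + 1 ≡ 4 * (u * v * d)

  swap-parameters : ∀ {p u v d k e} → Parameters p u v d k e → Parameters p v u d k e
  swap-parameters {u = u} {v} {d} P = record
    { 0<u = 0<v ; 0<v = 0<u ; 0<d = 0<d ; 0<k = 0<k ; 0<e = 0<e
    ; ek≡ = trans ek≡ (+-comm u v) ; pe≡ = trans pe≡ (cong (λ x → 4 * (x * d)) (*-comm u v)) }
    where open Parameters P

  -- With a = mp the cleared equation becomes (4m - 1)bc = pm(b + c), so p divides 4m - 1 = pe and
  -- ebc = m(b + c). Put b = gu, c = gv with g the gcd: u and v are coprime to each other and to u +
  -- v, so m = uvd and eg = d(u + v). From pe + 1 = 4uvd, d is coprime to e, so g = dk.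
  parametrise : ∀ {p a b c} → Prime p → 0 < a → 0 < b → 0 < c → Bound.Cleared p a b c →
    p ∣ a → ¬ p ∣ b → ¬ p ∣ c →
    ∃[ u ] ∃[ v ] ∃[ d ] ∃[ k ] ∃[ e ] Parameters p u v d k e ×
      a ≡ p * (u * v * d) × b ≡ d * k * u × c ≡ d * k * v
  parametrise {p} {a} {b} {c} pr 0<a 0<b 0<c cleared (divides m refl) p∤b p∤c = finish (coprime-quotients b c 0<b)
    where
    open ≡-Reasoning
    Goal : Set
    Goal = ∃[ u ] ∃[ v ] ∃[ d ] ∃[ k ] ∃[ e ] Parameters p u v d k e ×
      m * p ≡ p * (u * v * d) × b ≡ d * k * u × c ≡ d * k * v
    instance p≢0 = prime⇒nonZero pr
    0<m : 0 < m
    0<m = pos-*ˡ m p 0<a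
    s : ℕ
    s = pred (4 * m)
    4m≡ : 4 * m ≡ suc s
    4m≡ = sym (suc-pred (4 * m) {{>-nonZero (*-pos {4} (s≤s z≤n) 0<m)}})

    sbc≡ : s * (b * c) ≡ p * (m * (b + c))
    sbc≡ = +-cancelˡ-≡ (b * c) _ _ (*-cancelˡ-≡ _ _ p (begin
      p * (suc s * (b * c))                      ≡⟨ cong (λ x → p * (x * (b * c))) 4m≡ ⟨
      p * (4 * m * (b * c))                      ≡⟨ regroup₁ p m b c ⟩
      4 * (m * p * b * c)                        ≡⟨ cleared ⟩
      p * (b * c + m * p * c + m * p * b)        ≡⟨ cong (p *_) (regroup₂ p m b c) ⟩
      p * (b * c + p * (m * (b + c)))            ∎))
      where
      regroup₁ : ∀ p m b c → p * (4 * m * (b * c)) ≡ 4 * (m * p * b * c)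
      regroup₁ = solve-∀
      regroup₂ : ∀ p m b c → b * c + m * p * c + m * p * b ≡ b * c + p * (m * (b + c))
      regroup₂ = solve-∀

    p∣s : p ∣ s
    p∣s with euclidsLemma s (b * c) pr (subst (p ∣_) (sym sbc≡) (m∣m*n _))
    ... | inj₁ p∣s = p∣s
    ... | inj₂ p∣bc with euclidsLemma b c pr p∣bc
    ...   | inj₁ p∣b = contradiction p∣b p∤b
    ...   | inj₂ p∣c = contradiction p∣c p∤c

    e : ℕ
    e = quotient p∣s
    s≡ : s ≡ p * e
    s≡ = m∣n⇒n≡m*quotient p∣s
    4m≡pe+1 : 4 * m ≡ p * e + 1
    4m≡pe+1 = trans 4m≡ (trans (cong suc s≡) (+-comm 1 (p * e)))
    ebc≡ : e * (b * c) ≡ m * (b + c)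
    ebc≡ = *-cancelˡ-≡ _ _ p (trans (sym (*-assoc p e (b * c))) (trans (cong (_* (b * c)) (sym s≡)) sbc≡))
    0<e : 0 < e
    0<e = pos-*ˡ e (b * c) (subst (0 <_) (sym ebc≡) (*-pos 0<m (≤-trans 0<b (m≤m+n b c))))

    finish : ∃[ g ] ∃[ u ] ∃[ v ] 0 < g × b ≡ g * u × c ≡ g * v × Coprime u v × g ≡ gcd b c → Goal
    finish (g , u , v , 0<g , b≡ , c≡ , coprime , _) = go u∣m
      where
      instance g≢0 = >-nonZero 0<g
      0<u : 0 < u
      0<u = pos-*ʳ g u (subst (0 <_) b≡ 0<b)
      0<v : 0 < v
      0<v = pos-*ʳ g v (subst (0 <_) c≡ 0<c)
      eguv≡ : e * g * (u * v) ≡ m * (u + v)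
      eguv≡ = *-cancelˡ-≡ _ _ g (begin
        g * (e * g * (u * v))         ≡⟨ regroup₁ g e u v ⟩
        e * (g * u * (g * v))         ≡⟨ cong₂ (λ x y → e * (x * y)) b≡ c≡ ⟨
        e * (b * c)                   ≡⟨ ebc≡ ⟩
        m * (b + c)                   ≡⟨ cong₂ (λ x y → m * (x + y)) b≡ c≡ ⟩
        m * (g * u + g * v)           ≡⟨ regroup₂ g m u v ⟩
        g * (m * (u + v))             ∎)
        where
        regroup₁ : ∀ g e u v → g * (e * g * (u * v)) ≡ e * (g * u * (g * v))
        regroup₁ = solve-∀
        regroup₂ : ∀ g m u v → m * (g * u + g * v) ≡ g * (m * (u + v))
        regroup₂ = solve-∀
      u∣m : u ∣ m
      u∣m = coprime-divisor coprime (∣m+n∣m⇒∣n (subst (u ∣_) (trans eguv≡ (regroup m u v)) (∣n⇒∣m*n (e * g) (m∣m*n v))) (m∣m*n m))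
        where
        regroup : ∀ m u v → m * (u + v) ≡ u * m + v * m
        regroup = solve-∀

      go : u ∣ m → Goal
      go (divides m₁ m≡) = go₁ v∣m₁
        where
        egv≡ : e * g * v ≡ m₁ * (u + v)
        egv≡ = *-cancelˡ-≡ _ _ u {{>-nonZero 0<u}} (begin
          u * (e * g * v)        ≡⟨ regroup₁ u (e * g) v ⟩
          e * g * (u * v)        ≡⟨ eguv≡ ⟩
          m * (u + v)            ≡⟨ cong (_* (u + v)) m≡ ⟩
          m₁ * u * (u + v)       ≡⟨ regroup₂ m₁ u (u + v) ⟩
          u * (m₁ * (u + v))     ∎)
          where
          regroup₁ : ∀ a b c → a * (b * c) ≡ b * (a * c)
          regroup₁ = solve-∀
          regroup₂ : ∀ a b c → a * b * c ≡ b * (a * c)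
          regroup₂ = solve-∀
        v∣m₁ : v ∣ m₁
        v∣m₁ = coprime-divisor (Coprimality.sym coprime) (∣m+n∣m⇒∣n (subst (v ∣_) (trans egv≡ (regroup m₁ u v)) (n∣m*n (e * g))) (m∣m*n m₁))
          where
          regroup : ∀ m u v → m * (u + v) ≡ v * m + u * m
          regroup = solve-∀

        go₁ : v ∣ m₁ → Goal
        go₁ (divides d m₁≡) = go₂ d∣g
          where
          m≡uvd : m ≡ u * v * d
          m≡uvd = trans m≡ (trans (cong (_* u) m₁≡) (regroup d v u))
            where
            regroup : ∀ a b c → a * b * c ≡ c * b * a
            regroup = solve-∀
          0<d : 0 < d
          0<d = pos-*ʳ (u * v) d (subst (0 <_) m≡uvd 0<m)
          eg≡ : e * g ≡ d * (u + v)
          eg≡ = *-cancelˡ-≡ _ _ v {{>-nonZero 0<v}} (begin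
            v * (e * g)          ≡⟨ *-comm v (e * g) ⟩
            e * g * v            ≡⟨ egv≡ ⟩
            m₁ * (u + v)         ≡⟨ cong (_* (u + v)) m₁≡ ⟩
            d * v * (u + v)      ≡⟨ regroup d v (u + v) ⟩
            v * (d * (u + v))    ∎)
            where
            regroup : ∀ a b c → a * b * c ≡ b * (a * c)
            regroup = solve-∀
          coprime-de : Coprime d e
          coprime-de {i} (i∣d , i∣e) = ∣1⇒≡1 (∣m+n∣m⇒∣n
            (subst (i ∣_) 4m≡pe+1 (∣n⇒∣m*n 4 (subst (i ∣_) (sym m≡uvd) (∣n⇒∣m*n (u * v) i∣d)))) (∣n⇒∣m*n p i∣e))
          d∣g : d ∣ g
          d∣g = coprime-divisor coprime-de (subst (d ∣_) (sym eg≡) (m∣m*n (u + v)))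

          go₂ : d ∣ g → Goal
          go₂ (divides k g≡) = u , v , d , k , e , record
            { 0<u = 0<u ; 0<v = 0<v ; 0<d = 0<d ; 0<k = 0<k ; 0<e = 0<e
            ; ek≡ = *-cancelˡ-≡ _ _ d {{>-nonZero 0<d}} (trans (regroup d e k) (trans (cong (e *_) (sym g≡)) eg≡))
            ; pe≡ = trans (sym 4m≡pe+1) (cong (4 *_) m≡uvd) } ,
            trans (*-comm m p) (cong (p *_) m≡uvd) ,
            trans b≡ (cong (_* u) g≡dk) , trans c≡ (cong (_* v) g≡dk)
            where
            g≡dk : g ≡ d * k
            g≡dk = trans g≡ (*-comm k d)
            0<k : 0 < k
            0<k = pos-*ˡ k d (subst (0 <_) g≡ 0<g)
            regroup : ∀ a b c → a * (b * c) ≡ b * (c * a)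
            regroup = solve-∀

  module _ {p u v d k e} (P : Parameters p u v d k e) where
    open Parameters P

    -- Multiply ek = u + v by 4ud and insert 4uvd = pe + 1: the result is pe + (4u²d + 1), a
    -- multiple of e.
    e∣value : e ∣ value u d
    e∣value = ∣m+n∣m⇒∣n (subst (e ∣_) (begin
      e * (k * (4 * u * d))              ≡⟨ *-assoc e k _ ⟨
      e * k * (4 * u * d)                ≡⟨ cong (_* (4 * u * d)) ek≡ ⟩
      (u + v) * (4 * u * d)              ≡⟨ regroup₁ u v d ⟩
      4 * (u * v * d) + 4 * (u * u * d)  ≡⟨ cong (_+ 4 * (u * u * d)) pe≡ ⟨
      p * e + 1 + 4 * (u * u * d)        ≡⟨ regroup₂ (p * e) (4 * (u * u * d)) ⟩
      p * e + value u d                  ∎) (m∣m*n _)) (n∣m*n p)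
      where
      open ≡-Reasoning
      regroup₁ : ∀ u v d → (u + v) * (4 * u * d) ≡ 4 * (u * v * d) + 4 * (u * u * d)
      regroup₁ = solve-∀
      regroup₂ : ∀ a b → a + 1 + b ≡ a + (b + 1)
      regroup₂ = solve-∀

    -- Since u ≤ v, 2e · udk = 2ud(u + v) ≤ 4uvd = pe + 1 ≤ 2pe.
    udk≤p : 0 < p → u ≤ v → u * d * k ≤ p
    udk≤p 0<p u≤v = *-cancelˡ-≤ 2 (*-cancelˡ-≤ e {{>-nonZero 0<e}} (begin
      e * (2 * (u * d * k))      ≡⟨ regroup₁ e u d k ⟩
      2 * u * d * (e * k)        ≡⟨ cong (2 * u * d *_) ek≡ ⟩
      2 * u * d * (u + v)        ≤⟨ *-monoʳ-≤ (2 * u * d) (+-monoˡ-≤ v u≤v) ⟩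
      2 * u * d * (v + v)        ≡⟨ regroup₂ u d v ⟩
      4 * (u * v * d)            ≡⟨ pe≡ ⟨
      p * e + 1                  ≤⟨ +-monoʳ-≤ (p * e) (*-pos 0<p 0<e) ⟩
      p * e + p * e              ≡⟨ regroup₃ p e ⟩
      e * (2 * p)                ∎))
      where
      open ≤-Reasoning
      regroup₁ : ∀ e u d k → e * (2 * (u * d * k)) ≡ 2 * u * d * (e * k)
      regroup₁ = solve-∀
      regroup₂ : ∀ u d v → 2 * u * d * (v + v) ≡ 4 * (u * v * d)
      regroup₂ = solve-∀
      regroup₃ : ∀ p e → p * e + p * e ≡ e * (2 * p)
      regroup₃ = solve-∀

  -- The six positions of (multiple of p, smaller, larger) in an ordered triple.
  place : ℕ → Triple → Triple
  place 0 (x , y , z) = x , y , z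
  place 1 (x , y , z) = x , z , y
  place 2 (x , y , z) = y , x , z
  place 3 (x , y , z) = z , x , y
  place 4 (x , y , z) = y , z , x
  place _ (x , y , z) = z , y , x

  -- Encoding solutions by an ordering, a triple and a divisor

  Code : Set
  Code = ℕ × (ℕ × ℕ × ℕ) × ℕ

  Encodes : ℕ × Triple → Code → Set
  Encodes (p , t) (σ , (u , d , k) , e) =
    ∃[ v ] Parameters p u v d k e × t ≡ place σ (p * (u * v * d) , d * k * u , d * k * v)

  -- The equation ek = u + v recovers v, and then pe + 1 = 4uvd recovers p because e is positive.
  -- The prime is thus not part of the code.
  encodes-injective : ∀ {x x′ y} → Encodes x y → Encodes x′ y → x ≡ x′
  encodes-injective {p , t} {p′ , t′} {σ , (u , d , k) , e} (v , P , t≡) (v′ , P′ , t′≡)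
    with refl ← +-cancelˡ-≡ u v v′ (trans (sym (Parameters.ek≡ P)) (Parameters.ek≡ P′))
    with refl ← *-cancelʳ-≡ p p′ e {{>-nonZero (Parameters.0<e P)}}
                  (+-cancelʳ-≡ 1 (p * e) (p′ * e) (trans (Parameters.pe≡ P) (sym (Parameters.pe≡ P′)))) =
    cong (p ,_) (trans t≡ (sym t′≡))

  divisor-codes : ℕ → ℕ × ℕ × ℕ → List ℕ
  divisor-codes N (u , d , k) = if does (u * d * k ≤? N) then divisors (value u d) else []

  parameter-codes : ℕ → List ((ℕ × ℕ × ℕ) × ℕ)
  parameter-codes N = concatMap (λ x → map (x ,_) (divisor-codes N x)) (triples N)

  codes : ℕ → List Code
  codes N = cartesianProduct (upTo 6) (parameter-codes N)

  length-codes : ∀ N → length (codes N) ≡ 6 * ∑ (triples N) (λ (u , d , k) → inside N (u , d , k) * τ (value u d))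
  length-codes N = begin
    length (codes N)                     ≡⟨ length-cartesianProduct (upTo 6) (parameter-codes N) ⟩
    6 * length (parameter-codes N)       ≡⟨ cong (6 *_) (length-concatMap _ (triples N)) ⟩
    6 * ∑ (triples N) (λ x → length (map (x ,_) (divisor-codes N x)))
      ≡⟨ cong (6 *_) (∑-cong (triples N) count) ⟩
    6 * ∑ (triples N) (λ (u , d , k) → inside N (u , d , k) * τ (value u d))  ∎
    where
    open ≡-Reasoning
    count : ∀ ((u , d , k) : ℕ × ℕ × ℕ) → length (map ((u , d , k) ,_) (divisor-codes N (u , d , k))) ≡ inside N (u , d , k) * τ (value u d)
    count (u , d , k) = trans (length-map _ (divisor-codes N (u , d , k))) (branch (u * d * k ≤? N))
      where
      branch : ∀ {P : Set} (dec : Dec P) → length (if does dec then divisors (value u d) else []) ≡ 𝟙 dec * τ (value u d)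
      branch (yes _) = trans (length≡∑1 (divisors (value u d))) (sym (+-identityʳ _))
      branch (no _)  = refl

  ∈-codes : ∀ {N p σ u v d k e} → σ < 6 → 0 < p → p ≤ N → Parameters p u v d k e → u ≤ v →
            (σ , (u , d , k) , e) ∈ codes N
  ∈-codes {N} {p} {σ} {u} {v} {d} {k} {e} σ<6 0<p p≤N P u≤v =
    ∈-cartesianProduct⁺ (∈-upTo⁺ σ<6) (∈-concatMap⁺ (λ x → map (x ,_) (divisor-codes N x)) (lose
      (∈-cartesianProduct⁺ (∈-range⁺ 0<u (≤-trans (m≤m*n u (d * k) {{>-nonZero (*-pos 0<d 0<k)}}) u[dk]≤N))
        (∈-cartesianProduct⁺ (∈-range⁺ 0<d (≤-trans (m≤n*m d (u * k) {{>-nonZero (*-pos 0<u 0<k)}}) (≤-trans (≤-reflexive (regroup u d k)) udk≤N)))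
          (∈-range⁺ 0<k (≤-trans (m≤n*m k (u * d) {{>-nonZero (*-pos 0<u 0<d)}}) udk≤N))))
      (∈-map⁺ _ (branch (u * d * k ≤? N)))))
    where
    open Parameters P
    udk≤N : u * d * k ≤ N
    udk≤N = ≤-trans (udk≤p P 0<p u≤v) p≤N
    u[dk]≤N : u * (d * k) ≤ N
    u[dk]≤N = ≤-trans (≤-reflexive (sym (*-assoc u d k))) udk≤N
    regroup : ∀ u d k → u * k * d ≡ u * d * k
    regroup = solve-∀
    branch : (dec : Dec (u * d * k ≤ N)) → e ∈ (if does dec then divisors (value u d) else [])
    branch (yes _) = ∈-divisors⁺ (m≤n+m 1 _) (e∣value P)
    branch (no n)  = contradiction udk≤N n

  encode : ∀ {N p t} → Prime p → p ≤ N → Solves₁ p t → ∃ λ y → y ∈ codes N × Encodes (p , t) y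
  encode {N} {p} {n₁ , n₂ , n₃} pr p≤N s = cases oneMultiple
    where
    open IsSolution₁ s
    0<p = prime-pos pr
    0<n₁ = >-nonZero⁻¹ n₁
    0<n₂ = >-nonZero⁻¹ n₂
    0<n₃ = >-nonZero⁻¹ n₃
    cleared : Bound.Cleared p n₁ n₂ n₃
    cleared = Bound.clear p n₁ n₂ n₃ equation

    -- The two positions differ by exchanging the denominators not divisible by `p`; the one used is
    -- decided by which of `u`, `v` is smaller, since codes require u ≤ v.
    choose : ∀ σ σ′ {a b c} → σ < 6 → σ′ < 6 → 0 < a → 0 < b → 0 < c → Bound.Cleared p a b c →
             p ∣ a → ¬ p ∣ b → ¬ p ∣ c → (n₁ , n₂ , n₃) ≡ place σ (a , b , c) → (n₁ , n₂ , n₃) ≡ place σ′ (a , c , b) →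
             ∃ λ y → y ∈ codes N × Encodes (p , n₁ , n₂ , n₃) y
    choose σ σ′ σ<6 σ′<6 0<a 0<b 0<c cl p∣a p∤b p∤c t≡ t≡′
      with u , v , d , k , e , P , refl , refl , refl ← parametrise pr 0<a 0<b 0<c cl p∣a p∤b p∤c
      with ≤-total u v
    ... | inj₁ u≤v = (σ , (u , d , k) , e) , ∈-codes σ<6 0<p p≤N P u≤v , v , P , t≡
    ... | inj₂ v≤u = (σ′ , (v , d , k) , e) , ∈-codes σ′<6 0<p p≤N (swap-parameters P) v≤u , u , swap-parameters P ,
                     trans t≡′ (cong (λ x → place σ′ (p * (x * d) , d * k * v , d * k * u)) (*-comm u v))

    cases : ExactlyOne (p ∣ n₁) (p ∣ n₂) (p ∣ n₃) → ∃ λ y → y ∈ codes N × Encodes (p , n₁ , n₂ , n₃) y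
    cases (inj₁ (p∣₁ , p∤₂ , p∤₃)) = choose 0 1 (≤ᵇ⇒≤ _ _ tt) (≤ᵇ⇒≤ _ _ tt) 0<n₁ 0<n₂ 0<n₃ cleared p∣₁ p∤₂ p∤₃ refl refl
    cases (inj₂ (inj₁ (p∤₁ , p∣₂ , p∤₃))) = choose 2 3 (≤ᵇ⇒≤ _ _ tt) (≤ᵇ⇒≤ _ _ tt) 0<n₂ 0<n₁ 0<n₃
      (Bound.swap₁₂ p n₁ n₂ n₃ cleared) p∣₂ p∤₁ p∤₃ refl refl
    cases (inj₂ (inj₂ (p∤₁ , p∤₂ , p∣₃))) = choose 4 5 (≤ᵇ⇒≤ _ _ tt) (≤ᵇ⇒≤ _ _ tt) 0<n₃ 0<n₁ 0<n₂
      (Bound.swap₁₂ p n₁ n₃ n₂ (Bound.swap₂₃ p n₁ n₂ n₃ cleared)) p∣₃ p∤₁ p∤₂ refl refl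

  sum-map≡∑ : ∀ (f : ℕ → ℕ) xs → sum (map f xs) ≡ ∑ xs f
  sum-map≡∑ f []       = refl
  sum-map≡∑ f (x ∷ xs) = cong (f x +_) (sum-map≡∑ f xs)

  ∑f₁≤ : ∃[ C ] (∀ N (ps : List ℕ) → Unique ps → (∀ {p} → p ∈ ps → Prime p × p ≤ N) →
                  sum (map f₁ ps) ≤ C * ∑÷ (value N N) 5 (2 * N))
  ∑f₁≤ = 6 * proj₁ ∑τ-value , bound
    where
    open ≤-Reasoning
    bound : ∀ N (ps : List ℕ) → Unique ps → (∀ {p} → p ∈ ps → Prime p × p ≤ N) →
            sum (map f₁ ps) ≤ 6 * proj₁ ∑τ-value * ∑÷ (value N N) 5 (2 * N)
    bound N ps uniq h = begin
      sum (map f₁ ps)                                ≡⟨ sum-map≡∑ f₁ ps ⟩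
      ∑ ps f₁                                        ≡⟨ ∑-cong ps (λ p → length-map (p ,_) (solutions₁ p)) ⟨
      ∑ ps (λ p → length (map (p ,_) (solutions₁ p)))  ≡⟨ length-concatMap _ ps ⟨
      length solutions                               ≡⟨ length≡∑1 solutions ⟩
      ∑ solutions (λ _ → 1)
        ≤⟨ ∑-inject Encodes solutions (codes N) {g = λ _ → 1} (concatMap-, uniq solutions₁-unique) embed encodes-injective ⟩
      ∑ (codes N) (λ _ → 1)                          ≡⟨ length≡∑1 (codes N) ⟨
      length (codes N)                               ≡⟨ length-codes N ⟩
      6 * ∑ (triples N) (λ (u , d , k) → inside N (u , d , k) * τ (value u d))
        ≤⟨ *-monoʳ-≤ 6 (proj₂ ∑τ-value N) ⟩
      6 * (proj₁ ∑τ-value * ∑÷ (value N N) 5 (2 * N))  ≡⟨ *-assoc 6 (proj₁ ∑τ-value) (∑÷ (value N N) 5 (2 * N)) ⟨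
      6 * proj₁ ∑τ-value * ∑÷ (value N N) 5 (2 * N)  ∎
      where
      solutions : List (ℕ × Triple)
      solutions = concatMap (λ p → map (p ,_) (solutions₁ p)) ps
      embed : ∀ {x} → x ∈ solutions → 1 ≡ 0 ⊎ ∃ λ y → y ∈ codes N × Encodes x y × 1 ≤ 1
      embed x∈ with p , p∈ , t∈ ← find (∈-concatMap⁻ (λ p → map (p ,_) (solutions₁ p)) x∈)
        with t , t∈′ , refl ← ∈-map⁻ (p ,_) t∈ =
        let pr , p≤N = h p∈
            y , y∈ , enc = encode pr p≤N (Equivalence.to (∈-solutions₁ p t) t∈′)
        in inj₂ (y , y∈ , enc , ≤-refl)

  -- Intervals and truncation of the quotient sums

  interval : ℕ → ℕ → List ℕ
  interval k zero    = []
  interval k (suc m) = suc k ∷ interval (suc k) m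

  interval-++ : ∀ k m n → interval k (m + n) ≡ interval k m ++ interval (k + m) n
  interval-++ k zero    n = cong (λ k → interval k n) (sym (+-identityʳ k))
  interval-++ k (suc m) n = cong (suc k ∷_) (trans (interval-++ (suc k) m n)
    (cong (λ l → interval (suc k) m ++ interval l n) (sym (+-suc k m))))

  range≡interval : ∀ n → range n ≡ interval 0 n
  range≡interval = go suc 0 (λ i → refl)
    where
    go : ∀ f k → (∀ i → f i ≡ suc (k + i)) → ∀ n → applyUpTo f n ≡ interval k n
    go f k h zero    = refl
    go f k h (suc n) = cong₂ _∷_ (trans (h 0) (cong suc (+-identityʳ k)))
      (go (f ∘ suc) (suc k) (λ i → trans (h (suc i)) (cong suc (+-suc k i))) n)

  ÷-≤ : ∀ z i → 0 < i → z ÷ i ≤ z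
  ÷-≤ z (suc i) _ = m/n≤m z (suc i)

  ∑÷-0 : ∀ B j → ∑÷ B j 0 ≡ 0
  ∑÷-0 B zero    = refl
  ∑÷-0 B (suc j) = trans (∑-cong (range B) (λ i → trans (cong (∑÷ B j) (0÷ i)) (∑÷-0 B j))) (∑-0 (range B))

  -- For i > M ≥ z the quotient `z ÷ i` is 0. So the harmonic sums run up to M = 2N in the
  -- application, although the moduli ran up to a cubic bound in N.
  ∑÷-suc-≤ : ∀ {M} B j z → z ≤ M → ∑÷ B (suc j) z ≤ ∑ (range M) (λ i → ∑÷ B j (z ÷ i))
  ∑÷-suc-≤ {M} B j z z≤M = ∑-⊆ (range B) (range M) _ (range! B) keep
    where
    keep : ∀ {i} → i ∈ range B → ∑÷ B j (z ÷ i) ≡ 0 ⊎ i ∈ range M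
    keep {suc i} i∈ with suc i ≤? M
    ... | yes i≤M = inj₂ (∈-range⁺ (proj₁ (∈-range⁻ i∈)) i≤M)
    ... | no  i≰M = inj₁ (trans (cong (∑÷ B j) (m<n⇒m/n≡0 (≤-<-trans z≤M (≰⇒> i≰M)))) (∑÷-0 B j))
    keep {zero} i∈ = contradiction (proj₁ (∈-range⁻ i∈)) (λ ())

  -- Recording that `N` is 1 or a member of the list gives N ≤ x for the list of primes below x,
  -- without a floor function on the reals.
  upper-bound : ∀ (ps : List ℕ) → ∃[ N ] (0 < N × (N ≡ 1 ⊎ N ∈ ps) × (∀ {p} → p ∈ ps → p ≤ N))
  upper-bound []       = 1 , s≤s z≤n , inj₁ refl , λ ()
  upper-bound (p ∷ ps) with upper-bound ps
  ... | N , 0<N , origin , bound with ≤-total p N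
  ...   | inj₁ p≤N = N , 0<N , [ inj₁ , inj₂ ∘ there ]′ origin , λ { (here refl) → p≤N ; (there q∈) → bound q∈ }
  ...   | inj₂ N≤p = p , ≤-trans 0<N N≤p , inj₂ (here refl) , λ { (here refl) → ≤-refl ; (there q∈) → ≤-trans (bound q∈) N≤p }

open Counting using (∑; range; ∈-range⁻; _÷_; ÷-*-≤; ∑÷; value; ∑f₁≤; interval; interval-++; range≡interval; ÷-≤; ∑÷-suc-≤; upper-bound)

-- Passage to the real field

module Estimates (ℝ : CompleteOrderedField) where
  open RealFunctions ℝ
  open Properties
  open SemiringMult semiring using (×1-homo-*; ×-homo-+)

  open SemiringSolver (CommutativeRing.commutativeSemiring commutativeRing) using (solve; _:=_; _:+_; _:*_)

  ≤-preorder : Preorder 0ℓ 0ℓ 0ℓ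
  ≤-preorder = record
    { isPreorder = SN.isPreorder₂ (IsStrictTotalOrder.isStrictPartialOrder isStrictTotalOrder) }

  open PreorderReasoning ≤-preorder

  ≤-reflexive : ∀ {x y} → x ≈ y → x ≤ y
  ≤-reflexive = inj₂

  ≤-refl : ∀ {x} → x ≤ x
  ≤-refl = inj₂ R.refl

  +-mono-≤ : ∀ {a b c d} → a ≤ b → c ≤ d → a + c ≤ b + d
  +-mono-≤ {b = b} {c} a≤b c≤d = ≤-trans (+-monoˡ-≤ c a≤b) (+-monoʳ-≤ b c≤d)

  x≤x+y : ∀ {x y} → 0# ≤ y → x ≤ x + y
  x≤x+y {x} 0≤y = ≤-respˡ (R.+-identityʳ x) (+-monoʳ-≤ x 0≤y)

  *-monoˡ-≤ : ∀ {a b} c → 0# ≤ c → a ≤ b → a * c ≤ b * c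
  *-monoˡ-≤ c 0≤c a≤b = ≤-respˡ (R.*-comm c _) (≤-respʳ (R.*-comm c _) (*-monoʳ-≤ c 0≤c a≤b))

  *-mono-≤ : ∀ {a b c d} → 0# ≤ b → 0# ≤ c → a ≤ b → c ≤ d → a * c ≤ b * d
  *-mono-≤ {b = b} {c} 0≤b 0≤c a≤b c≤d = ≤-trans (*-monoˡ-≤ c 0≤c a≤b) (*-monoʳ-≤ b 0≤b c≤d)

  0≤* : ∀ {a b} → 0# ≤ a → 0# ≤ b → 0# ≤ a * b
  0≤* {a} 0≤a 0≤b = ≤-respˡ (R.zeroʳ a) (*-monoʳ-≤ a 0≤a 0≤b)

  0≤+ : ∀ {a b} → 0# ≤ a → 0# ≤ b → 0# ≤ a + b
  0≤+ 0≤a 0≤b = ≤-trans 0≤a (x≤x+y 0≤b)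

  0≤^ : ∀ {a} k → 0# ≤ a → 0# ≤ a ^ k
  0≤^ zero    _   = inj₁ 0<1
  0≤^ (suc k) 0≤a = 0≤* 0≤a (0≤^ k 0≤a)

  ^-monoˡ-≤ : ∀ {a b} k → 0# ≤ a → a ≤ b → a ^ k ≤ b ^ k
  ^-monoˡ-≤ zero    _   _   = ≤-refl
  ^-monoˡ-≤ (suc k) 0≤a a≤b = *-mono-≤ (≤-trans 0≤a a≤b) (0≤^ k 0≤a) a≤b (^-monoˡ-≤ k 0≤a a≤b)

  half-≤ : ∀ {a b} → a + a ≤ b + b → a ≤ b
  half-≤ {a} {b} h with compare a b
  ... | tri< a<b _ _ = inj₁ a<b
  ... | tri≈ _ a≈b _ = inj₂ a≈b
  ... | tri> _ _ b<a = ⊥-elim (O.irrefl R.refl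
    (<-≤-trans (O.trans (+-monoˡ-< b b<a) (<-respˡ (R.+-comm b a) (+-monoˡ-< a b<a))) h))

  fromℕ-+ : ∀ m n → fromℕ (m ℕ.+ n) ≈ fromℕ m + fromℕ n
  fromℕ-+ = ×-homo-+ 1#

  fromℕ-* : ∀ m n → fromℕ (m ℕ.* n) ≈ fromℕ m * fromℕ n
  fromℕ-* = ×1-homo-*

  fromℕ-1 : fromℕ 1 ≈ 1#
  fromℕ-1 = R.+-identityʳ 1#

  0≤fromℕ : ∀ n → 0# ≤ fromℕ n
  0≤fromℕ n = fromℕ-mono {0} {n} z≤n

  1≤fromℕ : ∀ {n} → 0 ℕ.< n → 1# ≤ fromℕ n
  1≤fromℕ {n} 0<n = ≤-respˡ fromℕ-1 (fromℕ-mono {1} {n} 0<n)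

  0<fromℕ : ∀ {n} → 0 ℕ.< n → 0# < fromℕ n
  0<fromℕ 0<n = 1≤x⇒0<x (1≤fromℕ 0<n)

  ⁻¹-inverseʳ : ∀ {x} → 0# < x → x * x ⁻¹ ≈ 1#
  ⁻¹-inverseʳ 0<x = R.trans (R.*-comm _ _) (⁻¹-inverse (>0⇒≉0 0<x))

  ≤-*⁻¹ : ∀ {a b c} → 0# < c → a * c ≤ b → a ≤ b * c ⁻¹
  ≤-*⁻¹ {a} {b} {c} 0<c h = begin
    a                  ≈⟨ R.*-identityʳ a ⟨
    a * 1#             ≈⟨ R.*-congˡ (⁻¹-inverseʳ 0<c) ⟨
    a * (c * c ⁻¹)     ≈⟨ R.*-assoc a c (c ⁻¹) ⟨
    a * c * c ⁻¹       ≲⟨ *-monoˡ-≤ (c ⁻¹) (inj₁ (⁻¹-positive 0<c)) h ⟩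
    b * c ⁻¹           ∎

  ⁻¹-anti-≤ : ∀ {a b} → 0# < a → a ≤ b → b ⁻¹ ≤ a ⁻¹
  ⁻¹-anti-≤ {a} {b} 0<a a≤b = ≤-respʳ (R.*-identityˡ (a ⁻¹)) (≤-*⁻¹ 0<a (begin
    b ⁻¹ * a     ≲⟨ *-monoʳ-≤ (b ⁻¹) (inj₁ (⁻¹-positive 0<b)) a≤b ⟩
    b ⁻¹ * b     ≈⟨ ⁻¹-inverse (>0⇒≉0 0<b) ⟩
    1#           ∎))
    where
    0<b = <-≤-trans 0<a a≤b

  -- Harmonic sums

  recips : List ℕ → Carrier
  recips []       = 0#
  recips (i ∷ is) = fromℕ i ⁻¹ + recips is

  recips-++ : ∀ is js → recips (is ++ js) ≈ recips is + recips js
  recips-++ []       js = R.sym (R.+-identityˡ _)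
  recips-++ (i ∷ is) js = R.trans (R.+-congˡ (recips-++ is js)) (R.sym (R.+-assoc _ _ _))

  0≤recips-range : ∀ M → 0# ≤ recips (range M)
  0≤recips-range M = ≡.subst (λ is → 0# ≤ recips is) (≡.sym (range≡interval M)) (go 0 M)
    where
    go : ∀ k m → 0# ≤ recips (interval k m)
    go k zero    = ≤-refl
    go k (suc m) = 0≤+ (inj₁ (⁻¹-positive (0<fromℕ {suc k} (s≤s z≤n)))) (go (suc k) m)

  recips-interval-≤ : ∀ {K} → 0 ℕ.< K → ∀ k m → K ℕ.≤ k → recips (interval k m) ≤ fromℕ m * fromℕ K ⁻¹
  recips-interval-≤ {K} 0<K k zero    K≤k = ≤-reflexive (R.sym (R.zeroˡ _))
  recips-interval-≤ {K} 0<K k (suc m) K≤k = begin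
    fromℕ (suc k) ⁻¹ + recips (interval (suc k) m)
      ≲⟨ +-mono-≤ (⁻¹-anti-≤ (0<fromℕ 0<K) (fromℕ-mono {K} {suc k} K≤1+k)) (recips-interval-≤ 0<K (suc k) m K≤1+k) ⟩
    fromℕ K ⁻¹ + fromℕ m * fromℕ K ⁻¹
      ≈⟨ R.+-congʳ (R.*-identityˡ _) ⟨
    1# * fromℕ K ⁻¹ + fromℕ m * fromℕ K ⁻¹
      ≈⟨ R.distribʳ (fromℕ K ⁻¹) 1# (fromℕ m) ⟨
    fromℕ (suc m) * fromℕ K ⁻¹  ∎
    where
    K≤1+k = ℕ.m≤n⇒m≤1+n K≤k

  -- The bound `M` stays fixed while `z` shrinks to `z ÷ i`, so every level of the recursion
  -- contributes the same harmonic sum, and ⌊z/i⌋ ≤ z/i supplies its terms.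
  ∑÷-≤ : ∀ M B j z → z ℕ.≤ M → fromℕ (∑÷ B j z) ≤ fromℕ z * recips (range M) ^ j
  ∑÷-≤ M B zero    z z≤M = ≤-reflexive (R.sym (R.*-identityʳ _))
  ∑÷-≤ M B (suc j) z z≤M = begin
    fromℕ (∑÷ B (suc j) z)
      ≲⟨ fromℕ-mono {∑÷ B (suc j) z} (∑÷-suc-≤ B j z z≤M) ⟩
    fromℕ (∑ (range M) (λ i → ∑÷ B j (z ÷ i)))
      ≲⟨ go (range M) (All.tabulate (λ i∈ → proj₁ (∈-range⁻ i∈))) ⟩
    fromℕ z * H ^ j * H
      ≈⟨ R.trans (R.*-assoc _ _ _) (R.*-congˡ (R.*-comm (H ^ j) H)) ⟩
    fromℕ z * H ^ suc j  ∎
    where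
    H = recips (range M)
    0≤H^j = 0≤^ j (0≤recips-range M)
    go : ∀ is → All (0 ℕ.<_) is → fromℕ (∑ is (λ i → ∑÷ B j (z ÷ i))) ≤ fromℕ z * H ^ j * recips is
    go []       []          = ≤-reflexive (R.sym (R.zeroʳ _))
    go (i ∷ is) (0<i ∷ 0<is) = begin
      fromℕ (∑÷ B j (z ÷ i) ℕ.+ ∑ is (λ i → ∑÷ B j (z ÷ i)))
        ≈⟨ fromℕ-+ (∑÷ B j (z ÷ i)) _ ⟩
      fromℕ (∑÷ B j (z ÷ i)) + fromℕ (∑ is (λ i → ∑÷ B j (z ÷ i)))
        ≲⟨ +-mono-≤ (∑÷-≤ M B j (z ÷ i) (ℕ.≤-trans (÷-≤ z i 0<i) z≤M)) (go is 0<is) ⟩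
      fromℕ (z ÷ i) * H ^ j + fromℕ z * H ^ j * recips is
        ≲⟨ +-monoˡ-≤ _ (*-monoˡ-≤ (H ^ j) 0≤H^j (≤-*⁻¹ (0<fromℕ 0<i)
             (≤-respˡ (fromℕ-* (z ÷ i) i) (fromℕ-mono {z ÷ i ℕ.* i} (÷-*-≤ z i))))) ⟩
      fromℕ z * fromℕ i ⁻¹ * H ^ j + fromℕ z * H ^ j * recips is
        ≈⟨ solve 4 (λ a b c d → (a :* b :* c :+ a :* c :* d) := (a :* c :* (b :+ d))) R.refl (fromℕ z) (fromℕ i ⁻¹) (H ^ j) (recips is) ⟩
      fromℕ z * H ^ j * (fromℕ i ⁻¹ + recips is)  ∎

  -- Lower bounds for the logarithm by Darboux sums

  lowerSum≤log : ∀ {x r} → 1# < x → IsLowerSum x r → r ≤ log x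
  lowerSum≤log {x} 1<x lower with compare 1# x | 0# <? x
  ... | tri< 1<x′ _ _ | _ = proj₁ (proj₂ (∫₁dt/t x (inj₁ 1<x′))) lower
  ... | tri≈ 1≮x _ _  | _ = ⊥-elim (1≮x 1<x)
  ... | tri> 1≮x _ _  | _ = ⊥-elim (1≮x 1<x)

  0≤last-step : ∀ {s x} → 0# < x → s ≤ x → 0# ≤ (x - s) * x ⁻¹ + 0#
  0≤last-step 0<x s≤x = ≤-respʳ (R.sym (R.+-identityʳ _)) (0≤* (≤⇒0≤- s≤x) (inj₁ (⁻¹-positive 0<x)))

  -- A step from k to k + 1 contributes exactly 1/(k + 1), and the final piece up to `x` is
  -- nonnegative. The start `s` is given up to `≈` because the division begins at `1#`, whereas
  -- `fromℕ 1` is `1# + 0#`.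
  unit-steps : ∀ {x} → 0# < x → ∀ m k s → s ≈ fromℕ k → fromℕ (k ℕ.+ m) ≤ x →
               Linked _≤_ (s ∷ map fromℕ (interval k m) ∷ʳ x) ×
               recips (interval k m) ≤ lowerSum (s ∷ map fromℕ (interval k m) ∷ʳ x)
  unit-steps {x} 0<x zero k s s≈k k≤x = s≤x ∷ [-] , 0≤last-step 0<x s≤x
    where
    s≤x : s ≤ x
    s≤x = ≤-respˡ (R.sym s≈k) (≡.subst (λ k → fromℕ k ≤ x) (ℕ.+-identityʳ k) k≤x)
  unit-steps {x} 0<x (suc m) k s s≈k k≤x =
    let linked , bound = unit-steps 0<x m (suc k) t R.refl (≡.subst (λ k → fromℕ k ≤ x) (ℕ.+-suc k m) k≤x)
    in ≤-respˡ (R.sym s≈k) (fromℕ-mono {k} {suc k} (ℕ.n≤1+n k)) ∷ linked ,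
       +-mono-≤ (≤-reflexive (R.sym step≈)) bound
    where
    t = fromℕ (suc k)
    step≈ : (t - s) * t ⁻¹ ≈ t ⁻¹
    step≈ = R.trans (R.*-congʳ (R.trans (R.+-congʳ (R.+-congˡ (R.sym s≈k)))
      (R.trans (R.+-assoc 1# s (- s)) (R.trans (R.+-congˡ (R.-‿inverseʳ s)) (R.+-identityʳ 1#))))) (R.*-identityˡ _)

  harmonic≤log : ∀ {x} n → 1# < x → fromℕ (suc n) ≤ x → recips (interval 1 n) ≤ log x
  harmonic≤log {x} n 1<x n≤x =
    let linked , bound = unit-steps (O.trans 0<1 1<x) n 1 1# (R.sym fromℕ-1) n≤x
    in ≤-trans bound (lowerSum≤log 1<x (map fromℕ (interval 1 n) , linked , R.refl))

  two half : Carrier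
  two  = 1# + 1#
  half = two ⁻¹

  0<two : 0# < two
  0<two = <-≤-trans 0<1 (x≤x+y (inj₁ 0<1))

  half+half : half + half ≈ 1#
  half+half = R.trans (R.+-cong (R.sym (R.*-identityˡ half)) (R.sym (R.*-identityˡ half)))
    (R.trans (R.sym (R.distribʳ half 1# 1#)) (⁻¹-inverseʳ 0<two))

  -- With t = 2s the contribution is s / 2s, so equality holds.
  doubling-step : ∀ {s t} → 0# < s → t ≈ s + s → half ≤ (t - s) * t ⁻¹
  doubling-step {s} {t} 0<s t≈ = half-≤ (≤-reflexive (R.trans half+half (R.sym doubled)))
    where
    0<t : 0# < t
    0<t = <-respʳ (R.sym t≈) (<-≤-trans 0<s (x≤x+y (inj₁ 0<s)))
    t-s≈ : t - s ≈ s
    t-s≈ = R.trans (R.+-congʳ t≈) (R.trans (R.+-assoc s s (- s)) (R.trans (R.+-congˡ (R.-‿inverseʳ s)) (R.+-identityʳ s)))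
    doubled : (t - s) * t ⁻¹ + (t - s) * t ⁻¹ ≈ 1#
    doubled = R.trans (R.sym (R.distribʳ (t ⁻¹) (t - s) (t - s)))
      (R.trans (R.*-congʳ (R.trans (R.+-cong t-s≈ t-s≈) (R.sym t≈))) (⁻¹-inverseʳ 0<t))

  1<two : 1# < two
  1<two = <-respˡ (R.+-identityˡ 1#) (+-monoˡ-< 1# 0<1)

  fromℕ-2 : fromℕ 2 ≈ two
  fromℕ-2 = R.+-congˡ fromℕ-1

  half≤log : ∀ {y} → two ≤ y → half ≤ log y
  half≤log {y} 2≤y = ≤-trans
    (≤-trans (x≤x+y (0≤last-step 0<y 2≤y)) (+-monoˡ-≤ _ (doubling-step 0<1 R.refl)))
    (lowerSum≤log (<-≤-trans 1<two 2≤y) (two ∷ [] , inj₁ 1<two ∷ 2≤y ∷ [-] , R.refl))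
    where
    0<y = <-≤-trans 0<two 2≤y

  -- The four doublings from 1 to 16 contribute one half each. This is the origin of the threshold
  -- 16.
  two≤log : ∀ {x} → fromℕ 16 ≤ x → two ≤ log x
  two≤log {x} 16≤x = begin
    two
      ≈⟨ R.+-cong half+half half+half ⟨
    (half + half) + (half + half)
      ≈⟨ R.+-assoc half half _ ⟩
    half + (half + (half + half))
      ≲⟨ +-mono-≤ (doubling-step 0<1 fromℕ-2) (+-mono-≤ (step 2) (+-mono-≤ (step 4) (≤-trans (step 8) (x≤x+y (0≤last-step 0<x 16≤x))))) ⟩
    lowerSum (1# ∷ fromℕ 2 ∷ fromℕ 4 ∷ fromℕ 8 ∷ fromℕ 16 ∷ x ∷ [])
      ≲⟨ lowerSum≤log 1<x (fromℕ 2 ∷ fromℕ 4 ∷ fromℕ 8 ∷ fromℕ 16 ∷ [] ,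
           1≤fromℕ {2} (s≤s z≤n) ∷ mono 2 4 tt ∷ mono 4 8 tt ∷ mono 8 16 tt ∷ 16≤x ∷ [-] , R.refl) ⟩
    log x  ∎
    where
    mono : ∀ m n → Bool.T (m ℕ.≤ᵇ n) → fromℕ m ≤ fromℕ n
    mono m n h = fromℕ-mono {m} {n} (ℕ.≤ᵇ⇒≤ m n h)
    step : ∀ n {h : Bool.T (1 ℕ.≤ᵇ n)} → half ≤ (fromℕ (n ℕ.+ n) - fromℕ n) * fromℕ (n ℕ.+ n) ⁻¹
    step n {h} = doubling-step (0<fromℕ (ℕ.≤ᵇ⇒≤ 1 n h)) (fromℕ-+ n n)
    1<x : 1# < x
    1<x = <-≤-trans 1<two (≤-trans (≤-respˡ fromℕ-2 (mono 2 16 tt)) 16≤x)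
    0<x : 0# < x
    0<x = O.trans 0<1 1<x

  -- The term 1 is split off, the terms from 2 to N are a lower sum for log x, and the N terms from
  -- N + 1 to 2N are at most 1/N each. The two units together are at most log x because log x ≥ 2.
  recips≤2log : ∀ {x} N → 0 ℕ.< N → fromℕ 16 ≤ x → fromℕ N ≤ x → recips (range (2 ℕ.* N)) ≤ two * log x
  recips≤2log {x} N@(suc n) 0<N 16≤x N≤x = begin
    recips (range (N ℕ.+ (N ℕ.+ 0)))
      ≈⟨ R.reflexive (≡.cong recips (≡.trans (≡.cong (λ m → range (N ℕ.+ m)) (ℕ.+-identityʳ N))
           (≡.trans (range≡interval (N ℕ.+ N)) (interval-++ 0 N N)))) ⟩
    recips (interval 0 N ++ interval N N)
      ≈⟨ recips-++ (interval 0 N) (interval N N) ⟩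
    (fromℕ 1 ⁻¹ + recips (interval 1 n)) + recips (interval N N)
      ≲⟨ +-mono-≤ (+-mono-≤ (1≤x⇒x⁻¹≤1 (1≤fromℕ {1} (s≤s z≤n))) (harmonic≤log n 1<x N≤x))
           (≤-respʳ (⁻¹-inverseʳ (0<fromℕ 0<N)) (recips-interval-≤ 0<N N N ℕ.≤-refl)) ⟩
    (1# + log x) + 1#
      ≈⟨ R.trans (R.+-congʳ (R.+-comm 1# (log x))) (R.+-assoc (log x) 1# 1#) ⟩
    log x + two
      ≲⟨ +-monoʳ-≤ (log x) (two≤log 16≤x) ⟩
    log x + log x
      ≈⟨ R.trans (R.distribʳ (log x) 1# 1#) (R.+-cong (R.*-identityˡ _) (R.*-identityˡ _)) ⟨
    two * log x  ∎
    where
    1<x : 1# < x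
    1<x = <-≤-trans 1<two (≤-trans (≤-respˡ fromℕ-2 (fromℕ-mono {2} {16} (s≤s (s≤s z≤n)))) 16≤x)

  -- From log x ≥ 2 one doubling gives log log x ≥ 1/2.
  1≤4loglog² : ∀ {x} → fromℕ 16 ≤ x → 1# ≤ (two * log (log x)) ^ 2
  1≤4loglog² {x} 16≤x = ≤-respˡ (R.trans (R.*-identityˡ _) (R.*-identityʳ _))
    (^-monoˡ-≤ {1#} 2 (inj₁ 0<1) (begin
      1#                      ≈⟨ ⁻¹-inverseʳ 0<two ⟨
      two * half              ≲⟨ *-monoʳ-≤ two (inj₁ 0<two) (half≤log (two≤log 16≤x)) ⟩
      two * log (log x)       ∎))

  -- The final estimate

  constant : Carrier
  -- The factors 2, 2⁵ and 2² come from 2N ≤ 2x, from the fifth power of the harmonic bound 2 log x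
  -- and from (2 log log x)². The successor makes the constant strictly positive.
  constant = fromℕ (suc (proj₁ ∑f₁≤)) * (two * two ^ 5 * two ^ 2)

  0<constant : 0# < constant
  0<constant = *-positive (0<fromℕ {suc (proj₁ ∑f₁≤)} (s≤s z≤n)) (*-positive (*-positive 0<two (0<^ 5)) (0<^ 2))
    where
    0<^ : ∀ k → 0# < two ^ k
    0<^ zero    = 0<1
    0<^ (suc k) = *-positive 0<two (0<^ k)

  ∑f₁-bound : ∀ x → fromℕ 16 ≤ x →
              fromℕ (∑ₚ< x [ f₁ ]) ≤ constant * x * (log x) ^ 5 * (log (log x)) ^ 2
  ∑f₁-bound x 16≤x = begin
    fromℕ (∑ₚ< x [ f₁ ])
      ≲⟨ fromℕ-mono {∑ₚ< x [ f₁ ]} (ℕ.≤-trans (proj₂ ∑f₁≤ N ps (primesBelow-unique x) λ {p} p∈ →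
           proj₁ (Equivalence.to (∈-primesBelow x p) p∈) , p≤N p∈) (ℕ.m≤n+m (K ℕ.* S) S)) ⟩
    fromℕ (suc K ℕ.* S)
      ≈⟨ fromℕ-* (suc K) S ⟩
    K′ * fromℕ S
      ≲⟨ *-monoʳ-≤ K′ 0≤K′ (∑÷-≤ (2 ℕ.* N) (value N N) 5 (2 ℕ.* N) ℕ.≤-refl) ⟩
    K′ * (fromℕ (2 ℕ.* N) * recips (range (2 ℕ.* N)) ^ 5)
      ≲⟨ *-monoʳ-≤ K′ 0≤K′ (*-mono-≤ (0≤* 0≤two 0≤x) (0≤^ 5 (0≤recips-range (2 ℕ.* N)))
           (≤-respˡ (R.sym (R.trans (fromℕ-* 2 N) (R.*-congʳ fromℕ-2))) (*-monoʳ-≤ two 0≤two N≤x))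
           (^-monoˡ-≤ 5 (0≤recips-range (2 ℕ.* N)) (recips≤2log N 0<N 16≤x N≤x))) ⟩
    K′ * ((two * x) * (two * log x) ^ 5)
      ≈⟨ R.*-identityʳ _ ⟨
    K′ * ((two * x) * (two * log x) ^ 5) * 1#
      ≲⟨ *-monoʳ-≤ _ (0≤* 0≤K′ (0≤* (0≤* 0≤two 0≤x) (0≤^ 5 (0≤* 0≤two 0≤log)))) (1≤4loglog² 16≤x) ⟩
    K′ * ((two * x) * (two * log x) ^ 5) * (two * log (log x)) ^ 2
      ≈⟨ R.*-cong (R.*-congˡ (R.*-congˡ (^-distrib 5 two (log x)))) (^-distrib 2 two (log (log x))) ⟩
    K′ * ((two * x) * (two ^ 5 * log x ^ 5)) * (two ^ 2 * log (log x) ^ 2)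
      ≈⟨ solve 7 (λ k t x t⁵ l⁵ t² l² → (k :* ((t :* x) :* (t⁵ :* l⁵)) :* (t² :* l²)) := (k :* (t :* t⁵ :* t²) :* x :* l⁵ :* l²))
           R.refl K′ two x (two ^ 5) (log x ^ 5) (two ^ 2) (log (log x) ^ 2) ⟩
    constant * x * (log x) ^ 5 * (log (log x)) ^ 2  ∎
    where
    K = proj₁ ∑f₁≤
    K′ = fromℕ (suc K)
    ps = primesBelow x
    N = proj₁ (upper-bound ps)
    0<N = proj₁ (proj₂ (upper-bound ps))
    p≤N = proj₂ (proj₂ (proj₂ (upper-bound ps)))
    S = ∑÷ (value N N) 5 (2 ℕ.* N)
    0≤K′ = 0≤fromℕ (suc K)
    0≤two : 0# ≤ two
    0≤two = inj₁ 0<two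
    0≤log : 0# ≤ log x
    0≤log = ≤-trans 0≤two (two≤log 16≤x)
    0≤x : 0# ≤ x
    0≤x = ≤-trans (0≤fromℕ 16) 16≤x
    N≤x : fromℕ N ≤ x
    N≤x with proj₁ (proj₂ (proj₂ (upper-bound ps)))
    ... | inj₁ N≡1 = ≡.subst (λ n → fromℕ n ≤ x) (≡.sym N≡1) (≤-trans (fromℕ-mono {1} {16} (s≤s z≤n)) 16≤x)
    ... | inj₂ N∈  = inj₁ (proj₂ (Equivalence.to (∈-primesBelow x N) N∈))
    ^-distrib : ∀ k a b → (a * b) ^ k ≈ a ^ k * b ^ k
    ^-distrib zero    a b = R.sym (R.*-identityˡ 1#)
    ^-distrib (suc k) a b = R.trans (R.*-congˡ (^-distrib k a b))
      (solve 4 (λ a b c d → (a :* b :* (c :* d)) := (a :* c :* (b :* d))) R.refl a b (a ^ k) (b ^ k))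

mainTheorem1 : (ℝ : CompleteOrderedField) → let open RealFunctions ℝ in
    ∃[ C ] ∃[ x₀ ] 0# < C ×
    (∀ x → x₀ ≤ x →
    fromℕ (∑ₚ< x [ f₁ ]) ≤ C * x * (log x) ^ 5 * (log (log x)) ^ 2)
mainTheorem1 ℝ = constant , RealFunctions.fromℕ ℝ 16 , 0<constant , ∑f₁-bound
  where open Estimates ℝ
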